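{- Let $X(z)=\operatorname{diag}(z_1,\dots,z_q)$ and define $$\mathcal P(z_1,\dots,z_q):=\sum_{I\subseteq N}\Psi_I\prod_{i\in I}z_i ,$$ where $N=(x_1,\dots,x_q)$ is identified with $\{1,\dots,q\}$ through its fixed order. Then $$\mathcal P(z)=\Phi_{\mathrm{valid}}\det\bigl(I_q+X(z)L\bigr),$$ and $\mathcal P$ is multiaffine, coefficientwise nonnegative and real stable.
   Context: Network. $G=(V,E)$ is a finite connected simple undirected graph; each edge $e$ has a conductance $c_e\in\mathbb R_{>0}$. The weighted Laplacian $L_c$ is the $V\times V$ matrix with $(L_c)_{uu}=\sum_{e\ni u}c_e$, $(L_c)_{uv}=-c_{uv}$ if $uv\in E$, and $0$ otherwise. A spanning forest $F$ of $G$ is an acyclic subgraph with vertex set $V$ (isolated vertices allowed); $w(F)=\prod_{e\in F}c_e$; $\mathcal F_m$ is the set of spanning forests with exactly $m$ connected components. Superports. The boundary $M\subseteq V$ is nonempty and partitioned into nonempty superports $M=A_1\sqcup\cdots\sqcup A_p$. Choose a root $r_a\in A_a$ for each $a$; $R=\{r_1,\dots,r_p\}$, $N=M\setminus R$, $q=|N|$, $N=(x_1,\dots,x_q)$ in a fixed order; $r(x)$ is the root of the superport containing $x$. Superport response. Given $y\in\mathbb R^N$, consider voltages $U\in\mathbb R^V$ with $U_x-U_{r(x)}=y_x$ for all $x\in N$ whose incoming-current vector $\iota=L_cU$ satisfies $\iota_v=0$ for $v\notin M$ and $\sum_{v\in A_a}\iota_v=0$ for every $a$. Put $j_x=\iota_x$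 for $x\in N$ (the independent incoming currents). The linear map $y\mapsto j$ is the superport response and $L$ is its $q\times q$ matrix: $j=Ly$. Valid forests. A spanning forest is valid if identifying all boundary vertices within each superport (one vertex per superport) turns it into a spanning tree of the quotient network (loops and parallel edges count as cycles). $\Phi_{\mathrm{valid}}=\sum_{F\text{ valid}}w(F)$. Quotient port graph and principal numerators. For a spanning forest $F$, the quotient port multigraph $H_F$ has the connected components of $F$ as vertices, and each $x\in N$ gives a directed edge from the component containing $r(x)$ to the component containing $x$ (a loop if these coincide). For $I\subseteq N$ with $|I|=k$, $\Psi_I$ is the sum of $w(F)$ over those $F\in\mathcal F_{q-k+1}$ for which the edge set $N\setminus I$ is a spanning tree of $H_F$; $\Psi_\varnothing:=\Phi_{\mathrm{valid}}$. A real polynomial is real stable if it has no zero $z\in\mathbb C^q$ with $\operatorname{Im}z_i>0$ for all $i$; it is multiaffine if it has degree at most one in each variable. -}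

module Defs where

open import Level using (Level; 0ℓ; _⊔_) renaming (suc to lsuc)
open import Algebra.Apartness.Bundles using (HeytingField)
open import Algebra.Bundles using (RawRing)
import Algebra.Definitions.RawSemiring as RawSemiringDefinitions
open import Data.Bool.Base using (if_then_else_)
open import Data.Fin.Base as Fin using (Fin; zero; suc; toℕ; punchIn)
open import Data.Fin.Properties using (_≟_; all?; any?)
open import Data.Fin.Subset using (Subset; inside; outside; ⊤; ∁; ∣_∣; _∈_; _∉_; _⊆_; ⁅_⁆; _─_) renaming (_-_ to _∖_)
open import Data.Fin.Subset.Properties using (_∈?_; nonempty?; p─q⊆p; x∈p∧x≢y⇒x∈p-y; x∈⁅x⁆)
open import Data.List.Base as List using (List; []; _∷_; _++_; map; filter; allFin; deduplicate; length)
open import Data.List.Membership.Propositional using () renaming (_∈_ to _∈ˡ_; _∉_ to _∉ˡ_)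
open import Data.List.Membership.Propositional.Properties using (∈-filter⁺; ∈-filter⁻; ∈-allFin)
open import Data.List.Relation.Unary.All as All using (All; []; _∷_)
open import Data.List.Relation.Unary.All.Properties using (¬Any⇒All¬; all-filter)
open import Data.List.Relation.Unary.AllPairs using ([]; _∷_)
open import Data.List.Relation.Unary.Any as Any using (Any; here; there)
import Data.List.Relation.Unary.Unique.Setoid as UniqueSetoid
open import Data.Nat.Base as ℕ using (ℕ; zero; suc; NonZero; _∸_)
import Data.Nat.Properties as ℕ
open import Data.Product.Base using (Σ-syntax; ∃-syntax; _×_; _,_; proj₁; proj₂)
open import Data.Sum.Base using (_⊎_; inj₁; inj₂)
open import Data.Vec.Base as Vec using (Vec; []; _∷_; here; there)
import Data.Vec.Properties as Vec
open import Data.Vec.Functional using (Vector)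
open import Function.Bundles using (_⇔_)
open import Relation.Binary.Core using (Rel)
open import Relation.Binary.Bundles using (Setoid)
open import Relation.Binary.Definitions using (Decidable)
open import Relation.Binary.PropositionalEquality as ≡ using (_≡_; _≢_)
open import Relation.Binary.Structures using (IsEquivalence; IsDecEquivalence; IsStrictPartialOrder)
open import Relation.Nullary using (¬_; Dec; does; yes; no; contradiction)
open import Relation.Nullary.Decidable using (map′; _×-dec_; _⊎-dec_; ¬?)
open import Relation.Unary using (Pred) renaming (Decidable to Decidable₁)

private variable
  a ℓ : Level
  n m p q : ℕ

-- The real numbers, axiomatised as a Cauchy-complete Archimedean ordered field.
-- The axioms are the constructive ones (_<_ need not be decidable); in the
-- presence of excluded middle they are equivalent to the usual categorical
-- axioms of a complete ordered field.

record RealNumbers a ℓ : Set (lsuc (a ⊔ ℓ)) where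
  infix 4 _<_ _≤_
  field
    heytingField : HeytingField a ℓ ℓ

  open HeytingField heytingField public using
    ( _≈_; _#_; _+_; _*_; -_; _-_; 0#; 1#; isHeytingField
    ; isHeytingCommutativeRing; isCommutativeRing ) renaming (Carrier to ℝ)

  field
    _<_                  : Rel ℝ ℓ
    isStrictPartialOrder : IsStrictPartialOrder _≈_ _<_
    <⇒#                  : ∀ {x y} → x < y → x # y
    #⇒<⊎>                : ∀ {x y} → x # y → x < y ⊎ y < x
    0<1                  : 0# < 1#
    +-monoˡ-<            : ∀ {x y} z → x < y → x + z < y + z
    *-pos                : ∀ {x y} → 0# < x → 0# < y → 0# < x * y

  rawRing : RawRing a ℓ
  rawRing = record
    { _≈_ = _≈_; _+_ = _+_; _*_ = _*_; -_ = -_; 0# = 0#; 1# = 1# }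

  open RawSemiringDefinitions (RawRing.rawSemiring rawRing) public
    using (sum; product) renaming (_×_ to _·_)

  _≤_ : Rel ℝ ℓ
  x ≤ y = ¬ (y < x)

  Within : ℝ → Rel ℝ ℓ
  Within ε x y = - ε < x - y × x - y < ε

  Cauchy : (ℕ → ℝ) → Set (a ⊔ ℓ)
  Cauchy s = ∀ ε → 0# < ε →
    ∃[ N ] ∀ i j → N ℕ.≤ i → N ℕ.≤ j → Within ε (s i) (s j)

  _ConvergesTo_ : (ℕ → ℝ) → ℝ → Set (a ⊔ ℓ)
  s ConvergesTo x = ∀ ε → 0# < ε →
    ∃[ N ] ∀ i → N ℕ.≤ i → Within ε (s i) x

  field
    archimedean : ∀ x → ∃[ k ] x < k · 1#
    complete    : ∀ s → Cauchy s → ∃[ x ] s ConvergesTo x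

module Complex (R : RealNumbers a ℓ) where
  open RealNumbers R

  record ℂ : Set a where
    constructor _+i_
    field
      re im : ℝ

  open ℂ public

  fromReal : ℝ → ℂ
  fromReal x = x +i 0#

  rawRingℂ : RawRing a ℓ
  rawRingℂ = record
    { Carrier = ℂ
    ; _≈_     = λ w z → re w ≈ re z × im w ≈ im z
    ; _+_     = λ w z → (re w + re z) +i (im w + im z)
    ; _*_     = λ w z → (re w * re z - im w * im z) +i (re w * im z + im w * re z)
    ; -_      = λ z → (- re z) +i (- im z)
    ; 0#      = fromReal 0#
    ; 1#      = fromReal 1#
    }

Matrix : Set a → ℕ → ℕ → Set a
Matrix A k l = Vector (Vector A l) k

module MatrixOperations (A : RawRing a ℓ) where
  open RawRing A
  open RawSemiringDefinitions rawSemiring using (sum; _^_)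

  infixl 6 _+ᴹ_
  infixl 7 _*ᴹ_

  diag : Vector Carrier n → Matrix Carrier n n
  diag d i j = if does (i ≟ j) then d i else 0#

  1ᴹ : Matrix Carrier n n
  1ᴹ = diag (λ _ → 1#)

  _+ᴹ_ : Matrix Carrier n m → Matrix Carrier n m → Matrix Carrier n m
  (M +ᴹ N) i j = M i j + N i j

  _*ᴹ_ : Matrix Carrier n m → Matrix Carrier m p → Matrix Carrier n p
  (M *ᴹ N) i j = sum (λ k → M i k * N k j)

  _*ⱽ_ : Matrix Carrier n m → Vector Carrier m → Vector Carrier n
  (M *ⱽ v) i = sum (λ k → M i k * v k)

  det : Matrix Carrier n n → Carrier
  det {zero}  M = 1#
  det {suc n} M =
    sum (λ j → (- 1#) ^ toℕ j * (M zero j * det (λ i k → M (suc i) (punchIn j k))))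

-- Real polynomials in q variables, as formal sums of terms (coefficient,
-- exponents).  An exponent vector may occur in several terms, so properties
-- are always expressed through coefficient, which collects them.

module Polynomials (R : RealNumbers a ℓ) where
  open RealNumbers R
  open Complex R
  module ℂ-ring = RawRing rawRingℂ
  private module ℂ-ops = RawSemiringDefinitions ℂ-ring.rawSemiring

  Polynomial : ℕ → Set a
  Polynomial q = List (ℝ × Vec ℕ q)

  coefficient : Polynomial q → Vec ℕ q → ℝ
  coefficient P e = List.foldr (λ t s → proj₁ t + s) 0#
    (filter (λ t → Vec.≡-dec ℕ._≟_ (proj₂ t) e) P)

  evaluate : Polynomial q → Vector ℂ q → ℂ
  evaluate P z = List.foldr (λ t s → term t ℂ-ring.+ s) ℂ-ring.0# P
    where
    term : ℝ × Vec ℕ _ → ℂ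
    term (c , e) = fromReal c ℂ-ring.* ℂ-ops.product (λ i → z i ℂ-ops.^ Vec.lookup e i)

  Multiaffine : Polynomial q → Set ℓ
  Multiaffine P = ∀ e i → 1 ℕ.< Vec.lookup e i → coefficient P e ≈ 0#

  CoefficientwiseNonnegative : Polynomial q → Set ℓ
  CoefficientwiseNonnegative P = ∀ e → 0# ≤ coefficient P e

  RealStable : Polynomial q → Set (a ⊔ ℓ)
  RealStable P = ∀ z → (∀ i → 0# < im (z i)) → ¬ (evaluate P z ℂ-ring.≈ ℂ-ring.0#)

subsets : ∀ n → List (Subset n)
subsets zero    = [] ∷ []
subsets (suc n) = map (outside ∷_) (subsets n) ++ map (inside ∷_) (subsets n)

-- A finite multigraph with m edges (loops and parallel edges allowed) whose
-- vertices are the classes of a decidable equivalence relation on Fin n.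

record Multigraph (n m : ℕ) : Set₁ where
  field
    _≈_              : Rel (Fin n) 0ℓ
    isDecEquivalence : IsDecEquivalence _≈_
    source target    : Vector (Fin n) m

  open IsDecEquivalence isDecEquivalence public
    using (isEquivalence; refl; sym; trans) renaming (_≟_ to _≈?_)

  setoid : Setoid 0ℓ 0ℓ
  setoid = record { isEquivalence = isEquivalence }

  open UniqueSetoid setoid using (Unique)

  Joins : Fin m → Fin n → Fin n → Set
  Joins e u v = (source e ≈ u × target e ≈ v) ⊎ (source e ≈ v × target e ≈ u)

  data Walk (T : Subset m) (u v : Fin n) : Set where
    stop : u ≈ v → Walk T u v
    step : ∀ e w → e ∈ T → Joins e u w → Walk T w v → Walk T u v

  vertices : ∀ {T u v} → Walk T u v → List (Fin n)
  vertices {u = u} (stop _)         = u ∷ []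
  vertices {u = u} (step _ _ _ _ w) = u ∷ vertices w

  edges : ∀ {T u v} → Walk T u v → List (Fin m)
  edges (stop _)         = []
  edges (step e _ _ _ w) = e ∷ edges w

  -- A path together with an edge off the path that joins its two ends; in
  -- particular loops and pairs of parallel edges are cycles.
  record Cycle (T : Subset m) : Set where
    field
      start end  : Fin n
      path       : Walk T start end
      distinct   : Unique (vertices path)
      closing    : Fin m
      closing∈T  : closing ∈ T
      closing∉   : closing ∉ˡ edges path
      closes     : Joins closing end start

  Acyclic : Subset m → Set
  Acyclic T = ¬ Cycle T

  Connected : Subset m → Set
  Connected T = ∀ u v → Walk T u v

  SpanningTree : Subset m → Set
  SpanningTree T = Connected T × Acyclic T

  Joins-sym : ∀ {e u v} → Joins e u v → Joins e v u
  Joins-sym (inj₁ x) = inj₂ x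
  Joins-sym (inj₂ x) = inj₁ x

  Joins-respˡ : ∀ {e u u′ v} → u ≈ u′ → Joins e u v → Joins e u′ v
  Joins-respˡ eq (inj₁ (x , y)) = inj₁ (trans x eq , y)
  Joins-respˡ eq (inj₂ (x , y)) = inj₂ (x , trans y eq)

  module _ {T : Subset m} where

    walk-respˡ : ∀ {u u′ v} → u ≈ u′ → Walk T u v → Walk T u′ v
    walk-respˡ eq (stop x)         = stop (trans (sym eq) x)
    walk-respˡ eq (step e w i j x) = step e w i (Joins-respˡ eq j) x

    walk-trans : ∀ {u v w} → Walk T u v → Walk T v w → Walk T u w
    walk-trans (stop x)         ys = walk-respˡ (sym x) ys
    walk-trans (step e w i j x) ys = step e w i j (walk-trans x ys)

    walk-sym : ∀ {u v} → Walk T u v → Walk T v u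
    walk-sym (stop x)         = stop (sym x)
    walk-sym (step e w i j x) =
      walk-trans (walk-sym x) (step e _ i (Joins-sym j) (stop refl))

    walk-isEquivalence : IsEquivalence (Walk T)
    walk-isEquivalence = record
      { refl = stop refl ; sym = walk-sym ; trans = walk-trans }

  -- Decidability of Walk, by adding the edges one at a time.
  Reach : List (Fin m) → Fin n → Fin n → Set
  Reach []       u v = u ≈ v
  Reach (e ∷ es) u v = Reach es u v
                     ⊎ (Reach es u (source e) × Reach es (target e) v)
                     ⊎ (Reach es u (target e) × Reach es (source e) v)

  reach? : ∀ es → Decidable (Reach es)
  reach? []       u v = u ≈? v
  reach? (e ∷ es) u v = reach? es u v
    ⊎-dec (reach? es u (source e) ×-dec reach? es (target e) v)
    ⊎-dec (reach? es u (target e) ×-dec reach? es (source e) v)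

  reach-≈ : ∀ es {u v} → u ≈ v → Reach es u v
  reach-≈ []       x = x
  reach-≈ (e ∷ es) x = inj₁ (reach-≈ es x)

  reach-trans : ∀ es {u v w} → Reach es u v → Reach es v w → Reach es u w
  reach-trans [] = trans
  reach-trans (e ∷ es) x y = go x y
    where
    infixr 5 _∙_
    _∙_ : ∀ {u v w} → Reach es u v → Reach es v w → Reach es u w
    _∙_ = reach-trans es
    go : ∀ {u v w} → Reach (e ∷ es) u v → Reach (e ∷ es) v w → Reach (e ∷ es) u w
    go (inj₁ x) (inj₁ y) = inj₁ (x ∙ y)
    go (inj₁ x) (inj₂ (inj₁ (y , z))) = inj₂ (inj₁ (x ∙ y , z))
    go (inj₁ x) (inj₂ (inj₂ (y , z))) = inj₂ (inj₂ (x ∙ y , z))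
    go (inj₂ (inj₁ (x , y))) (inj₁ z) = inj₂ (inj₁ (x , y ∙ z))
    go (inj₂ (inj₂ (x , y))) (inj₁ z) = inj₂ (inj₂ (x , y ∙ z))
    go (inj₂ (inj₁ (x , _))) (inj₂ (inj₁ (_ , z))) = inj₂ (inj₁ (x , z))
    go (inj₂ (inj₁ (x , _))) (inj₂ (inj₂ (_ , z))) = inj₁ (x ∙ z)
    go (inj₂ (inj₂ (x , _))) (inj₂ (inj₁ (_ , z))) = inj₁ (x ∙ z)
    go (inj₂ (inj₂ (x , _))) (inj₂ (inj₂ (_ , z))) = inj₂ (inj₂ (x , z))

  reach-edge : ∀ {es e u v} → e ∈ˡ es → Joins e u v → Reach es u v
  reach-edge {es = _ ∷ es} (here ≡.refl) (inj₁ (x , y)) =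
    inj₂ (inj₁ (reach-≈ es (sym x) , reach-≈ es y))
  reach-edge {es = _ ∷ es} (here ≡.refl) (inj₂ (x , y)) =
    inj₂ (inj₂ (reach-≈ es (sym y) , reach-≈ es x))
  reach-edge (there i) j = inj₁ (reach-edge i j)

  reach⇒walk : ∀ {T es} → All (_∈ T) es → ∀ {u v} → Reach es u v → Walk T u v
  reach⇒walk [] x = stop x
  reach⇒walk (_ ∷ is) (inj₁ x) = reach⇒walk is x
  reach⇒walk (i ∷ is) (inj₂ (inj₁ (x , y))) = walk-trans (reach⇒walk is x)
    (step _ _ i (inj₁ (refl , refl)) (reach⇒walk is y))
  reach⇒walk (i ∷ is) (inj₂ (inj₂ (x , y))) = walk-trans (reach⇒walk is x)
    (step _ _ i (inj₂ (refl , refl)) (reach⇒walk is y))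

  walk⇒reach : ∀ {T es} → (∀ {e} → e ∈ T → e ∈ˡ es) →
               ∀ {u v} → Walk T u v → Reach es u v
  walk⇒reach {es = es} f (stop x) = reach-≈ es x
  walk⇒reach {es = es} f (step e w i j x) =
    reach-trans es (reach-edge (f i) j) (walk⇒reach f x)

  walk? : ∀ T → Decidable (Walk T)
  walk? T u v = map′
    (reach⇒walk (all-filter (_∈? T) (allFin m)))
    (walk⇒reach (∈-filter⁺ (_∈? T) (∈-allFin _)))
    (reach? (filter (_∈? T) (allFin m)) u v)

  walk-isDecEquivalence : ∀ T → IsDecEquivalence (Walk T)
  walk-isDecEquivalence T = record
    { isEquivalence = walk-isEquivalence ; _≟_ = walk? T }

  #components : Subset m → ℕ
  #components T = length (deduplicate (walk? T) (allFin n))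

  connected? : Decidable₁ Connected
  connected? T = all? λ u → all? λ v → walk? T u v

  -- Decidability of acyclicity: T has a cycle iff some edge e ∈ T has its ends
  -- joined by a walk in T ∖ e.
  e∉T∖e : ∀ {k} {x : Fin k} {s : Subset k} → x ∉ s ∖ x
  e∉T∖e {s = s} i = go s i (x∈⁅x⁆ _)
    where
    go : ∀ {k} {x : Fin k} (s : Subset k) {t} → x ∈ s ─ t → x ∉ t
    go (_ ∷ _) {inside  ∷ _} (there i) (there j) = go _ i j
    go (_ ∷ _) {outside ∷ _} (there i) (there j) = go _ i j

  avoid : ∀ {T e u v} (w : Walk T u v) → e ∉ˡ edges w → Walk (T ∖ e) u v
  avoid (stop x)         _ = stop x
  avoid (step f w i j x) p = step f w
    (x∈p∧x≢y⇒x∈p-y i (λ { ≡.refl → p (here ≡.refl) })) j (avoid x (λ q → p (there q)))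

  Path : Subset m → Fin n → Fin n → Set
  Path T u v = Σ[ w ∈ Walk T u v ] Unique (vertices w)

  suffix : ∀ {T u v x} (w : Walk T u v) → Unique (vertices w) →
           Any (x ≈_) (vertices w) → Path T x v
  suffix (stop y) _ (here x) = stop (trans x y) , ([] ∷ [])
  suffix (step e w i j p) (d ∷ ds) (here x) =
    step e w i (Joins-respˡ (sym x) j) p , (All.map (λ ne eq → ne (trans (sym x) eq)) d ∷ ds)
  suffix (step e w i j p) (_ ∷ ds) (there k) = suffix p ds k

  walk⇒path : ∀ {T u v} → Walk T u v → Path T u v
  walk⇒path (stop x) = stop x , ([] ∷ [])
  walk⇒path {u = u} (step e w i j x) with walk⇒path x
  ... | p , d with Any.any? (u ≈?_) (vertices p)
  ...   | yes k = suffix p d k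
  ...   | no ¬k = step e w i j p , (¬Any⇒All¬ _ ¬k ∷ d)

  weaken : ∀ {T e u v} → Walk (T ∖ e) u v → Walk T u v
  weaken (stop x)         = stop x
  weaken (step f w i j x) = step f w (p─q⊆p _ _ i) j (weaken x)

  weaken-vertices : ∀ {T e u v} (w : Walk (T ∖ e) u v) → vertices (weaken {T} w) ≡ vertices w
  weaken-vertices (stop x)         = ≡.refl
  weaken-vertices (step _ _ _ _ w) = ≡.cong (_ ∷_) (weaken-vertices w)

  weaken-edges : ∀ {T e u v} (w : Walk (T ∖ e) u v) → e ∉ˡ edges (weaken {T} w)
  weaken-edges (step _ _ i _ _) (here ≡.refl) = e∉T∖e i
  weaken-edges (step _ _ _ _ w) (there k)     = weaken-edges w k

  Redundant : Subset m → Fin m → Set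
  Redundant T e = e ∈ T × Walk (T ∖ e) (source e) (target e)

  redundant⇒cycle : ∀ {T} → ∃[ e ] Redundant T e → Cycle T
  redundant⇒cycle (e , i , w) with walk⇒path w
  ... | p , d = record
    { path      = weaken p
    ; distinct  = ≡.subst Unique (≡.sym (weaken-vertices p)) d
    ; closing   = e
    ; closing∈T = i
    ; closing∉  = weaken-edges p
    ; closes    = inj₂ (refl , refl)
    }

  cycle⇒redundant : ∀ {T} → Cycle T → ∃[ e ] Redundant T e
  cycle⇒redundant {T} c = closing , closing∈T , ends closes
    where
    open Cycle c
    w : Walk (T ∖ closing) start end
    w = avoid path closing∉
    ends : Joins closing end start → Walk (T ∖ closing) (source closing) (target closing)
    ends (inj₁ (x , y)) = walk-trans (stop x) (walk-trans (walk-sym w) (stop (sym y)))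
    ends (inj₂ (x , y)) = walk-trans (stop x) (walk-trans w (stop (sym y)))

  acyclic? : Decidable₁ Acyclic
  acyclic? T = ¬? (map′ redundant⇒cycle cycle⇒redundant
    (any? λ e → (e ∈? T) ×-dec walk? (T ∖ e) (source e) (target e)))

  spanningTree? : Decidable₁ SpanningTree
  spanningTree? T = connected? T ×-dec acyclic? T

-- A finite connected simple graph with vertex set Fin n and m edges, each edge
-- {u , v} being recorded once, as its ordered pair of ends.

record Network (R : RealNumbers a ℓ) (n m : ℕ) : Set (a ⊔ ℓ) where
  open RealNumbers R
  field
    source target : Vector (Fin n) m
    source<target : ∀ e → source e Fin.< target e
    simple        : ∀ e f → source e ≡ source f → target e ≡ target f → e ≡ f

  graph : Multigraph n m
  graph = record
    { _≈_              = _≡_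
    ; isDecEquivalence = record { isEquivalence = ≡.isEquivalence ; _≟_ = _≟_ }
    ; source           = source
    ; target           = target
    }

  open Multigraph graph using (Connected; Joins; Acyclic; acyclic?; #components)

  field
    connected     : Connected ⊤
    conductance   : Vector ℝ m
    conductance>0 : ∀ e → 0# < conductance e

  incident? : ∀ e u → Dec (source e ≡ u ⊎ target e ≡ u)
  incident? e u = (source e ≟ u) ⊎-dec (target e ≟ u)

  joins? : ∀ u v e → Dec (Joins e u v)
  joins? u v e = ((source e ≟ u) ×-dec (target e ≟ v))
           ⊎-dec ((source e ≟ v) ×-dec (target e ≟ u))

  laplacian : Matrix ℝ n n
  laplacian u v with u ≟ v | any? (joins? u v)
  ... | yes _ | _           = sum (λ e → if does (incident? e u) then conductance e else 0#)
  ... | no _  | yes (e , _) = - conductance e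
  ... | no _  | no _        = 0#

  weight : Subset m → ℝ
  weight F = product (λ e → if does (e ∈? F) then conductance e else 1#)

  SpanningForest : Subset m → Set
  SpanningForest = Acyclic

  SpanningForestWith : ℕ → Subset m → Set
  SpanningForestWith k F = SpanningForest F × #components F ≡ k

  spanningForestWith? : ∀ k → Decidable₁ (SpanningForestWith k)
  spanningForestWith? k F = acyclic? F ×-dec (#components F ℕ.≟ k)

  weightSum : {P : Pred (Subset m) 0ℓ} → Decidable₁ P → ℝ
  weightSum P? = List.foldr (λ F s → weight F + s) 0# (filter P? (subsets m))

-- The superports A a (a : Fin p) with their roots, and the enumeration
-- x of the non-root boundary vertices; x i lies in the superport A (port i).

record Superports (n p q : ℕ) : Set where
  field
    p≢0      : NonZero p
    A        : Fin p → Subset n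
    disjoint : ∀ {a b v} → v ∈ A a → v ∈ A b → a ≡ b
    root     : Fin p → Fin n
    root∈    : ∀ a → root a ∈ A a
    x        : Fin q → Fin n
    port     : Fin q → Fin p
    x∈       : ∀ i → x i ∈ A (port i)
    x≢root   : ∀ i → x i ≢ root (port i)
    x-inj    : ∀ {i j} → x i ≡ x j → i ≡ j
    x-all    : ∀ {a v} → v ∈ A a → v ≢ root a → ∃[ i ] x i ≡ v

  Boundary : Fin n → Set
  Boundary v = ∃[ a ] v ∈ A a

  rootOf : Fin q → Fin n
  rootOf i = root (port i)

  Identified : Rel (Fin n) 0ℓ
  Identified u v = u ≡ v ⊎ (∃[ a ] u ∈ A a × v ∈ A a)

  identified-isDecEquivalence : IsDecEquivalence Identified
  identified-isDecEquivalence = record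
    { isEquivalence = record { refl = inj₁ ≡.refl ; sym = sym ; trans = trans }
    ; _≟_ = λ u v → (u ≟ v) ⊎-dec any? (λ a → (u ∈? A a) ×-dec (v ∈? A a))
    }
    where
    sym : ∀ {u v} → Identified u v → Identified v u
    sym (inj₁ eq)          = inj₁ (≡.sym eq)
    sym (inj₂ (a , i , j)) = inj₂ (a , j , i)
    trans : ∀ {u v w} → Identified u v → Identified v w → Identified u w
    trans (inj₁ ≡.refl) y = y
    trans x (inj₁ ≡.refl) = x
    trans (inj₂ (a , i , j)) (inj₂ (b , k , l)) with disjoint j k
    ... | ≡.refl = inj₂ (a , i , l)

module SuperportNetwork {R : RealNumbers a ℓ} (G : Network R n m) (S : Superports n p q) where
  open RealNumbers R
  open MatrixOperations rawRing using (_*ⱽ_)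
  open Polynomials R using (Polynomial)
  open Network G
  open Superports S
  open Multigraph graph using (Walk; walk-isDecEquivalence; acyclic?)

  currents : Vector ℝ n → Vector ℝ n
  currents U = laplacian *ⱽ U

  record Admissible (y : Vector ℝ q) (U : Vector ℝ n) : Set ℓ where
    field
      voltages : ∀ i → U (x i) - U (rootOf i) ≈ y i
      interior : ∀ v → ¬ Boundary v → currents U v ≈ 0#
      balanced : ∀ a → sum (λ v → if does (v ∈? A a) then currents U v else 0#) ≈ 0#

  -- The graph of the linear map y ↦ j.
  Response : Vector ℝ q → Vector ℝ q → Set (a ⊔ ℓ)
  Response y j = ∃[ U ] Admissible y U × (∀ i → j i ≈ currents U (x i))

  IsSuperportResponse : Matrix ℝ q q → Set (a ⊔ ℓ)
  IsSuperportResponse L = ∀ y j → Response y j ⇔ (∀ i → j i ≈ (L *ⱽ y) i)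

  quotientNetwork : Multigraph n m
  quotientNetwork = record
    { _≈_              = Identified
    ; isDecEquivalence = identified-isDecEquivalence
    ; source           = source
    ; target           = target
    }

  Valid : Subset m → Set
  Valid F = SpanningForest F × Multigraph.SpanningTree quotientNetwork F

  valid? : Decidable₁ Valid
  valid? F = acyclic? F ×-dec Multigraph.spanningTree? quotientNetwork F

  Φ-valid : ℝ
  Φ-valid = weightSum valid?

  portGraph : Subset m → Multigraph n q
  portGraph F = record
    { _≈_              = Walk F
    ; isDecEquivalence = walk-isDecEquivalence F
    ; source           = rootOf
    ; target           = x
    }

  Contributes : Subset q → Subset m → Set
  Contributes I F = SpanningForestWith (q ∸ ∣ I ∣ ℕ.+ 1) F
                  × Multigraph.SpanningTree (portGraph F) (∁ I)

  contributes? : ∀ I → Decidable₁ (Contributes I)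
  contributes? I F = spanningForestWith? (q ∸ ∣ I ∣ ℕ.+ 1) F
               ×-dec Multigraph.spanningTree? (portGraph F) (∁ I)

  Ψ : Subset q → ℝ
  Ψ I = if does (nonempty? I) then weightSum (contributes? I) else Φ-valid

  monomial : Subset q → Vec ℕ q
  monomial I = Vec.tabulate (λ i → if does (i ∈? I) then 1 else 0)

  𝒫 : Polynomial q
  𝒫 = map (λ I → Ψ I , monomial I) (subsets q)

{-# OPTIONS --safe #-}
module Submission where

open import Algebra.Apartness.Structures using (IsHeytingField)
open import Algebra.Bundles using (CommutativeRing; RawRing)
import Algebra.Definitions.RawSemiring as RawSemiringDefinitions
import Algebra.Properties.AbelianGroup as AbelianGroupProperties
import Algebra.Properties.CommutativeSemigroup as CommutativeSemigroupProperties
import Algebra.Properties.Ring as RingProperties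
import Algebra.Properties.Semiring.Exp as SemiringExp
import Algebra.Properties.Semiring.Mult.TCOptimised as SemiringMult
import Algebra.Properties.Semiring.Sum as SemiringSum
import Algebra.Solver.Ring
open import Algebra.Solver.Ring.AlmostCommutativeRing using (fromCommutativeRing; _-Raw-AlmostCommutative⟶_)
open import Data.Bool.Base using (true; false; if_then_else_)
open import Data.Fin.Base as Fin using (Fin; zero; suc; toℕ; punchIn; pinch)
import Data.Fin.Properties as Fin
open import Data.Fin.Properties using (_≟_; any?; all?; injective⇒≤)
open import Data.Fin.Subset using (Subset; inside; outside; ⊤; ∁; ∣_∣; Empty; _∈_; _∉_; _⊆_) renaming (_-_ to _∖_)
open import Data.Fin.Subset.Properties
  using (_∈?_; nonempty?; ∈⊤; ⊆⊤; ⊆-antisym; drop-there; out⊆; s⊆s; p─q⊆p; x∈p∧x≢y⇒x∈p-y; x∉p⇒x∈∁p; ∣∁p∣≡n∸∣p∣)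
open import Data.List.Base as List using (List; []; _∷_; _++_; map; filter; allFin; deduplicate)
open import Data.List.Membership.Propositional.Properties using (∈-allFin; ∈-lookup)
import Data.List.Relation.Unary.All as All
open import Data.List.Relation.Unary.AllPairs using (AllPairs; _∷_)
open import Data.List.Relation.Unary.Any as Any using (Any)
import Data.List.Relation.Unary.Any.Properties as Any
import Data.List.Relation.Unary.Unique.DecSetoid.Properties as UniqueDecSetoid
open import Data.Maybe.Base using (Maybe; just; nothing)
open import Data.Nat.Base as ℕ using (ℕ; zero; suc)
import Data.Nat.Properties as ℕ
open import Data.Product.Base using (∃-syntax; _×_; _,_; proj₁; proj₂)
open import Data.Sum.Base as Sum using (_⊎_; inj₁; inj₂)
open import Data.Unit.Base using (tt) renaming (⊤ to Unit)
open import Data.Vec.Base as Vec using (Vec; []; _∷_; here; there)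
open import Data.Vec.Functional as Vector using (Vector) renaming (_∷_ to infixr 5 _◂_)
import Data.Vec.Properties as Vec
open import Function.Base using (_∘_; id)
open import Function.Bundles using (_⇔_; mk⇔; Equivalence)
open import Level using (Level; 0ℓ; _⊔_)
open import Relation.Binary.Bundles using (DecSetoid)
open import Relation.Binary.Core using (Rel)
open import Relation.Binary.PropositionalEquality as ≡ using (_≡_; _≢_)
import Relation.Binary.Reasoning.Setoid as SetoidReasoning
open import Relation.Binary.Structures using (IsEquivalence; IsDecEquivalence; IsStrictPartialOrder)
open import Relation.Nullary using (¬_; Dec; does; yes; no; contradiction)
open import Relation.Nullary.Decidable using (dec-true; dec-false)
open import Relation.Unary using (Pred; Decidable)

open import Defs

-- Regard the pairs (root, xᵢ) as additional edges, the ports. By deletion and contraction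
-- of the ports, 𝒫 z is the sum over the spanning trees T of the enlarged graph of the
-- weight of the network edges in T times the zᵢ of the ports outside T. Contracting
-- the first port replaces L by its submatrix without the first row and column; deleting
-- the port replaces L by the Schur complement of L₀₀, and multiplies Φ by L₀₀. Since
-- det (I + X L) satisfies the same recursion, the formula follows by induction on the
-- number of ports. The factor L₀₀ is Kirchhoff's effective conductance; it is found from
-- an explicit potential, itself defined by deletion and contraction of the network edges,
-- which allows its current law to be proved by induction on the edges.
--
-- Stability: as L is real symmetric, the matrix - X⁻¹ (I + X L) = - X⁻¹ - L has its
-- numerical range in the open upper half plane when all zᵢ lie there. This property passes
-- to Schur complements and makes the pivots invertible, so det (I + X L) is not zero.

-- The vertex set and the edges stay fixed; a labelling of the vertices records the contractions
-- made so far, so deletion and contraction become recursion on the number of edges. Current laws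
-- cannot be kept vertex by vertex, because contraction adds the currents of merged vertices. In
-- weak form, tested against potentials constant on the classes, contraction merely restricts the
-- test potentials. The obstacle lies in the induction for Kirchhoff's potential: a test potential
-- constant on the classes of `ρ` need not be constant along the contracted edge. This forces the
-- separate identity `voltage-kirchhoff` for the contracted term, and the splitting of test
-- potentials in it. Equality and order of reals are not assumed decidable. Hence pivots come with
-- explicit inverses, obtained from the positive tree sums of a connected network or from a positive
-- norm. That a response exists for all port voltages is also used combinatorially: it shows that
-- the ports contain no cycle.

module RingSolver {c ℓ} (K : CommutativeRing c ℓ) where
  open CommutativeRing K hiding (zero)
  open RingProperties ring using (-0#≈0#; x[y-z]≈xy-xz; [y-z]x≈yx-zx)
  open AbelianGroupProperties +-abelianGroup using (⁻¹-anti-homo‿-; ⁻¹-∙-comm; x∙y⁻¹≈ε⇒x≈y)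
  open CommutativeSemigroupProperties +-commutativeSemigroup using (interchange)
  open SemiringMult semiring using (×-homo-+; ×1-homo-*) renaming (_×_ to _·_)
  open SetoidReasoning setoid

  -- Integer coefficients, a pair (m , n) standing for m - n.
  coefficients : RawRing _ _
  coefficients = record
    { Carrier = ℕ × ℕ
    ; _≈_     = _≡_
    ; _+_     = λ (m , n) (m′ , n′) → m ℕ.+ m′ , n ℕ.+ n′
    ; _*_     = λ (m , n) (m′ , n′) → m ℕ.* m′ ℕ.+ n ℕ.* n′ , m ℕ.* n′ ℕ.+ n ℕ.* m′
    ; -_      = λ (m , n) → n , m
    ; 0#      = 0 , 0
    ; 1#      = 1 , 0
    }

  -- The case `n = 0` is kept apart so that `(0 , 0)` and `(1 , 0)` reduce to `0#` and `1#` by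
  -- computation, and solver goals with these constants close by `refl`.
  ⟦_⟧ᶜ : ℕ × ℕ → Carrier
  ⟦ m , 0 ⟧ᶜ          = m · 1#
  ⟦ m , n@(suc _) ⟧ᶜ = m · 1# - n · 1#

  ⟦⟧ᶜ-difference : ∀ m n → ⟦ m , n ⟧ᶜ ≈ m · 1# - n · 1#
  ⟦⟧ᶜ-difference m zero    = sym (trans (+-congˡ -0#≈0#) (+-identityʳ _))
  ⟦⟧ᶜ-difference m (suc n) = refl

  difference-+ : ∀ x y z w → (x + y) - (z + w) ≈ (x - z) + (y - w)
  difference-+ x y z w = trans (+-congˡ (sym (⁻¹-∙-comm z w))) (interchange x y (- z) (- w))

  difference-* : ∀ x y z w → (x * z + y * w) - (x * w + y * z) ≈ (x - y) * (z - w)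
  difference-* x y z w = begin
    (x * z + y * w) - (x * w + y * z)     ≈⟨ difference-+ _ _ _ _ ⟩
    (x * z - x * w) + (y * w - y * z)     ≈⟨ +-congˡ (⁻¹-anti-homo‿- _ _) ⟨
    (x * z - x * w) - (y * z - y * w)     ≈⟨ +-cong (x[y-z]≈xy-xz x z w) (-‿cong (x[y-z]≈xy-xz y z w)) ⟨
    x * (z - w) - y * (z - w)             ≈⟨ [y-z]x≈yx-zx (z - w) x y ⟨
    (x - y) * (z - w)                     ∎

  morphism : coefficients -Raw-AlmostCommutative⟶ fromCommutativeRing K
  morphism = record
    { ⟦_⟧    = ⟦_⟧ᶜ
    ; +-homo = λ (m , n) (m′ , n′) → begin
        ⟦ m ℕ.+ m′ , n ℕ.+ n′ ⟧ᶜ                 ≈⟨ ⟦⟧ᶜ-difference (m ℕ.+ m′) (n ℕ.+ n′) ⟩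
        (m ℕ.+ m′) · 1# - (n ℕ.+ n′) · 1#       ≈⟨ +-cong (×-homo-+ 1# m m′) (-‿cong (×-homo-+ 1# n n′)) ⟩
        (m · 1# + m′ · 1#) - (n · 1# + n′ · 1#) ≈⟨ difference-+ _ _ _ _ ⟩
        (m · 1# - n · 1#) + (m′ · 1# - n′ · 1#) ≈⟨ +-cong (⟦⟧ᶜ-difference m n) (⟦⟧ᶜ-difference m′ n′) ⟨
        ⟦ m , n ⟧ᶜ + ⟦ m′ , n′ ⟧ᶜ                ∎
    ; *-homo = λ (m , n) (m′ , n′) → begin
        ⟦ m ℕ.* m′ ℕ.+ n ℕ.* n′ , m ℕ.* n′ ℕ.+ n ℕ.* m′ ⟧ᶜ ≈⟨ ⟦⟧ᶜ-difference (m ℕ.* m′ ℕ.+ n ℕ.* n′)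
            (m ℕ.* n′ ℕ.+ n ℕ.* m′) ⟩
        (m ℕ.* m′ ℕ.+ n ℕ.* n′) · 1# - (m ℕ.* n′ ℕ.+ n ℕ.* m′) · 1# ≈⟨ +-cong (sums m m′ n n′)
            (-‿cong (sums m n′ n m′)) ⟩
        _ ≈⟨ difference-* _ _ _ _ ⟩
        (m · 1# - n · 1#) * (m′ · 1# - n′ · 1#) ≈⟨ *-cong (⟦⟧ᶜ-difference m n) (⟦⟧ᶜ-difference m′ n′) ⟨
        ⟦ m , n ⟧ᶜ * ⟦ m′ , n′ ⟧ᶜ                ∎
    ; -‿homo = λ (m , n) → begin
        ⟦ n , m ⟧ᶜ           ≈⟨ ⟦⟧ᶜ-difference n m ⟩
        n · 1# - m · 1#     ≈⟨ ⁻¹-anti-homo‿- _ _ ⟨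
        - (m · 1# - n · 1#) ≈⟨ -‿cong (⟦⟧ᶜ-difference m n) ⟨
        - ⟦ m , n ⟧ᶜ         ∎
    ; 0-homo = refl
    ; 1-homo = refl
    }
    where
    sums : ∀ a b c d → (a ℕ.* b ℕ.+ c ℕ.* d) · 1# ≈ (a · 1#) * (b · 1#) + (c · 1#) * (d · 1#)
    sums a b c d = trans (×-homo-+ 1# (a ℕ.* b) (c ℕ.* d)) (+-cong (×1-homo-* a b) (×1-homo-* c d))

  -- Pairs are compared by their difference, as in the construction of the integers from the
  -- naturals. Thus the solver sees that `1 - 1` cancels, whichever pair represents it.
  _≟ᶜ_ : ∀ x y → Maybe (⟦ x ⟧ᶜ ≈ ⟦ y ⟧ᶜ)
  (m , n) ≟ᶜ (m′ , n′) with m ℕ.+ n′ ℕ.≟ m′ ℕ.+ n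
  ... | no _   = nothing
  ... | yes eq = just (x∙y⁻¹≈ε⇒x≈y _ _ (begin
    ⟦ m , n ⟧ᶜ - ⟦ m′ , n′ ⟧ᶜ                 ≈⟨ +-congˡ (-‿homo (m′ , n′)) ⟨
    ⟦ m , n ⟧ᶜ + ⟦ n′ , m′ ⟧ᶜ                 ≈⟨ +-homo (m , n) (n′ , m′) ⟨
    ⟦ m ℕ.+ n′ , n ℕ.+ m′ ⟧ᶜ                  ≈⟨ ⟦⟧ᶜ-difference (m ℕ.+ n′) (n ℕ.+ m′) ⟩
    (m ℕ.+ n′) · 1# - (n ℕ.+ m′) · 1#         ≡⟨ ≡.cong (λ k → k · 1# - (n ℕ.+ m′) · 1#) (≡.trans eq (ℕ.+-comm m′ n)) ⟩
    (n ℕ.+ m′) · 1# - (n ℕ.+ m′) · 1#         ≈⟨ -‿inverseʳ _ ⟩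
    0#                                        ∎))
    where open _-Raw-AlmostCommutative⟶_ morphism using (+-homo; -‿homo)

  open Algebra.Solver.Ring coefficients (fromCommutativeRing K) morphism _≟ᶜ_ public
    using (solve; _:=_; _:+_; _:*_; _:-_; :-_; con)

-- Finite sums and determinants over a commutative ring.

punchIn-punchIn : ∀ {n} (j : Fin (suc (suc n))) (k : Fin (suc n)) (i : Fin n) →
  punchIn (punchIn j k) (punchIn (pinch k j) i) ≡ punchIn j (punchIn k i)
punchIn-punchIn zero    k       i       = ≡.refl
punchIn-punchIn (suc j) zero    i       = ≡.refl
punchIn-punchIn (suc j) (suc k) zero    = ≡.refl
punchIn-punchIn (suc j) (suc k) (suc i) = ≡.cong suc (punchIn-punchIn j k i)

-- The pair `(j , k)` codes the two distinct columns `j` and `punchIn j k`. Passing to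
-- `(punchIn j k , pinch k j)` exchanges them, and by `punchIn-punchIn` the list of remaining
-- columns is unchanged.
punchIn-pinch : ∀ {n} (j : Fin (suc n)) (k : Fin n) → punchIn (punchIn j k) (pinch k j) ≡ j
punchIn-pinch zero    zero    = ≡.refl
punchIn-pinch zero    (suc k) = ≡.refl
punchIn-pinch (suc j) zero    = ≡.refl
punchIn-pinch (suc j) (suc k) = ≡.cong suc (punchIn-pinch j k)

module Sums {c ℓ} (K : CommutativeRing c ℓ) where
  open CommutativeRing K hiding (zero)
  open SetoidReasoning setoid
  open SemiringSum semiring public using
      (sum; sum-replicate-zero; ∑-distrib-+; ∑-comm; *-distribˡ-sum; *-distribʳ-sum; sum-cong-≋)

  sum-cong : ∀ {n} {f g : Vector Carrier n} → (∀ i → f i ≈ g i) → sum f ≈ sum g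
  sum-cong = sum-cong-≋

  sum-zero : ∀ {n} {f : Vector Carrier n} → (∀ i → f i ≈ 0#) → sum f ≈ 0#
  sum-zero {n} f≈0 = trans (sum-cong f≈0) (sum-replicate-zero n)

  sum-indicator : ∀ {n} (i : Fin n) (f : Vector Carrier n) → sum (λ k → if does (i ≟ k) then f k else 0#) ≈ f i
  sum-indicator {suc n} zero f = trans (+-congˡ (sum-replicate-zero n)) (+-identityʳ _)
  sum-indicator (suc i) f = trans (+-identityˡ _) (sum-indicator i (f ∘ suc))

  sum-injective : ∀ {n q} (x : Fin q → Fin n) → (∀ {i j} → x i ≡ x j → i ≡ j) → ∀ (f : Vector Carrier n) →
    (∀ v → (∀ i → x i ≢ v) → f v ≈ 0#) → sum f ≈ sum (f ∘ x)
  sum-injective {n} {q} x x-inj f f≈0 = begin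
    sum f                                                    ≈⟨ sum-cong (λ v → sym (fibre v (any? λ i → x i ≟ v))) ⟩
    sum (λ v → sum (λ i → if does (x i ≟ v) then f v else 0#)) ≈⟨ ∑-comm (λ v i → if does (x i ≟ v) then f v else 0#) ⟩
    sum (λ i → sum (λ v → if does (x i ≟ v) then f v else 0#)) ≈⟨ sum-cong (λ i → sum-indicator (x i) f) ⟩
    sum (f ∘ x)                                              ∎
    where
    fibre : ∀ v → Dec (∃[ i ] x i ≡ v) → sum (λ i → if does (x i ≟ v) then f v else 0#) ≈ f v
    fibre v (no ¬i) = trans (sum-zero λ i → outside-image i) (sym (f≈0 v λ i eq → ¬i (i , eq)))
      where
      outside-image : ∀ i → (if does (x i ≟ v) then f v else 0#) ≈ 0#
      outside-image i with x i ≟ v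
      ... | yes eq = contradiction (i , eq) ¬i
      ... | no _   = refl
    fibre v (yes (k , ≡.refl)) = trans (sum-cong same) (sum-indicator k (λ _ → f v))
      where
      same : ∀ i → (if does (x i ≟ x k) then f v else 0#) ≈ (if does (k ≟ i) then f v else 0#)
      same i with x i ≟ x k | k ≟ i
      ... | yes _  | yes _      = refl
      ... | no _   | no _       = refl
      ... | yes eq | no k≢i     = contradiction (≡.sym (x-inj eq)) k≢i
      ... | no xi≢ | yes ≡.refl = contradiction ≡.refl xi≢

module Determinant {c ℓ} (K : CommutativeRing c ℓ) where
  open CommutativeRing K hiding (zero)
  open RingSolver K
  open Sums K
  open SemiringExp semiring using (_^_)
  open SetoidReasoning setoid
  open MatrixOperations rawRing using (det; 1ᴹ; diag; _+ᴹ_; _*ᴹ_; _*ⱽ_)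

  minor : ∀ {n m} → Matrix Carrier n (suc m) → Fin (suc m) → Matrix Carrier n m
  minor M j i k = M i (punchIn j k)

  cofactorTerm : ∀ {n} → Vector Carrier (suc n) → Matrix Carrier n (suc n) → Fin (suc n) → Carrier
  cofactorTerm r M j = (- 1#) ^ toℕ j * (r j * det (minor M j))

  det-cong : ∀ {n} (M N : Matrix Carrier n n) → (∀ i j → M i j ≈ N i j) → det M ≈ det N
  det-cong {zero}  M N M≈N = refl
  det-cong {suc n} M N M≈N = sum-cong {f = cofactorTerm (M zero) (M ∘ suc)} {cofactorTerm (N zero) (N ∘ suc)} λ j →
    *-congˡ {(- 1#) ^ toℕ j} (*-cong (M≈N zero j)
      (det-cong (minor (M ∘ suc) j) (minor (N ∘ suc) j) λ i k → M≈N (suc i) (punchIn j k)))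

  det-◂ : ∀ {n} (M : Matrix Carrier (suc n) (suc n)) → det M ≈ det (M zero ◂ M ∘ suc)
  det-◂ M = det-cong M (M zero ◂ M ∘ suc) λ { zero j → refl ; (suc i) j → refl }

  det-◂-cong : ∀ {n} (r : Vector Carrier (suc n)) (M N : Matrix Carrier n (suc n)) →
    (∀ i j → M i j ≈ N i j) → det (r ◂ M) ≈ det (r ◂ N)
  det-◂-cong r M N M≈N = det-cong (r ◂ M) (r ◂ N) λ { zero j → refl ; (suc i) j → M≈N i j }

  det-linear : ∀ {n} (r r′ : Vector Carrier (suc n)) x (M : Matrix Carrier n (suc n)) →
    det ((λ j → r j + x * r′ j) ◂ M) ≈ det (r ◂ M) + x * det (r′ ◂ M)
  det-linear r r′ x M = begin
    sum (λ j → sgn j * ((r j + x * r′ j) * d j))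
      ≈⟨ sum-cong {f = λ j → sgn j * ((r j + x * r′ j) * d j)} {λ j → sgn j * (r j * d j) + x * (sgn j * (r′ j * d j))}
           (λ j → solve 5 (λ s r x r′ d → s :* ((r :+ x :* r′) :* d) := s :* (r :* d) :+ x :* (s :* (r′ :* d)))
               refl (sgn j) (r j) x (r′ j) (d j)) ⟩
    sum (λ j → sgn j * (r j * d j) + x * (sgn j * (r′ j * d j)))
      ≈⟨ ∑-distrib-+ (λ j → sgn j * (r j * d j)) (λ j → x * (sgn j * (r′ j * d j))) ⟩
    det (r ◂ M) + sum (λ j → x * (sgn j * (r′ j * d j)))
      ≈⟨ +-congˡ (*-distribˡ-sum x (λ j → sgn j * (r′ j * d j))) ⟨
    det (r ◂ M) + x * det (r′ ◂ M) ∎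
    where
    sgn d : Vector Carrier _
    sgn j = (- 1#) ^ toℕ j
    d j = det (minor M j)

  -- Proved together with `det-lowerBlock`: in the expansion along the first row, a minor that omits
  -- a later column still contains the first one, which is zero below the top row.
  det-zeroColumn : ∀ {n} (M : Matrix Carrier (suc n) (suc n)) → (∀ i → M i zero ≈ 0#) → det M ≈ 0#
  det-lowerBlock : ∀ {n} (M : Matrix Carrier (suc n) (suc n)) → (∀ i → M (suc i) zero ≈ 0#) →
    det M ≈ M zero zero * det (λ i j → M (suc i) (suc j))

  det-zeroColumn M M≈0 = begin
    det M                                              ≈⟨ det-lowerBlock M (M≈0 ∘ suc) ⟩
    M zero zero * det (λ i j → M (suc i) (suc j))      ≈⟨ *-congʳ (M≈0 zero) ⟩
    0# * det (λ i j → M (suc i) (suc j))               ≈⟨ zeroˡ _ ⟩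
    0#                                                 ∎

  det-lowerBlock {zero} M M≈0 = trans (+-identityʳ _) (*-identityˡ _)
  det-lowerBlock {suc n} M M≈0 = trans
      (+-cong (*-identityˡ _) (sum-zero {f = cofactorTerm (M zero) (M ∘ suc) ∘ suc} λ j →
    trans (*-congˡ {(- 1#) ^ toℕ (suc j)}
        (trans (*-congˡ {M zero (suc j)} (det-zeroColumn (minor (M ∘ suc) (suc j)) M≈0))
      (zeroʳ _))) (zeroʳ _)))
    (+-identityʳ _)

  det-unitRow : ∀ {n} (r : Vector Carrier (suc n)) (M : Matrix Carrier n (suc n)) →
    r zero ≈ 1# → (∀ j → r (suc j) ≈ 0#) → det (r ◂ M) ≈ det (minor M zero)
  det-unitRow r M r₀ r₊ = trans
    (+-cong (trans (*-identityˡ _) (trans (*-congʳ r₀) (*-identityˡ _)))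
            (sum-zero {f = cofactorTerm r M ∘ suc} λ j →
              trans (*-congˡ {(- 1#) ^ toℕ (suc j)} (trans (*-congʳ {det (minor M (suc j))} (r₊ j)) (zeroˡ _)))
                  (zeroʳ _)))
    (+-identityʳ _)

  -- Exchanging the two chosen columns has no fixed point, so terms cancel in pairs, and equal rows
  -- give 0 even in characteristic 2. The pairs involving column 0 cancel among themselves; the
  -- others form the same pattern one size down.
  antisymmetric-sum : ∀ {n} (F : Fin (suc n) → Fin n → Carrier) →
    (∀ j k → F j k + F (punchIn j k) (pinch k j) ≈ 0#) → sum (λ j → sum (F j)) ≈ 0#
  antisymmetric-sum {zero}  F anti = +-identityʳ _
  antisymmetric-sum {suc n} F anti = begin
    sum (F zero) + sum (λ j → F (suc j) zero + sum (F (suc j) ∘ suc))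
      ≈⟨ +-congˡ (∑-distrib-+ (λ j → F (suc j) zero) (λ j → sum (F (suc j) ∘ suc))) ⟩
    sum (F zero) + (sum (λ j → F (suc j) zero) + sum (λ j → sum (F (suc j) ∘ suc)))
      ≈⟨ +-assoc _ _ _ ⟨
    (sum (F zero) + sum (λ j → F (suc j) zero)) + sum (λ j → sum (F (suc j) ∘ suc))
      ≈⟨ +-cong (trans (sym (∑-distrib-+ (F zero) (λ j → F (suc j) zero)))
           (sum-zero {f = λ k → F zero k + F (suc k) zero} λ { zero → anti zero zero ; (suc k) → anti zero (suc k) }))
                (antisymmetric-sum (λ j k → F (suc j) (suc k)) (λ j k → anti (suc j) (suc k))) ⟩
    0# + 0#
      ≈⟨ +-identityʳ _ ⟩
    0# ∎

  sign-pinch : ∀ {n} (j : Fin (suc n)) (k : Fin n) →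
    (- 1#) ^ toℕ (punchIn j k) * (- 1#) ^ toℕ (pinch k j) ≈ - ((- 1#) ^ toℕ j * (- 1#) ^ toℕ k)
  sign-pinch zero    zero    = solve 0
      (:- con (1 , 0) :* con (1 , 0) :* con (1 , 0) := :- (con (1 , 0) :* con (1 , 0))) refl
  sign-pinch zero    (suc k) = solve 1 (λ x → :- con (1 , 0) :* x :* con (1 , 0) := :- (con (1 , 0) :* x)) refl
      ((- 1#) ^ toℕ (suc k))
  sign-pinch (suc j) zero    = solve 1 (λ x → con (1 , 0) :* x := :- (:- con (1 , 0) :* x :* con (1 , 0))) refl
      ((- 1#) ^ toℕ j)
  sign-pinch (suc j) (suc k) = begin
    (- 1# * a) * (- 1# * b)     ≈⟨ solve 2 (λ a b → (:- con (1 , 0) :* a) :* (:- con (1 , 0) :* b) := a :* b) refl a b ⟩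
    a * b                       ≈⟨ sign-pinch j k ⟩
    - (a′ * b′)                 ≈⟨ solve 2
        (λ a b → :- (a :* b) := :- ((:- con (1 , 0) :* a) :* (:- con (1 , 0) :* b))) refl a′ b′ ⟩
    - ((- 1# * a′) * (- 1# * b′)) ∎
    where
    a = (- 1#) ^ toℕ (punchIn j k)
    b = (- 1#) ^ toℕ (pinch k j)
    a′ = (- 1#) ^ toℕ j
    b′ = (- 1#) ^ toℕ k

  module _ {n} (M : Matrix Carrier n (suc (suc n))) where

    term : (r r′ : Vector Carrier (suc (suc n))) → Fin (suc (suc n)) → Fin (suc n) → Carrier
    term r r′ j k = (- 1#) ^ toℕ j * (r j * cofactorTerm (r′ ∘ punchIn j) (minor M j) k)

    det-twoRows : ∀ r r′ → det (r ◂ r′ ◂ M) ≈ sum (λ j → sum (term r r′ j))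
    det-twoRows r r′ = sum-cong {f = cofactorTerm r (r′ ◂ M)} {λ j → sum (term r r′ j)} λ j →
      trans (*-congˡ {(- 1#) ^ toℕ j} (*-distribˡ-sum (r j) (cofactorTerm (r′ ∘ punchIn j) (minor M j))))
        (*-distribˡ-sum ((- 1#) ^ toℕ j) (λ k → r j * cofactorTerm (r′ ∘ punchIn j) (minor M j) k))

    term-anti : ∀ r r′ j k → term r r′ j k + term r′ r (punchIn j k) (pinch k j) ≈ 0#
    term-anti r r′ j k = begin
      s * (r j * (t * (r′ j′ * d))) + s′ * (r′ j′ * (t′ * (r (punchIn j′ k′) * d′)))
        ≈⟨ +-congˡ (*-congˡ (*-congˡ (*-congˡ (*-cong (reflexive (≡.cong r (punchIn-pinch j k)))
             (det-cong (minor (minor M j′) k′) (minor (minor M j) k) λ i l →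
                 reflexive (≡.cong (M i) (punchIn-punchIn j k l))))))) ⟩
      s * (r j * (t * (r′ j′ * d))) + s′ * (r′ j′ * (t′ * (r j * d)))
        ≈⟨ solve 7 (λ s t s′ t′ x y d → s :* (x :* (t :* (y :* d))) :+ s′ :* (y :* (t′ :* (x :* d))) :=
             (s :* t :+ s′ :* t′) :* (x :* y :* d)) refl s t s′ t′ (r j) (r′ j′) d ⟩
      (s * t + s′ * t′) * (r j * r′ j′ * d)
        ≈⟨ *-congʳ (trans (+-congˡ (sign-pinch j k)) (-‿inverseʳ _)) ⟩
      0# * (r j * r′ j′ * d)
        ≈⟨ zeroˡ _ ⟩
      0# ∎
      where
      j′ = punchIn j k
      k′ = pinch k j
      s = (- 1#) ^ toℕ j
      t = (- 1#) ^ toℕ k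
      s′ = (- 1#) ^ toℕ j′
      t′ = (- 1#) ^ toℕ k′
      d = det (minor (minor M j) k)
      d′ = det (minor (minor M j′) k′)

    det-equalRows : ∀ r → det (r ◂ r ◂ M) ≈ 0#
    det-equalRows r = trans (det-twoRows r r) (antisymmetric-sum (term r r) (term-anti r r))

    det-swapRows : ∀ r r′ → det (r ◂ r′ ◂ M) + det (r′ ◂ r ◂ M) ≈ 0#
    det-swapRows r r′ = begin
      det (r ◂ r′ ◂ M) + det (r′ ◂ r ◂ M)
        ≈⟨ +-cong (det-twoRows r r′) (det-twoRows r′ r) ⟩
      sum (λ j → sum (term r r′ j)) + sum (λ j → sum (term r′ r j))
        ≈⟨ ∑-distrib-+ (λ j → sum (term r r′ j)) (λ j → sum (term r′ r j)) ⟨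
      sum (λ j → sum (term r r′ j) + sum (term r′ r j))
        ≈⟨ sum-cong {f = λ j → sum (λ k → term r r′ j k + term r′ r j k)}
             (λ j → ∑-distrib-+ (term r r′ j) (term r′ r j)) ⟨
      sum (λ j → sum (λ k → term r r′ j k + term r′ r j k))
        ≈⟨ antisymmetric-sum (λ j k → term r r′ j k + term r′ r j k) (λ j k →
             trans (solve 4 (λ a b c d → (a :+ b) :+ (c :+ d) := (a :+ d) :+ (b :+ c)) refl
               (term r r′ j k) (term r′ r j k) (term r r′ (punchIn j k) (pinch k j))
                   (term r′ r (punchIn j k) (pinch k j)))
             (trans (+-cong (term-anti r r′ j k) (term-anti r′ r j k)) (+-identityʳ _))) ⟩
      0# ∎

  -- The expansion gives linearity in the first row only. So the second row is swapped to the top,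
  -- where linearity applies and the repeated row `r` kills the extra term. The rows further down
  -- are changed inside the minors along `M zero`, whose first row is again a part of `r`.
  det-addMultiples : ∀ {n} (r : Vector Carrier (suc n)) (M : Matrix Carrier n (suc n)) (x : Vector Carrier n) →
    det (r ◂ λ i j → M i j + x i * r j) ≈ det (r ◂ M)
  det-addMultiples {zero} r M x = det-◂-cong r (λ i j → M i j + x i * r j) M λ ()
  det-addMultiples {suc n} r M x = begin
    det (r ◂ M₊)
      ≈⟨ det-cong (r ◂ M₊) (r ◂ r₊ ◂ M₊ ∘ suc) (λ { zero j → refl ; (suc zero) j → refl ; (suc (suc i)) j → refl }) ⟩
    det (r ◂ r₊ ◂ M₊ ∘ suc)
      ≈⟨ x≈-y (det-swapRows (M₊ ∘ suc) r r₊) ⟩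
    - det (r₊ ◂ r ◂ M₊ ∘ suc)
      ≈⟨ -‿cong (det-linear (M zero) r (x zero) (r ◂ M₊ ∘ suc)) ⟩
    - (det (M zero ◂ r ◂ M₊ ∘ suc) + x zero * det (r ◂ r ◂ M₊ ∘ suc))
      ≈⟨ -‿cong (trans (+-congˡ (trans (*-congˡ (det-equalRows (M₊ ∘ suc) r)) (zeroʳ _))) (+-identityʳ _)) ⟩
    - det (M zero ◂ r ◂ M₊ ∘ suc)
      ≈⟨ -‿cong (sum-cong {f = cofactorTerm (M zero) (r ◂ M₊ ∘ suc)} {cofactorTerm (M zero) (r ◂ M ∘ suc)} λ j →
           *-congˡ {(- 1#) ^ toℕ j} (*-congˡ {M zero j} (begin
             det (minor (r ◂ M₊ ∘ suc) j)
               ≈⟨ det-◂ (minor (r ◂ M₊ ∘ suc) j) ⟩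
             det (r ∘ punchIn j ◂ minor (M₊ ∘ suc) j)
               ≈⟨ det-addMultiples (r ∘ punchIn j) (minor (M ∘ suc) j) (x ∘ suc) ⟩
             det (r ∘ punchIn j ◂ minor (M ∘ suc) j)
               ≈⟨ det-◂ (minor (r ◂ M ∘ suc) j) ⟨
             det (minor (r ◂ M ∘ suc) j) ∎))) ⟩
    - det (M zero ◂ r ◂ M ∘ suc)
      ≈⟨ x≈-y (det-swapRows (M ∘ suc) r (M zero)) ⟨
    det (r ◂ M zero ◂ M ∘ suc)
      ≈⟨ det-cong (r ◂ M) (r ◂ M zero ◂ M ∘ suc) (λ { zero j → refl ; (suc zero) j → refl ; (suc (suc i)) j → refl }) ⟨
    det (r ◂ M) ∎
    where
    x≈-y : ∀ {x y} → x + y ≈ 0# → x ≈ - y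
    x≈-y {x} {y} eq = trans (solve 2 (λ x y → x := (x :+ y) :- y) refl x y) (trans (+-congʳ eq) (+-identityˡ _))
    M₊ : Matrix Carrier (suc n) (suc (suc n))
    M₊ i j = M i j + x i * r j
    r₊ : Vector Carrier (suc (suc n))
    r₊ = M₊ zero

  schur : ∀ {n} → Matrix Carrier (suc n) (suc n) → Carrier → Matrix Carrier n n
  schur M a⁻¹ i j = M (suc i) (suc j) - M (suc i) zero * a⁻¹ * M zero (suc j)

  det-schur : ∀ {n} (M : Matrix Carrier (suc n) (suc n)) a⁻¹ → M zero zero * a⁻¹ ≈ 1# →
    det M ≈ M zero zero * det (schur M a⁻¹)
  det-schur M a⁻¹ inv = begin
    det M
      ≈⟨ det-◂ M ⟩
    det (M zero ◂ M ∘ suc)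
      ≈⟨ det-addMultiples (M zero) (M ∘ suc) x ⟨
    det M′
      ≈⟨ det-lowerBlock M′ (λ i → trans
           (solve 3 (λ m b a → m :+ :- (m :* b) :* a := m :- m :* (a :* b)) refl (M (suc i) zero) a⁻¹ (M zero zero))
           (trans (+-congˡ (-‿cong (trans (*-congˡ inv) (*-identityʳ _)))) (-‿inverseʳ _))) ⟩
    M zero zero * det (λ i j → M′ (suc i) (suc j))
      ≈⟨ *-congˡ (det-cong (λ i j → M′ (suc i) (suc j)) (schur M a⁻¹) λ i j →
           solve 3 (λ m y z → m :+ :- y :* z := m :- y :* z) refl (M (suc i) (suc j)) (M (suc i) zero * a⁻¹)
           (M zero (suc j))) ⟩
    M zero zero * det (schur M a⁻¹) ∎
    where
    x : Vector Carrier _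
    x i = - (M (suc i) zero * a⁻¹)
    M′ : Matrix Carrier _ _
    M′ = M zero ◂ λ i j → M (suc i) j + x i * M zero j

  module _ {n} (M : Matrix Carrier (suc n) (suc n)) (a⁻¹ : Carrier) (y : Vector Carrier n) where

    -- The solution x of the first equation of M x = (0 , …), given the other entries y.
    extend : Vector Carrier (suc n)
    extend = (- (a⁻¹ * sum (λ k → M zero (suc k) * y k))) ◂ y

    extend-zero : M zero zero * a⁻¹ ≈ 1# → (M *ⱽ extend) zero ≈ 0#
    extend-zero inv = trans (solve 3 (λ m a s → m :* (:- (a :* s)) :+ s := s :- m :* a :* s) refl (M zero zero) a⁻¹ s)
      (trans (+-congˡ (-‿cong (trans (*-congʳ inv) (*-identityˡ s)))) (-‿inverseʳ s))
      where s = sum (λ k → M zero (suc k) * y k)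

    extend-suc : ∀ i → (M *ⱽ extend) (suc i) ≈ (schur M a⁻¹ *ⱽ y) i
    extend-suc i = begin
      M (suc i) zero * (- (a⁻¹ * s)) + sum (λ k → M (suc i) (suc k) * y k)
        ≈⟨ solve 4 (λ l a s t → l :* (:- (a :* s)) :+ t := t :+ (:- (l :* a)) :* s) refl (M (suc i) zero) a⁻¹ s _ ⟩
      sum (λ k → M (suc i) (suc k) * y k) + (- x) * s
        ≈⟨ +-congˡ (*-distribˡ-sum (- x) (λ k → M zero (suc k) * y k)) ⟩
      sum (λ k → M (suc i) (suc k) * y k) + sum (λ k → (- x) * (M zero (suc k) * y k))
        ≈⟨ ∑-distrib-+ (λ k → M (suc i) (suc k) * y k) (λ k → (- x) * (M zero (suc k) * y k)) ⟨
      sum (λ k → M (suc i) (suc k) * y k + (- x) * (M zero (suc k) * y k))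
        ≈⟨ sum-cong (λ k → solve 4 (λ l x m y → l :* y :+ (:- x) :* (m :* y) := (l :- x :* m) :* y) refl
             (M (suc i) (suc k)) x (M zero (suc k)) (y k)) ⟩
      (schur M a⁻¹ *ⱽ y) i ∎
      where
      s = sum (λ k → M zero (suc k) * y k)
      x = M (suc i) zero * a⁻¹

  I+diag* : ∀ {n} → Vector Carrier n → Matrix Carrier n n → Matrix Carrier n n
  I+diag* z L i j = 1ᴹ i j + z i * L i j

  I+diag*-spec : ∀ {n} (z : Vector Carrier n) L i j → (1ᴹ +ᴹ diag z *ᴹ L) i j ≈ I+diag* z L i j
  I+diag*-spec z L i j = +-congˡ (trans (sum-cong λ k → eq k) (sum-indicator i (λ k → z i * L k j)))
    where
    eq : ∀ k → diag z i k * L k j ≈ (if does (i ≟ k) then z i * L k j else 0#)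
    eq k with does (i ≟ k)
    ... | true  = refl
    ... | false = zeroˡ _

  -- The first row is a unit row plus `z zero` times that of `L`. The unit row leaves a minor. For
  -- the other row the pivot is `L zero zero`, and elimination acts on the rows `z i * L i` below as
  -- it would on `L`, so the variables stay outside the Schur complement.
  det-I+diag*-suc : ∀ {n} (z : Vector Carrier (suc n)) L a⁻¹ → L zero zero * a⁻¹ ≈ 1# →
    det (I+diag* z L) ≈ det (I+diag* (z ∘ suc) (λ i j → L (suc i) (suc j)))
      + z zero * (L zero zero * det (I+diag* (z ∘ suc) (schur L a⁻¹)))
  det-I+diag*-suc z L a⁻¹ inv = begin
    det (I+diag* z L)
      ≈⟨ det-◂ (I+diag* z L) ⟩
    det ((λ j → 1ᴹ zero j + z zero * L zero j) ◂ rest)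
      ≈⟨ det-linear (1ᴹ zero) (L zero) (z zero) rest ⟩
    det (1ᴹ zero ◂ rest) + z zero * det (L zero ◂ rest)
      ≈⟨ +-cong (det-unitRow (1ᴹ zero) rest refl (λ j → refl)) (*-congˡ (trans (det-schur (L zero ◂ rest) a⁻¹ inv)
           (*-congˡ (det-cong (schur (L zero ◂ rest) a⁻¹) (I+diag* (z ∘ suc) (schur L a⁻¹)) λ i j →
               solve 6 (λ δ z l m a n → (δ :+ z :* l) :- (con (0 , 0) :+ z :* m) :* a :* n := δ :+ z :*
               (l :- m :* a :* n)) refl
             (1ᴹ i j) (z (suc i)) (L (suc i) (suc j)) (L (suc i) zero) a⁻¹ (L zero (suc j)))))) ⟩
    det (I+diag* (z ∘ suc) (λ i j → L (suc i) (suc j))) + z zero *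
        (L zero zero * det (I+diag* (z ∘ suc) (schur L a⁻¹))) ∎
    where
    rest : Matrix Carrier _ _
    rest = I+diag* z L ∘ suc

-- Partitions of the vertices, contraction and independent edge sets.

module Labellings where

  private variable
    n m k : ℕ

  -- A labelling represents the partition of the vertices into its fibres.
  Labelling : ℕ → Set
  Labelling n = Vector (Fin n) n

  Edge : ℕ → Set
  Edge n = Fin n × Fin n

  Edges : ℕ → ℕ → Set
  Edges n m = Vector (Edge n) m

  tail : Edges n (suc m) → Edges n m
  tail E = E ∘ suc

  Loop : Labelling n → Edge n → Set
  Loop ρ (a , b) = ρ a ≡ ρ b

  loop? : ∀ (ρ : Labelling n) e → Dec (Loop ρ e)
  loop? ρ (a , b) = ρ a ≟ ρ b

  Total : Labelling n → Set
  Total ρ = ∀ u v → ρ u ≡ ρ v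

  infix 4 _⊑_ _≐_
  _⊑_ _≐_ : Labelling n → Labelling n → Set
  ρ ⊑ σ = ∀ {u v} → ρ u ≡ ρ v → σ u ≡ σ v
  ρ ≐ σ = ρ ⊑ σ × σ ⊑ ρ

  -- The label of `b` survives. Merging in another order can label the same partition differently,
  -- which is why labellings are compared by `⊑` and `≐` and not as functions.
  merge : Labelling n → Edge n → Labelling n
  merge ρ (a , b) v = if does (ρ v ≟ ρ a) then ρ b else ρ v

  merge-⊑ : ∀ (ρ : Labelling n) e → ρ ⊑ merge ρ e
  merge-⊑ ρ (a , b) = ≡.cong (λ l → if does (l ≟ ρ a) then ρ b else l)

  merge-loop : ∀ (ρ : Labelling n) e → Loop (merge ρ e) e
  merge-loop ρ (a , b) with ρ a ≟ ρ a | ρ b ≟ ρ a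
  ... | yes _ | yes _ = ≡.refl
  ... | yes _ | no _  = ≡.refl
  ... | no ¬p | _     = contradiction ≡.refl ¬p

  merge-cases : ∀ (ρ : Labelling n) a b {u v} → merge ρ (a , b) u ≡ merge ρ (a , b) v →
    ρ u ≡ ρ v ⊎ (ρ u ≡ ρ a × ρ v ≡ ρ b) ⊎ (ρ u ≡ ρ b × ρ v ≡ ρ a)
  merge-cases ρ a b {u} {v} eq with ρ u ≟ ρ a | ρ v ≟ ρ a
  ... | yes p | yes q = inj₁ (≡.trans p (≡.sym q))
  ... | yes p | no _  = inj₂ (inj₁ (p , ≡.sym eq))
  ... | no _  | yes q = inj₂ (inj₂ (eq , q))
  ... | no _  | no _  = inj₁ eq

  module _ {ℓ} {W : Rel (Fin n) ℓ} (isEquivalence : IsEquivalence W) where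
    open IsEquivalence isEquivalence

    -- The universal property of `merge`. The relation `W` is arbitrary, as it will be another
    -- labelling, the existence of a walk, or equality of potentials.
    merge-least : ∀ (ρ : Labelling n) a b → (∀ {u v} → ρ u ≡ ρ v → W u v) → W a b →
      ∀ {u v} → merge ρ (a , b) u ≡ merge ρ (a , b) v → W u v
    merge-least ρ a b ρ⊆W ab eq with merge-cases ρ a b eq
    ... | inj₁ p              = ρ⊆W p
    ... | inj₂ (inj₁ (p , q)) = trans (ρ⊆W p) (trans ab (sym (ρ⊆W q)))
    ... | inj₂ (inj₂ (p , q)) = trans (ρ⊆W p) (trans (sym ab) (sym (ρ⊆W q)))

  kernel : ∀ (ρ : Labelling n) → IsEquivalence (λ u v → ρ u ≡ ρ v)
  kernel ρ = record { refl = ≡.refl ; sym = ≡.sym ; trans = ≡.trans }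

  merge-mono : ∀ {ρ σ : Labelling n} e → ρ ⊑ σ → merge ρ e ⊑ merge σ e
  merge-mono {ρ = ρ} {σ} e@(a , b) ρ⊑σ =
    merge-least (kernel (merge σ e)) ρ a b (λ eq → merge-⊑ σ e (ρ⊑σ eq)) (merge-loop σ e)

  merge-cong : ∀ {ρ σ : Labelling n} e → ρ ≐ σ → merge ρ e ≐ merge σ e
  merge-cong {ρ = ρ} {σ} e (ρ⊑σ , σ⊑ρ) = merge-mono {ρ = ρ} {σ} e ρ⊑σ , merge-mono {ρ = σ} {ρ} e σ⊑ρ

  merge-swap : ∀ (ρ : Labelling n) e f → merge (merge ρ e) f ⊑ merge (merge ρ f) e
  merge-swap ρ e@(a , b) f@(c , d) = merge-least (kernel (merge (merge ρ f) e)) (merge ρ e) c d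
    (merge-mono {ρ = ρ} {merge ρ f} e (merge-⊑ ρ f)) (merge-⊑ (merge ρ f) e (merge-loop ρ f))

  merge-comm : ∀ (ρ : Labelling n) e f → merge (merge ρ e) f ≐ merge (merge ρ f) e
  merge-comm ρ e f = merge-swap ρ e f , merge-swap ρ f e

  -- Being parallel is symmetric: an edge `e` that becomes a loop only through the contraction of
  -- `f` has its ends in the classes of the ends of `f`.
  loop-swap : ∀ (ρ : Labelling n) e f → ¬ Loop ρ e → Loop (merge ρ f) e → Loop (merge ρ e) f
  loop-swap ρ e@(a , b) f@(c , d) ¬e l with merge-cases ρ c d l
  ... | inj₁ p              = contradiction p ¬e
  ... | inj₂ (inj₁ (p , q)) = ≡.trans (merge-⊑ ρ e (≡.sym p)) (≡.trans (merge-loop ρ e) (merge-⊑ ρ e q))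
  ... | inj₂ (inj₂ (p , q)) = ≡.trans (merge-⊑ ρ e (≡.sym q)) (≡.trans (≡.sym (merge-loop ρ e)) (merge-⊑ ρ e p))

  contract : Labelling n → Edges n m → Subset m → Labelling n
  contract ρ E []            = ρ
  contract ρ E (outside ∷ X) = contract ρ (tail E) X
  contract ρ E (inside ∷ X)  = contract (merge ρ (E zero)) (tail E) X

  -- Independence in the graphic matroid of the graph contracted by `ρ`, tested edge by edge. The
  -- recursion parallels that of `τ`; the price is that independence of the order has to be proved.
  Forest : Labelling n → Edges n m → Subset m → Set
  Forest ρ E []            = Unit
  Forest ρ E (outside ∷ X) = Forest ρ (tail E) X
  Forest ρ E (inside ∷ X)  = ¬ Loop ρ (E zero) × Forest (merge ρ (E zero)) (tail E) X

  Tree : Labelling n → Edges n m → Subset m → Set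
  Tree ρ E X = Forest ρ E X × Total (contract ρ E X)

  contract-⊑ : ∀ (ρ : Labelling n) (E : Edges n m) X → ρ ⊑ contract ρ E X
  contract-⊑ ρ E []            eq = eq
  contract-⊑ ρ E (outside ∷ X) eq = contract-⊑ ρ (tail E) X eq
  contract-⊑ ρ E (inside ∷ X)  eq = contract-⊑ (merge ρ (E zero)) (tail E) X (merge-⊑ ρ (E zero) eq)

  contract-loop : ∀ (ρ : Labelling n) (E : Edges n m) {X i} → i ∈ X → Loop (contract ρ E X) (E i)
  contract-loop ρ E {inside ∷ X}  here       = contract-⊑ (merge ρ (E zero)) (tail E) X (merge-loop ρ (E zero))
  contract-loop ρ E {inside ∷ X}  (there i∈) = contract-loop (merge ρ (E zero)) (tail E) i∈
  contract-loop ρ E {outside ∷ X} (there i∈) = contract-loop ρ (tail E) i∈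

  -- The universal property of contraction, as the equivalence generated by `ρ` and the edges of
  -- `X`. Monotonicity and exchange of contractions then reduce to a check on generators.
  contract-least : ∀ {ℓ} {W : Rel (Fin n) ℓ} → IsEquivalence W →
    ∀ (ρ : Labelling n) (E : Edges n m) X → (∀ {u v} → ρ u ≡ ρ v → W u v) →
    (∀ {i} → i ∈ X → W (proj₁ (E i)) (proj₂ (E i))) →
    ∀ {u v} → contract ρ E X u ≡ contract ρ E X v → W u v
  contract-least eqW ρ E []            ρ⊆W X⊆W eq = ρ⊆W eq
  contract-least eqW ρ E (outside ∷ X) ρ⊆W X⊆W eq = contract-least eqW ρ (tail E) X ρ⊆W (X⊆W ∘ there) eq
  contract-least eqW ρ E (inside ∷ X)  ρ⊆W X⊆W eq =
    contract-least eqW (merge ρ (E zero)) (tail E) X (merge-least eqW ρ _ _ ρ⊆W (X⊆W here)) (X⊆W ∘ there) eq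

  contract-mono : ∀ {ρ σ : Labelling n} (E : Edges n m) {X Y} → ρ ⊑ σ → X ⊆ Y → contract ρ E X ⊑ contract σ E Y
  contract-mono {ρ = ρ} {σ} E {X} {Y} ρ⊑σ X⊆Y = contract-least (kernel (contract σ E Y)) ρ E X
    (λ eq → contract-⊑ σ E Y (ρ⊑σ eq)) (λ i∈ → contract-loop σ E (X⊆Y i∈))

  contract-merge : ∀ (ρ : Labelling n) e (E : Edges n m) X → contract (merge ρ e) E X ≐ merge (contract ρ E X) e
  contract-merge ρ e E X =
      contract-least (kernel (merge (contract ρ E X) e)) (merge ρ e) E X
        (merge-mono {ρ = ρ} {contract ρ E X} e (contract-⊑ ρ E X))
            (λ i∈ → merge-⊑ (contract ρ E X) e (contract-loop ρ E i∈))
    , merge-least (kernel (contract (merge ρ e) E X)) (contract ρ E X) _ _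
        (contract-mono {ρ = ρ} {merge ρ e} E {X} (merge-⊑ ρ e) id) (contract-⊑ (merge ρ e) E X (merge-loop ρ e))

  contract-swap : ∀ (ρ : Labelling n) (E : Edges n m) X (F : Edges n k) Y →
    contract (contract ρ E X) F Y ⊑ contract (contract ρ F Y) E X
  contract-swap ρ E X F Y = contract-least (kernel (contract (contract ρ F Y) E X)) (contract ρ E X) F Y
    (contract-mono {ρ = ρ} {contract ρ F Y} E {X} (contract-⊑ ρ F Y) id)
    (λ i∈ → contract-⊑ (contract ρ F Y) E X (contract-loop ρ F i∈))

  forest-mono : ∀ {ρ σ : Labelling n} (E : Edges n m) X → σ ⊑ ρ → Forest ρ E X → Forest σ E X
  forest-mono E []            σ⊑ρ f       = tt
  forest-mono E (outside ∷ X) σ⊑ρ f       = forest-mono (tail E) X σ⊑ρ f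
  forest-mono {ρ = ρ} {σ} E (inside ∷ X)  σ⊑ρ (¬l , f) =
    ¬l ∘ σ⊑ρ , forest-mono (tail E) X (merge-mono {ρ = σ} {ρ} (E zero) σ⊑ρ) f

  -- Moves `e` from the last position to the first. If a forest edge became a loop after contracting
  -- `e`, then by `loop-swap` the contraction of that edge would make `e` a loop.
  forest-addFirst : ∀ (ρ : Labelling n) e (E : Edges n m) X → Forest ρ E X → ¬ Loop (contract ρ E X) e →
    Forest (merge ρ e) E X
  forest-addFirst ρ e E []            f        ¬e = tt
  forest-addFirst ρ e E (outside ∷ X) f        ¬e = forest-addFirst ρ e (tail E) X f ¬e
  forest-addFirst ρ e E (inside ∷ X)  (¬l , f) ¬e =
    (λ l → ¬e (contract-⊑ (merge ρ (E zero)) (tail E) X (loop-swap ρ (E zero) e ¬l l))) ,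
    forest-mono (tail E) X (merge-swap ρ e (E zero)) (forest-addFirst (merge ρ (E zero)) e (tail E) X f ¬e)

  forest-addLast : ∀ (ρ : Labelling n) e (E : Edges n m) X → ¬ Loop ρ e → Forest (merge ρ e) E X →
    ¬ Loop (contract ρ E X) e
  forest-addLast ρ e E []            ¬e f        = ¬e
  forest-addLast ρ e E (outside ∷ X) ¬e f        = forest-addLast ρ e (tail E) X ¬e f
  forest-addLast ρ e E (inside ∷ X)  ¬e (¬l , f) = forest-addLast (merge ρ (E zero)) e (tail E) X
    (¬l ∘ loop-swap ρ e (E zero) ¬e) (forest-mono (tail E) X (merge-swap ρ (E zero) e) f)

  -- Both sides express that `X` and `Y` are jointly independent, with a different set contracted
  -- first. This later trades forests modulo the ports for ports modulo a forest.
  forest-exchange : ∀ (ρ : Labelling n) (E : Edges n m) X (F : Edges n k) Y →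
    Forest ρ E X → Forest (contract ρ E X) F Y → Forest (contract ρ F Y) E X
  forest-exchange ρ E X F []            f g        = f
  forest-exchange ρ E X F (outside ∷ Y) f g        = forest-exchange ρ E X (tail F) Y f g
  forest-exchange ρ E X F (inside ∷ Y)  f (¬l , g) = forest-exchange (merge ρ (F zero)) E X (tail F) Y
    (forest-addFirst ρ (F zero) E X f ¬l) (forest-mono (tail F) Y (proj₁ (contract-merge ρ (F zero) E X)) g)

  -- Links the ordered notion `Forest` to cycles, which know no order. Admitting every `Y` inside
  -- `X` that misses `i`, and not just the largest, lets the induction strip the first edge whether
  -- or not it lies in `Y`.
  forest-irredundant : ∀ (ρ : Labelling n) (E : Edges n m) {X Y i} → Forest ρ E X → i ∈ X → Y ⊆ X → i ∉ Y →
    ¬ Loop (contract ρ E Y) (E i)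
  forest-irredundant ρ E {inside ∷ X}  {inside ∷ Y}  f        here       Y⊆X i∉Y = contradiction here i∉Y
  forest-irredundant ρ E {inside ∷ X}  {outside ∷ Y} (¬l , f) here       Y⊆X i∉Y =
    forest-addLast ρ (E zero) (tail E) X ¬l f ∘ contract-mono {ρ = ρ} {ρ} (tail E) id (drop-there ∘ Y⊆X ∘ there)
  forest-irredundant ρ E {inside ∷ X}  {inside ∷ Y}  (¬l , f) (there i∈) Y⊆X i∉Y =
    forest-irredundant (merge ρ (E zero)) (tail E) f i∈ (drop-there ∘ Y⊆X ∘ there) (i∉Y ∘ there)
  forest-irredundant ρ E {inside ∷ X}  {outside ∷ Y} (¬l , f) (there i∈) Y⊆X i∉Y =
    forest-irredundant (merge ρ (E zero)) (tail E) f i∈ (drop-there ∘ Y⊆X ∘ there) (i∉Y ∘ there)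
      ∘ contract-mono {ρ = ρ} {merge ρ (E zero)} (tail E) {Y} (merge-⊑ ρ (E zero)) id
  forest-irredundant ρ E {outside ∷ X} {inside ∷ Y}  f        (there i∈) Y⊆X i∉Y with () ← Y⊆X here
  forest-irredundant ρ E {outside ∷ X} {outside ∷ Y} f        (there i∈) Y⊆X i∉Y =
    forest-irredundant ρ (tail E) f i∈ (drop-there ∘ Y⊆X ∘ there) (i∉Y ∘ there)

  irredundant-forest : ∀ (ρ : Labelling n) (E : Edges n m) X →
    (∀ {i Y} → i ∈ X → Y ⊆ X → i ∉ Y → ¬ Loop (contract ρ E Y) (E i)) → Forest ρ E X
  irredundant-forest ρ E []            irr = tt
  irredundant-forest ρ E (outside ∷ X) irr = irredundant-forest ρ (tail E) X λ {i} {Y} i∈ Y⊆X i∉Y →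
    irr {Y = outside ∷ Y} (there i∈) (out⊆ Y⊆X) (i∉Y ∘ drop-there)
  irredundant-forest ρ E (inside ∷ X)  irr =
    irr {Y = outside ∷ X} here (out⊆ id) (λ ()) ∘ contract-⊑ ρ (tail E) X ,
    irredundant-forest (merge ρ (E zero)) (tail E) X λ {i} {Y} i∈ Y⊆X i∉Y →
      irr {Y = inside ∷ Y} (there i∈) (s⊆s Y⊆X) (i∉Y ∘ drop-there)

  record Transversal (ρ : Labelling n) (k : ℕ) : Set where
    field
      vertex   : Vector (Fin n) k
      distinct : ∀ {i j} → ρ (vertex i) ≡ ρ (vertex j) → i ≡ j
      covering : ∀ v → ∃[ i ] ρ v ≡ ρ (vertex i)

  transversal-unique : ∀ {ρ : Labelling n} → Transversal ρ m → Transversal ρ k → m ≡ k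
  transversal-unique S T = ℕ.≤-antisym (bound S T) (bound T S)
    where
    bound : ∀ {ρ : Labelling n} → Transversal ρ m → Transversal ρ k → m ℕ.≤ k
    bound {ρ = ρ} S T = injective⇒≤ {f = λ i → proj₁ (T.covering (S.vertex i))} λ {i} {j} eq →
      S.distinct (≡.trans (proj₂ (T.covering (S.vertex i)))
        (≡.trans (≡.cong (ρ ∘ T.vertex) eq) (≡.sym (proj₂ (T.covering (S.vertex j))))))
      where
      module S = Transversal S
      module T = Transversal T

  -- The representative of the merged class lies on one side of `e`; the end of `e` on the other
  -- side is the additional representative.
  transversal-merge : ∀ {ρ : Labelling n} e → ¬ Loop ρ e → Transversal (merge ρ e) k → Transversal ρ (suc k)
  transversal-merge {n} {k} {ρ} e@(a , b) ¬l T = extend (proj₁ (T.covering a)) (proj₂ (T.covering a))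
    where
    module T = Transversal T
    σ : Labelling n
    σ = merge ρ e

    class : ∀ {v} → σ v ≡ σ a → ρ v ≡ ρ a ⊎ ρ v ≡ ρ b
    class v~a with merge-cases ρ a b v~a
    ... | inj₁ p              = inj₁ p
    ... | inj₂ (inj₁ (p , _)) = inj₁ p
    ... | inj₂ (inj₂ (p , _)) = inj₂ p

    add : ∀ o i → σ o ≡ σ a → σ (T.vertex i) ≡ σ a → ρ o ≢ ρ (T.vertex i) →
          (∀ {v} → σ v ≡ σ a → ρ v ≡ ρ o ⊎ ρ v ≡ ρ (T.vertex i)) → Transversal ρ (suc k)
    add o i o~a i~a o≢i split = record { vertex = o ◂ T.vertex ; distinct = distinct′ ; covering = covering′ }
      where
      fresh : ∀ j → ρ o ≢ ρ (T.vertex j)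
      fresh j eq with T.distinct {i} {j} (≡.trans i~a (≡.trans (≡.sym o~a) (merge-⊑ ρ e eq)))
      ... | ≡.refl = o≢i eq
      distinct′ : ∀ {j j′} → ρ ((o ◂ T.vertex) j) ≡ ρ ((o ◂ T.vertex) j′) → j ≡ j′
      distinct′ {zero}  {zero}   eq = ≡.refl
      distinct′ {zero}  {suc j′} eq = contradiction eq (fresh j′)
      distinct′ {suc j} {zero}   eq = contradiction (≡.sym eq) (fresh j)
      distinct′ {suc j} {suc j′} eq = ≡.cong suc (T.distinct (merge-⊑ ρ e eq))
      covering′ : ∀ v → ∃[ j ] ρ v ≡ ρ ((o ◂ T.vertex) j)
      covering′ v with σ v ≟ σ a
      covering′ v | yes v~a with split v~a
      ... | inj₁ eq = zero , eq
      ... | inj₂ eq = suc i , eq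
      covering′ v | no v≁a with T.covering v
      ... | j , v~j with merge-cases ρ a b v~j
      ...   | inj₁ eq              = suc j , eq
      ...   | inj₂ (inj₁ (p , _)) = contradiction (merge-⊑ ρ e p) v≁a
      ...   | inj₂ (inj₂ (p , _)) = contradiction (≡.trans (merge-⊑ ρ e p) (≡.sym (merge-loop ρ e))) v≁a

    extend : ∀ i → σ a ≡ σ (T.vertex i) → Transversal ρ (suc k)
    extend i a~i with class (≡.sym a~i)
    ... | inj₁ i≈a = add b i (≡.sym (merge-loop ρ e)) (≡.sym a~i) (λ b≈i → ¬l (≡.sym (≡.trans b≈i i≈a)))
                       (λ v~a → Sum.swap (Sum.map₁ (λ p → ≡.trans p (≡.sym i≈a)) (class v~a)))
    ... | inj₂ i≈b = add a i ≡.refl (≡.sym a~i) (λ a≈i → ¬l (≡.trans a≈i i≈b))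
                       (λ v~a → Sum.map₂ (λ p → ≡.trans p (≡.sym i≈b)) (class v~a))

  -- Every tree edge lowers the number of classes by one until a single class is left. The given
  -- vertex represents that class.
  tree⇒transversal : ∀ (ρ : Labelling n) (E : Edges n m) X → Fin n → Tree ρ E X → Transversal ρ (∣ X ∣ ℕ.+ 1)
  tree⇒transversal ρ E []            v (f , total) = record
    { vertex = λ _ → v ; distinct = λ { {zero} {zero} _ → ≡.refl } ; covering = λ u → zero , total u v }
  tree⇒transversal ρ E (outside ∷ X) v (f , total)        = tree⇒transversal ρ (tail E) X v (f , total)
  tree⇒transversal ρ E (inside ∷ X)  v ((¬l , f) , total) =
    transversal-merge (E zero) ¬l (tree⇒transversal (merge ρ (E zero)) (tail E) X v (f , total))

-- Walks, cycles and components of the network, its quotient and the port graphs, in terms of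
-- labellings.

module MultigraphLabelling {n m} (G : Multigraph n m) (ρ : Labellings.Labelling n)
  (≈⇒ : ∀ {u v} → Multigraph._≈_ G u v → ρ u ≡ ρ v) (⇒≈ : ∀ {u v} → ρ u ≡ ρ v → Multigraph._≈_ G u v) where
  open Labellings
  open Multigraph G

  ends : Edges n m
  ends i = source i , target i

  walk⇒label : ∀ {X u v} → Walk X u v → contract ρ ends X u ≡ contract ρ ends X v
  walk⇒label {X} (stop u≈v) = contract-⊑ ρ ends X (≈⇒ u≈v)
  walk⇒label {X} (step e w e∈X (inj₁ (p , q)) r) = ≡.trans (contract-⊑ ρ ends X (≡.sym (≈⇒ p)))
    (≡.trans (contract-loop ρ ends e∈X) (≡.trans (contract-⊑ ρ ends X (≈⇒ q)) (walk⇒label r)))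
  walk⇒label {X} (step e w e∈X (inj₂ (p , q)) r) = ≡.trans (contract-⊑ ρ ends X (≡.sym (≈⇒ q)))
    (≡.trans (≡.sym (contract-loop ρ ends e∈X)) (≡.trans (contract-⊑ ρ ends X (≈⇒ p)) (walk⇒label r)))

  label⇒walk : ∀ {X u v} → contract ρ ends X u ≡ contract ρ ends X v → Walk X u v
  label⇒walk {X} = contract-least walk-isEquivalence ρ ends X (λ eq → stop (⇒≈ eq))
    (λ i∈ → step _ _ i∈ (inj₁ (refl , refl)) (stop refl))

  acyclic⇒forest : ∀ {X} → Acyclic X → Forest ρ ends X
  acyclic⇒forest {X} acyclic = irredundant-forest ρ ends X λ {i} {Y} i∈X Y⊆X i∉Y loop →
    acyclic (redundant⇒cycle (i , i∈X , label⇒walk (contract-mono {ρ = ρ} {ρ} ends {Y} {X ∖ i} id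
      (λ j∈Y → x∈p∧x≢y⇒x∈p-y (Y⊆X j∈Y) λ { ≡.refl → i∉Y j∈Y }) loop)))

  forest⇒acyclic : ∀ {X} → Forest ρ ends X → Acyclic X
  forest⇒acyclic {X} forest cycle with cycle⇒redundant cycle
  ... | i , i∈X , walk = forest-irredundant ρ ends forest i∈X (p─q⊆p X _) e∉T∖e (walk⇒label walk)

  spanningTree⇒tree : ∀ {X} → SpanningTree X → Tree ρ ends X
  spanningTree⇒tree (connected , acyclic) = acyclic⇒forest acyclic , λ u v → walk⇒label (connected u v)

  tree⇒spanningTree : ∀ {X} → Tree ρ ends X → SpanningTree X
  tree⇒spanningTree (forest , total) = (λ u v → label⇒walk (total u v)) , forest⇒acyclic forest

  components : ∀ X → Transversal (contract ρ ends X) (#components X)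
  components X = record
    { vertex   = List.lookup vs
    ; distinct = λ {i} {j} eq → lookup-injective (UniqueDecSetoid.deduplicate-! decSetoid (allFin n)) i j
        (label⇒walk eq)
    ; covering = λ v → let v∈ = covered v in Any.index v∈ , walk⇒label (Any.lookup-index v∈)
    }
    where
    decSetoid : DecSetoid 0ℓ 0ℓ
    decSetoid = record { isDecEquivalence = walk-isDecEquivalence X }
    vs = deduplicate (walk? X) (allFin n)
    covered : ∀ v → Any (Walk X v) vs
    covered v = Any.deduplicate⁺ (walk? X) (λ x y → walk-trans y (walk-sym x))
        (Any.map (λ { ≡.refl → stop refl }) (∈-allFin v))
    lookup-injective : ∀ {vs : List (Fin n)} → AllPairs (λ u v → ¬ Walk X u v) vs →
      ∀ i j → Walk X (List.lookup vs i) (List.lookup vs j) → i ≡ j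
    lookup-injective (_ ∷ _)       zero    zero    w = ≡.refl
    lookup-injective (d ∷ _)       zero    (suc j) w = contradiction w (All.lookup d (∈-lookup j))
    lookup-injective (d ∷ _)       (suc i) zero    w = contradiction (walk-sym w) (All.lookup d (∈-lookup i))
    lookup-injective (_ ∷ ds)      (suc i) (suc j) w = ≡.cong suc (lookup-injective ds i j w)

-- Spanning tree sums and Kirchhoff's potential.

module TreePolynomial {c ℓ} (K : CommutativeRing c ℓ) where
  open CommutativeRing K hiding (zero)
  open RingSolver K
  open Sums K
  open SetoidReasoning setoid
  open Labellings

  private variable
    n m : ℕ

  indicator : ∀ {p} {P : Set p} → Dec P → Carrier
  indicator P? = if does P? then 1# else 0#

  indicator-yes : ∀ {p} {P : Set p} (P? : Dec P) → P → indicator P? ≈ 1#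
  indicator-yes P? x rewrite dec-true P? x = refl

  indicator-no : ∀ {p} {P : Set p} (P? : Dec P) → ¬ P → indicator P? ≈ 0#
  indicator-no P? x rewrite dec-false P? x = refl

  indicator-cong : ∀ {p q} {P : Set p} {Q : Set q} (P? : Dec P) (Q? : Dec Q) → (P → Q) →
      (Q → P) → indicator P? ≈ indicator Q?
  indicator-cong (yes x) Q? f g = sym (indicator-yes Q? (f x))
  indicator-cong (no ¬x) Q? f g = sym (indicator-no Q? (¬x ∘ g))

  -- Deletion leaves a function of partitions unchanged; this is contraction,
  -- which gives 0 for a loop.
  infixl 8 _/_

  opaque
    _/_ : (Labelling n → Carrier) → Edge n → Labelling n → Carrier
    (F / e) ρ = if does (loop? ρ e) then 0# else F (merge ρ e)

    /-loop : ∀ (F : Labelling n → Carrier) {ρ e} → Loop ρ e → (F / e) ρ ≈ 0#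
    /-loop F {ρ} {e} l rewrite dec-true (loop? ρ e) l = refl

    /-edge : ∀ (F : Labelling n → Carrier) {ρ e} → ¬ Loop ρ e → (F / e) ρ ≈ F (merge ρ e)
    /-edge F {ρ} {e} ¬l rewrite dec-false (loop? ρ e) ¬l = refl

    /-vanishes : ∀ (F : Labelling n → Carrier) e {ρ} → (∀ σ → ρ ⊑ σ → Loop σ e → F σ ≈ 0#) → (F / e) ρ ≈ 0#
    /-vanishes F e {ρ} F≈0 with loop? ρ e
    ... | yes _ = refl
    ... | no _  = F≈0 (merge ρ e) (merge-⊑ ρ e) (merge-loop ρ e)

    /-cong : ∀ {F G : Labelling n → Carrier} e {ρ} → (∀ σ → ρ ⊑ σ → F σ ≈ G σ) → (F / e) ρ ≈ (G / e) ρ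
    /-cong e {ρ} F≈G with does (loop? ρ e)
    ... | true  = refl
    ... | false = F≈G (merge ρ e) (merge-⊑ ρ e)

    /-linear : ∀ (F G : Labelling n → Carrier) x e ρ → ((λ σ → F σ + x * G σ) / e) ρ ≈ (F / e) ρ + x * (G / e) ρ
    /-linear F G x e ρ with does (loop? ρ e)
    ... | true  = solve 1 (λ x → con (0 , 0) := con (0 , 0) :+ x :* con (0 , 0)) refl x
    ... | false = refl

    /-difference : ∀ (F G : Labelling n → Carrier) e ρ → ((λ σ → F σ - G σ) / e) ρ ≈ (F / e) ρ - (G / e) ρ
    /-difference F G e ρ with does (loop? ρ e)
    ... | true  = sym (-‿inverseʳ 0#)
    ... | false = refl

  Extensional : (Labelling n → Carrier) → Set _
  Extensional F = ∀ {ρ σ} → ρ ≐ σ → F ρ ≈ F σ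

  /-extensional : ∀ (F : Labelling n → Carrier) e → Extensional F → Extensional (F / e)
  /-extensional F e ext {ρ} {σ} ρ≐σ = go (loop? ρ e)
    where
    go : Dec (Loop ρ e) → (F / e) ρ ≈ (F / e) σ
    go (yes l) = trans (/-loop F l) (sym (/-loop F (proj₁ ρ≐σ l)))
    go (no ¬l) = trans (/-edge F ¬l) (trans (ext (merge-cong {ρ = ρ} {σ} e ρ≐σ)) (sym (/-edge F (¬l ∘ proj₂ ρ≐σ))))

  -- Parallel edges give 0 on both sides by `loop-swap`. Otherwise the two orders of merging agree
  -- only up to `≐`, hence extensionality.
  /-comm : ∀ (F : Labelling n → Carrier) → Extensional F → ∀ e f ρ → (F / e / f) ρ ≈ (F / f / e) ρ
  /-comm F ext e f ρ = go (loop? ρ e) (loop? ρ f)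
    where
    go : Dec (Loop ρ e) → Dec (Loop ρ f) → (F / e / f) ρ ≈ (F / f / e) ρ
    go (yes l) _ = trans (/-vanishes (F / e) f λ σ ρ⊑σ _ → /-loop F (ρ⊑σ l)) (sym (/-loop (F / f) l))
    go (no _) (yes l) = trans (/-loop (F / e) l) (sym (/-vanishes (F / f) e λ σ ρ⊑σ _ → /-loop F (ρ⊑σ l)))
    go (no ¬e) (no ¬f) = trans (/-edge (F / e) ¬f) (trans (inner (loop? (merge ρ f) e)) (sym (/-edge (F / f) ¬e)))
      where
      inner : Dec (Loop (merge ρ f) e) → (F / e) (merge ρ f) ≈ (F / f) (merge ρ e)
      inner (yes l) = trans (/-loop F l) (sym (/-loop F (loop-swap ρ e f ¬e l)))
      inner (no ¬l) = trans (/-edge F ¬l) (trans (ext (merge-comm ρ f e)) (sym (/-edge F (¬l ∘ loop-swap ρ f e ¬f))))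

  total? : ∀ (ρ : Labelling n) → Dec (Total ρ)
  total? ρ = all? λ u → all? λ v → ρ u ≟ ρ v

  -- The weighted sum of the spanning trees of the network obtained by identifying the
  -- vertices with equal labels.
  τ : Edges n m → Vector Carrier m → Labelling n → Carrier
  τ {m = zero}  E c ρ = indicator (total? ρ)
  τ {m = suc m} E c ρ = τ (tail E) (c ∘ suc) ρ + c zero * (τ (tail E) (c ∘ suc) / E zero) ρ

  τ-extensional : ∀ (E : Edges n m) c → Extensional (τ E c)
  τ-extensional {m = zero} E c {ρ} {σ} (ρ⊑σ , σ⊑ρ) = indicator-cong (total? ρ) (total? σ)
    (λ t u v → ρ⊑σ (t u v)) (λ t u v → σ⊑ρ (t u v))
  τ-extensional {m = suc m} E c ρ≐σ = +-cong (τ-extensional (tail E) (c ∘ suc) ρ≐σ)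
    (*-congˡ (/-extensional (τ (tail E) (c ∘ suc)) (E zero) (τ-extensional (tail E) (c ∘ suc)) ρ≐σ))

  Respects : Labelling n → Vector Carrier n → Set _
  Respects ρ φ = ∀ {u v} → ρ u ≡ ρ v → φ u ≈ φ v

  drop : Vector Carrier n → Edge n → Carrier
  drop φ (a , b) = φ b - φ a

  respects⇒drop≈0 : ∀ {ρ : Labelling n} {φ} e → Respects ρ φ → Loop ρ e → drop φ e ≈ 0#
  respects⇒drop≈0 e resp l = trans (+-congʳ (resp (≡.sym l))) (-‿inverseʳ _)

  respects-merge : ∀ {ρ : Labelling n} {φ} a b → Respects ρ φ → φ a ≈ φ b → Respects (merge ρ (a , b)) φ
  respects-merge {ρ = ρ} {φ} a b resp a≈b = merge-least isEq ρ a b resp a≈b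
    where
    isEq : IsEquivalence (λ u v → φ u ≈ φ v)
    isEq = record { refl = refl ; sym = sym ; trans = trans }

  -- Kirchhoff's potential when a current τ enters at b and leaves at a: at v it is
  -- the weighted sum of the spanning forests with two components that separate
  -- a from b and join v to b.
  potential : Edges n m → Vector Carrier m → Edge n → Labelling n → Vector Carrier n
  potential {m = zero}  E c (a , b) ρ v = (τ E c / (a , b)) ρ * indicator (ρ v ≟ ρ b)
  potential {m = suc m} E c p ρ v = potential (tail E) (c ∘ suc) p ρ v
    + c zero * ((λ σ → potential (tail E) (c ∘ suc) p σ v) / E zero) ρ

  potential-respects : ∀ (E : Edges n m) c p ρ → Respects ρ (potential E c p ρ)
  potential-respects {m = zero} E c (a , b) ρ {u} {v} eq =
    *-congˡ (indicator-cong (ρ u ≟ ρ b) (ρ v ≟ ρ b) (≡.trans (≡.sym eq)) (≡.trans eq))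
  potential-respects {m = suc m} E c p ρ eq = +-cong (potential-respects (tail E) (c ∘ suc) p ρ eq)
    (*-congˡ (/-cong (E zero) λ σ ρ⊑σ → potential-respects (tail E) (c ∘ suc) p σ (ρ⊑σ eq)))

  potential-extensional : ∀ (E : Edges n m) c p v → Extensional (λ ρ → potential E c p ρ v)
  potential-extensional {m = zero} E c (a , b) v {ρ} {σ} ρ≐σ@(ρ⊑σ , σ⊑ρ) =
    *-cong (/-extensional (τ E c) (a , b) (τ-extensional E c) ρ≐σ) (indicator-cong (ρ v ≟ ρ b) (σ v ≟ σ b) ρ⊑σ σ⊑ρ)
  potential-extensional {m = suc m} E c p v ρ≐σ = +-cong (potential-extensional (tail E) (c ∘ suc) p v ρ≐σ)
    (*-congˡ (/-extensional _ (E zero) (potential-extensional (tail E) (c ∘ suc) p v) ρ≐σ))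

  voltage : Edges n m → Vector Carrier m → Edge n → Edge n → Labelling n → Carrier
  voltage E c p f ρ = drop (potential E c p ρ) f

  voltage-extensional : ∀ (E : Edges n m) c p f → Extensional (voltage E c p f)
  voltage-extensional E c p (a , b) ρ≐σ =
    +-cong (potential-extensional E c p b ρ≐σ) (-‿cong (potential-extensional E c p a ρ≐σ))

  voltage-loop : ∀ (E : Edges n m) c p f {ρ} → Loop ρ f → voltage E c p f ρ ≈ 0#
  voltage-loop E c p f {ρ} = respects⇒drop≈0 {ρ = ρ} {potential E c p ρ} f
      (λ {u} {v} → potential-respects E c p ρ {u} {v})

  voltage-suc : ∀ (E : Edges n (suc m)) c p f ρ → let V′ = voltage (tail E) (c ∘ suc) p f in
    voltage E c p f ρ ≈ V′ ρ + c zero * (V′ / E zero) ρ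
  voltage-suc E c p (a , b) ρ = trans
    (solve 5 (λ x y z w c → (x :+ c :* y) :- (z :+ c :* w) := (x :- z) :+ c :* (y :- w)) refl _ _ _ _ (c zero))
    (+-congˡ (*-congˡ (sym (/-difference _ _ (E zero) ρ))))

  -- A forest that contains the first edge gives both of its ends the same potential, so the
  -- contracted term contributes nothing.
  voltage-first : ∀ (E : Edges n (suc m)) c p ρ →
    voltage E c p (E zero) ρ ≈ voltage (tail E) (c ∘ suc) p (E zero) ρ
  voltage-first E c p ρ = trans (voltage-suc E c p (E zero) ρ) (trans
    (+-congˡ (trans (*-congˡ (/-vanishes _ (E zero) λ σ _ l → voltage-loop (tail E) (c ∘ suc) p (E zero) l)) (zeroʳ _)))
    (+-identityʳ _))

  -- Adding the port to a forest with two components that separates its ends gives a spanning tree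
  -- through the port; the potential difference counts exactly these.
  voltage-port : ∀ (E : Edges n m) c p ρ → voltage E c p p ρ ≈ (τ E c / p) ρ
  voltage-port {m = zero} E c p@(a , b) ρ = go (loop? ρ p)
    where
    go : Dec (Loop ρ p) → voltage E c p p ρ ≈ (τ E c / p) ρ
    go (yes l) = trans (voltage-loop E c p p l) (sym (/-loop (τ E c) l))
    go (no ¬l) = trans (+-cong (*-congˡ (indicator-yes (ρ b ≟ ρ b) ≡.refl))
        (-‿cong (*-congˡ (indicator-no (ρ a ≟ ρ b) ¬l))))
      (solve 1 (λ x → x :* con (1 , 0) :- x :* con (0 , 0) := x) refl ((τ E c / p) ρ))
  voltage-port {m = suc m} E c p ρ = begin
    voltage E c p p ρ                                     ≈⟨ voltage-suc E c p p ρ ⟩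
    voltage E′ c′ p p ρ + c zero * (voltage E′ c′ p p / E zero) ρ
      ≈⟨ +-cong (voltage-port E′ c′ p ρ) (*-congˡ (/-cong (E zero) λ σ _ → voltage-port E′ c′ p σ)) ⟩
    (τ E′ c′ / p) ρ + c zero * (τ E′ c′ / p / E zero) ρ   ≈⟨ +-congˡ
        (*-congˡ (/-comm (τ E′ c′) (τ-extensional E′ c′) p (E zero) ρ)) ⟩
    (τ E′ c′ / p) ρ + c zero * (τ E′ c′ / E zero / p) ρ   ≈⟨ /-linear (τ E′ c′) (τ E′ c′ / E zero) (c zero) p ρ ⟨
    (τ E c / p) ρ                                         ∎
    where
    E′ = tail E
    c′ = c ∘ suc

  two-classes : ∀ {ρ : Labelling n} a b {c d} → Total (merge ρ (a , b)) → ¬ Loop ρ (c , d) →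
    (ρ c ≡ ρ a × ρ d ≡ ρ b) ⊎ (ρ c ≡ ρ b × ρ d ≡ ρ a)
  two-classes {ρ = ρ} a b {c} {d} total ¬l with merge-cases ρ a b (total c d)
  ... | inj₁ l = contradiction l ¬l
  ... | inj₂ x = x

  total-merge : ∀ {ρ : Labelling n} e f → Total (merge ρ e) → ¬ Loop ρ f → Total (merge ρ f)
  total-merge {ρ = ρ} e@(a , b) f@(c , d) total ¬l u v = merge-least (kernel (merge ρ f)) ρ a b
      (merge-⊑ ρ f) a~b (total u v)
    where
    a~b : Loop (merge ρ f) e
    a~b with two-classes {ρ = ρ} a b total ¬l
    ... | inj₁ (p , q) = ≡.trans (merge-⊑ ρ f (≡.sym p)) (≡.trans (merge-loop ρ f) (merge-⊑ ρ f q))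
    ... | inj₂ (p , q) = ≡.trans (merge-⊑ ρ f (≡.sym q)) (≡.trans (≡.sym (merge-loop ρ f)) (merge-⊑ ρ f p))

  -- Only two classes are left, and `f` runs between them along `e` or against it. Reversing `f`
  -- changes the sign of both factors.
  drop-class : ∀ {ρ : Labelling n} {φ} e f → Respects ρ φ → Total (merge ρ e) → ¬ Loop ρ e → ¬ Loop ρ f →
    drop (λ v → indicator (ρ v ≟ ρ (proj₂ e))) f * drop φ f ≈ drop φ e
  drop-class {ρ = ρ} {φ} e@(a , b) f@(c , d) resp total ¬e ¬f with two-classes {ρ = ρ} a b total ¬f
  ... | inj₁ (p , q) = begin
    (indicator (ρ d ≟ ρ b) - indicator (ρ c ≟ ρ b)) * (φ d - φ c)
      ≈⟨ *-cong (+-cong (indicator-yes (ρ d ≟ ρ b) q) (-‿cong (indicator-no (ρ c ≟ ρ b) (¬e ∘ ≡.trans (≡.sym p)))))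
                (+-cong (resp q) (-‿cong (resp p))) ⟩
    (1# - 0#) * (φ b - φ a)
      ≈⟨ solve 2 (λ x y → (con (1 , 0) :- con (0 , 0)) :* (x :- y) := x :- y) refl (φ b) (φ a) ⟩
    φ b - φ a ∎
  ... | inj₂ (p , q) = begin
    (indicator (ρ d ≟ ρ b) - indicator (ρ c ≟ ρ b)) * (φ d - φ c)
      ≈⟨ *-cong (+-cong (indicator-no (ρ d ≟ ρ b) (¬e ∘ ≡.trans (≡.sym q))) (-‿cong (indicator-yes (ρ c ≟ ρ b) p)))
                (+-cong (resp q) (-‿cong (resp p))) ⟩
    (0# - 1#) * (φ a - φ b)
      ≈⟨ solve 2 (λ x y → (con (0 , 0) :- con (1 , 0)) :* (y :- x) := x :- y) refl (φ b) (φ a) ⟩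
    φ b - φ a ∎

  -- A potential φ on the classes of ρ is the sum of one that is constant along e and one
  -- that is constant along f, unless e and f are parallel.
  record Splitting (ρ : Labelling n) (φ : Vector Carrier n) (e f : Edge n) : Set (c ⊔ ℓ) where
    field
      φₑ φ_f   : Vector Carrier n
      φ≈φₑ+φ_f : ∀ v → φ v ≈ φₑ v + φ_f v
      φₑ-resp  : Respects (merge ρ e) φₑ
      φ_f-resp : Respects (merge ρ f) φ_f

  -- As `e` and `f` are not parallel, some end `o` of `e` lies in the class of neither end of `f`.
  -- Any multiple of the indicator of the class of `o` is constant along `f`, and the factor is
  -- chosen so that subtracting it levels `φ` along `e`.
  split : ∀ {ρ : Labelling n} {φ} e f → Respects ρ φ → ¬ Loop ρ e → ¬ Loop (merge ρ e) f → Splitting ρ φ e f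
  split {n} {ρ} {φ} e@(a , b) f@(c , d) resp ¬e ¬f = choose (ρ b ≟ ρ c) (ρ b ≟ ρ d)
    where
    g : Fin n → Vector Carrier n
    g o v = indicator (ρ v ≟ ρ o)

    g-resp : ∀ o → Respects ρ (g o)
    g-resp o {u} {v} eq = indicator-cong (ρ u ≟ ρ o) (ρ v ≟ ρ o) (≡.trans (≡.sym eq)) (≡.trans eq)

    build : ∀ o x → ρ o ≢ ρ c → ρ o ≢ ρ d → φ a - x * g o a ≈ φ b - x * g o b → Splitting ρ φ e f
    build o x o≢c o≢d eq = record
      { φₑ       = λ v → φ v - x * g o v
      ; φ_f      = λ v → x * g o v
      ; φ≈φₑ+φ_f = λ v → solve 2 (λ y z → y := (y :- z) :+ z) refl (φ v) (x * g o v)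
      ; φₑ-resp  = respects-merge {φ = λ v → φ v - x * g o v} a b
                     (λ eq → +-cong (resp eq) (-‿cong (*-congˡ (g-resp o eq)))) eq
      ; φ_f-resp = respects-merge {φ = λ v → x * g o v} c d (λ eq → *-congˡ (g-resp o eq)) (*-congˡ (trans
                     (indicator-no (ρ c ≟ ρ o) (o≢c ∘ ≡.sym)) (sym (indicator-no (ρ d ≟ ρ o) (o≢d ∘ ≡.sym)))))
      }

    use-b : ρ b ≢ ρ c → ρ b ≢ ρ d → Splitting ρ φ e f
    use-b b≢c b≢d = build b (φ b - φ a) b≢c b≢d (begin
      φ a - (φ b - φ a) * g b a  ≈⟨ +-congˡ (-‿cong (*-congˡ (indicator-no (ρ a ≟ ρ b) ¬e))) ⟩
      φ a - (φ b - φ a) * 0#     ≈⟨ solve 2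
          (λ x y → x :- (y :- x) :* con (0 , 0) := y :- (y :- x) :* con (1 , 0)) refl (φ a) (φ b) ⟩
      φ b - (φ b - φ a) * 1#     ≈⟨ +-congˡ (-‿cong (*-congˡ (indicator-yes (ρ b ≟ ρ b) ≡.refl))) ⟨
      φ b - (φ b - φ a) * g b b  ∎)

    use-a : ρ a ≢ ρ c → ρ a ≢ ρ d → Splitting ρ φ e f
    use-a a≢c a≢d = build a (φ a - φ b) a≢c a≢d (begin
      φ a - (φ a - φ b) * g a a  ≈⟨ +-congˡ (-‿cong (*-congˡ (indicator-yes (ρ a ≟ ρ a) ≡.refl))) ⟩
      φ a - (φ a - φ b) * 1#     ≈⟨ solve 2
          (λ x y → x :- (x :- y) :* con (1 , 0) := y :- (x :- y) :* con (0 , 0)) refl (φ a) (φ b) ⟩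
      φ b - (φ a - φ b) * 0#     ≈⟨ +-congˡ (-‿cong (*-congˡ (indicator-no (ρ b ≟ ρ a) (¬e ∘ ≡.sym)))) ⟨
      φ b - (φ a - φ b) * g a b  ∎)

    choose : Dec (ρ b ≡ ρ c) → Dec (ρ b ≡ ρ d) → Splitting ρ φ e f
    choose (no b≢c) (no b≢d) = use-b b≢c b≢d
    choose (yes b≡c) _ = use-a (λ a≡c → ¬e (≡.trans a≡c (≡.sym b≡c)))
      (λ a≡d → ¬f (≡.trans (merge-⊑ ρ e (≡.sym b≡c)) (≡.trans (≡.sym (merge-loop ρ e)) (merge-⊑ ρ e a≡d))))
    choose (no _) (yes b≡d) = use-a
      (λ a≡c → ¬f (≡.trans (merge-⊑ ρ e (≡.sym a≡c)) (≡.trans (merge-loop ρ e) (merge-⊑ ρ e b≡d))))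
      (λ a≡d → ¬e (≡.trans a≡d (≡.sym b≡d)))

  drop-+ : ∀ {φ φ′ φ″ : Vector Carrier n} → (∀ v → φ v ≈ φ′ v + φ″ v) → ∀ e → drop φ e ≈ drop φ′ e + drop φ″ e
  drop-+ {φ′ = φ′} {φ″} eq (a , b) = trans (+-cong (eq b) (-‿cong (eq a)))
    (solve 4 (λ x y z w → (x :+ y) :- (z :+ w) := (x :- z) :+ (y :- w)) refl (φ′ b) (φ″ b) (φ′ a) (φ″ a))

  -- In the induction step, mixed collects the coefficients of the first conductance. It is
  -- linear in φ, and the parts φₑ and φ_f of a splitting reduce it to the induction
  -- hypotheses for the contractions of e and of f.
  voltage-kirchhoff : ∀ (E : Edges n m) c p e ρ {φ} → Respects ρ φ →
    voltage E c p e ρ * drop φ e + sum (λ i → c i * (voltage E c p (E i) / e) ρ * drop φ (E i))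
      ≈ (τ E c / e) ρ * drop φ p
  voltage-kirchhoff {m = zero} E c p e ρ {φ} resp = trans (+-identityʳ _) (go (loop? ρ e) (loop? ρ p))
    where
    F = τ E c
    go : Dec (Loop ρ e) → Dec (Loop ρ p) → voltage E c p e ρ * drop φ e ≈ (F / e) ρ * drop φ p
    go (yes l) _ = trans (*-congʳ (voltage-loop E c p e l)) (trans (zeroˡ _)
      (sym (trans (*-congʳ (/-loop F l)) (zeroˡ _))))
    go (no ¬e) (yes l) = begin
      voltage E c p e ρ * drop φ e ≈⟨ *-congʳ
          (trans (+-cong (trans (*-congʳ (/-loop F l)) (zeroˡ _))
          (-‿cong (trans (*-congʳ (/-loop F l)) (zeroˡ _)))) (-‿inverseʳ 0#)) ⟩
      0# * drop φ e                ≈⟨ zeroˡ _ ⟩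
      0#                           ≈⟨ zeroʳ _ ⟨
      (F / e) ρ * 0#               ≈⟨ *-congˡ (respects⇒drop≈0 {ρ = ρ} {φ} p resp l) ⟨
      (F / e) ρ * drop φ p         ∎
    go (no ¬e) (no ¬p) = begin
      voltage E c p e ρ * drop φ e
        ≈⟨ *-congʳ (solve 3 (λ x y z → x :* y :- x :* z := x :* (y :- z)) refl ((F / p) ρ) _ _) ⟩
      (F / p) ρ * drop (λ v → indicator (ρ v ≟ ρ (proj₂ p))) e * drop φ e
        ≈⟨ *-assoc _ _ _ ⟩
      (F / p) ρ * (drop (λ v → indicator (ρ v ≟ ρ (proj₂ p))) e * drop φ e)
        ≈⟨ *-congʳ (trans (/-edge F ¬p) (trans (indicator-cong (total? (merge ρ p)) (total? (merge ρ e))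
             (λ t → total-merge {ρ = ρ} p e t ¬e) (λ t → total-merge {ρ = ρ} e p t ¬p)) (sym (/-edge F ¬e)))) ⟩
      (F / e) ρ * (drop (λ v → indicator (ρ v ≟ ρ (proj₂ p))) e * drop φ e)
        ≈⟨ when-total (total? (merge ρ e)) ⟩
      (F / e) ρ * drop φ p ∎
      where
      when-total : Dec (Total (merge ρ e)) →
          (F / e) ρ * (drop (λ v → indicator (ρ v ≟ ρ (proj₂ p))) e * drop φ e) ≈ (F / e) ρ * drop φ p
      when-total (yes t) = *-congˡ (drop-class {ρ = ρ} {φ} p e resp (total-merge {ρ = ρ} e p t ¬p) ¬p ¬e)
      when-total (no ¬t) = trans (*-congʳ F≈0) (trans (zeroˡ _) (sym (trans (*-congʳ F≈0) (zeroˡ _))))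
        where
        F≈0 : (F / e) ρ ≈ 0#
        F≈0 = trans (/-edge F ¬e) (indicator-no (total? (merge ρ e)) ¬t)
  voltage-kirchhoff {n} {suc m} E c p e ρ {φ} resp = begin
    voltage E c p e ρ * d e + (x * (voltage E c p f / e) ρ * d f + sum
        (λ i → c′ i * (voltage E c p (E′ i) / e) ρ * d (E′ i)))
      ≈⟨ +-cong (*-congʳ (voltage-suc E c p e ρ)) (+-cong
           (*-congʳ (*-congˡ (/-cong e λ σ _ → voltage-first E c p σ)))
           (sum-cong λ i → trans (*-congʳ (*-congˡ
               (trans (/-cong e λ σ _ → voltage-suc E c p (E′ i) σ) (/-linear (V (E′ i)) (V (E′ i) / f) x e ρ))))
             (solve 5 (λ c v x w d → c :* (v :+ x :* w) :* d := c :* v :* d :+ x :* (c :* w :* d)) refl (c′ i)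
                 ((V (E′ i) / e) ρ) x ((V (E′ i) / f / e) ρ) (d (E′ i))))) ⟩
    (V e ρ + x * (V e / f) ρ) * d e + (x * (V f / e) ρ * d f + sum (λ i → S i + x * S₂ i))
      ≈⟨ +-congˡ (+-congˡ (trans (∑-distrib-+ S (λ i → x * S₂ i)) (+-congˡ (sym (*-distribˡ-sum x S₂))))) ⟩
    (V e ρ + x * (V e / f) ρ) * d e + (x * (V f / e) ρ * d f + (sum S + x * sum S₂))
      ≈⟨ solve 8 (λ v x w de v₂ df s s₂ → (v :+ x :* w) :* de :+ (x :* v₂ :* df :+ (s :+ x :* s₂))
           := (v :* de :+ s) :+ x :* (w :* de :+ (v₂ :* df :+ s₂))) refl (V e ρ) x ((V e / f) ρ) (d e)
               ((V f / e) ρ) (d f) (sum S) (sum S₂) ⟩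
    (V e ρ * d e + sum S) + x * mixed φ
      ≈⟨ +-cong (voltage-kirchhoff E′ c′ p e ρ resp) (*-congˡ (mixed-≈ (loop? ρ e) (loop? ρ f))) ⟩
    (F / e) ρ * d p + x * ((F / f / e) ρ * d p)
      ≈⟨ solve 4 (λ a x b d → a :* d :+ x :* (b :* d) := (a :+ x :* b) :* d) refl ((F / e) ρ) x ((F / f / e) ρ) (d p) ⟩
    ((F / e) ρ + x * (F / f / e) ρ) * d p
      ≈⟨ *-congʳ (/-linear F (F / f) x e ρ) ⟨
    (τ E c / e) ρ * d p ∎
    where
    E′ = tail E
    c′ = c ∘ suc
    x = c zero
    f = E zero
    F = τ E′ c′
    V : Edge n → Labelling n → Carrier
    V = voltage E′ c′ p
    d = drop φ
    S S₂ : Vector Carrier m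
    S i = c′ i * (V (E′ i) / e) ρ * d (E′ i)
    S₂ i = c′ i * (V (E′ i) / f / e) ρ * d (E′ i)
    mixed : Vector Carrier n → Carrier
    mixed ψ = (V e / f) ρ * drop ψ e +
        ((V f / e) ρ * drop ψ f + sum (λ i → c′ i * (V (E′ i) / f / e) ρ * drop ψ (E′ i)))

    drop-zero : ∀ {v} g → Loop ρ g → v * d g ≈ 0#
    drop-zero g l = trans (*-congˡ (respects⇒drop≈0 {ρ = ρ} {φ} g resp l)) (zeroʳ _)

    coefficient-zero : ∀ {v y} → v ≈ 0# → v * y ≈ 0#
    coefficient-zero eq = trans (*-congʳ eq) (zeroˡ _)

    all-zero : (V e / f) ρ * d e ≈ 0# → (V f / e) ρ * d f ≈ 0# → (∀ G → (G / f / e) ρ ≈ 0#) →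
      mixed φ ≈ (F / f / e) ρ * d p
    all-zero p₁ p₂ p₃ = begin
      mixed φ             ≈⟨ +-cong p₁
          (+-cong p₂ (sum-zero λ i → coefficient-zero (trans (*-congˡ (p₃ (V (E′ i)))) (zeroʳ _)))) ⟩
      0# + (0# + 0#)      ≈⟨ trans (+-identityˡ _) (+-identityˡ _) ⟩
      0#                  ≈⟨ coefficient-zero (p₃ F) ⟨
      (F / f / e) ρ * d p ∎

    mixed-≈ : Dec (Loop ρ e) → Dec (Loop ρ f) → mixed φ ≈ (F / f / e) ρ * d p
    mixed-≈ (yes l) _ = all-zero (drop-zero e l) (coefficient-zero (/-loop (V f) l)) (λ G → /-loop (G / f) l)
    mixed-≈ (no _) (yes l) = all-zero (coefficient-zero (/-loop (V e) l)) (drop-zero f l)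
      (λ G → /-vanishes (G / f) e λ σ ρ⊑σ _ → /-loop G (ρ⊑σ l))
    mixed-≈ (no ¬e) (no ¬f) = parallel (loop? (merge ρ e) f)
      where
      parallel : Dec (Loop (merge ρ e) f) → mixed φ ≈ (F / f / e) ρ * d p
      -- Contracting one of two parallel edges makes the other a loop: its voltage is then 0, and so
      -- is every double contraction.
      parallel (yes l) = all-zero
        (coefficient-zero (trans (/-edge (V e) ¬f) (voltage-loop E′ c′ p e (loop-swap ρ f e ¬f l))))
        (coefficient-zero (trans (/-edge (V f) ¬e) (voltage-loop E′ c′ p f l)))
        (λ G → trans (/-edge (G / f) ¬e) (/-loop G l))
      parallel (no ¬l) = begin
        mixed φ                                       ≈⟨ mixed-+ ⟩
        mixed φₑ + mixed φ_f                          ≈⟨ +-cong mixed-φₑ mixed-φ_f ⟩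
        (F / f / e) ρ * drop φₑ p + (F / f / e) ρ * drop φ_f p ≈⟨ distribˡ _ _ _ ⟨
        (F / f / e) ρ * (drop φₑ p + drop φ_f p)      ≈⟨ *-congˡ (drop-+ φ≈φₑ+φ_f p) ⟨
        (F / f / e) ρ * d p                           ∎
        where
        open Splitting (split {ρ = ρ} {φ} e f resp ¬e ¬l)
        a b : Carrier
        a = (V e / f) ρ
        b = (V f / e) ρ
        w : Vector Carrier m
        w i = c′ i * (V (E′ i) / f / e) ρ

        mixed-+ : mixed φ ≈ mixed φₑ + mixed φ_f
        mixed-+ = begin
          mixed φ
            ≈⟨ +-cong (*-congˡ (drop-+ φ≈φₑ+φ_f e)) (+-cong (*-congˡ (drop-+ φ≈φₑ+φ_f f))
                 (trans (sum-cong λ i → trans (*-congˡ (drop-+ φ≈φₑ+φ_f (E′ i))) (distribˡ (w i) _ _))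
                     (∑-distrib-+ (λ i → w i * drop φₑ (E′ i)) (λ i → w i * drop φ_f (E′ i))))) ⟩
          a * (drop φₑ e + drop φ_f e) + (b * (drop φₑ f + drop φ_f f) +
              (sum (λ i → w i * drop φₑ (E′ i)) + sum (λ i → w i * drop φ_f (E′ i))))
            ≈⟨ solve 8 (λ a x x′ b y y′ z z′ → a :* (x :+ x′) :+ (b :* (y :+ y′) :+ (z :+ z′)) :=
                 (a :* x :+ (b :* y :+ z)) :+ (a :* x′ :+ (b :* y′ :+ z′)))
                 refl a (drop φₑ e) (drop φ_f e) b (drop φₑ f) (drop φ_f f) _ _ ⟩
          mixed φₑ + mixed φ_f ∎

        mixed-φₑ : mixed φₑ ≈ (F / f / e) ρ * drop φₑ p
        mixed-φₑ = begin
          mixed φₑ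
            ≈⟨ +-cong (trans (*-congˡ (respects⇒drop≈0 {ρ = merge ρ e} {φₑ} e φₑ-resp (merge-loop ρ e))) (zeroʳ a))
                 (+-cong (*-congʳ (/-edge (V f) ¬e)) (sum-cong λ i → *-congʳ (*-congˡ (/-edge (V (E′ i) / f) ¬e)))) ⟩
          0# + (V f (merge ρ e) * drop φₑ f + sum (λ i → c′ i * (V (E′ i) / f) (merge ρ e) * drop φₑ (E′ i)))
            ≈⟨ +-identityˡ _ ⟩
          V f (merge ρ e) * drop φₑ f + sum (λ i → c′ i * (V (E′ i) / f) (merge ρ e) * drop φₑ (E′ i))
            ≈⟨ voltage-kirchhoff E′ c′ p f (merge ρ e) φₑ-resp ⟩
          (F / f) (merge ρ e) * drop φₑ p
            ≈⟨ *-congʳ (/-edge (F / f) ¬e) ⟨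
          (F / f / e) ρ * drop φₑ p ∎

        exchange : ∀ G → Extensional G → (G / f / e) ρ ≈ (G / e) (merge ρ f)
        exchange G ext = trans (/-comm G ext f e ρ) (/-edge (G / e) ¬f)

        mixed-φ_f : mixed φ_f ≈ (F / f / e) ρ * drop φ_f p
        mixed-φ_f = begin
          mixed φ_f
            ≈⟨ +-cong (*-congʳ (/-edge (V e) ¬f)) (+-cong
                 (trans (*-congˡ (respects⇒drop≈0 {ρ = merge ρ f} {φ_f} f φ_f-resp (merge-loop ρ f))) (zeroʳ b))
                 (sum-cong λ i → *-congʳ (*-congˡ (exchange (V (E′ i)) (voltage-extensional E′ c′ p (E′ i)))))) ⟩
          V e (merge ρ f) * drop φ_f e + (0# + sum (λ i → c′ i * (V (E′ i) / e) (merge ρ f) * drop φ_f (E′ i)))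
            ≈⟨ +-congˡ (+-identityˡ _) ⟩
          V e (merge ρ f) * drop φ_f e + sum (λ i → c′ i * (V (E′ i) / e) (merge ρ f) * drop φ_f (E′ i))
            ≈⟨ voltage-kirchhoff E′ c′ p e (merge ρ f) φ_f-resp ⟩
          (F / e) (merge ρ f) * drop φ_f p
            ≈⟨ *-congʳ (exchange F (τ-extensional E′ c′)) ⟨
          (F / f / e) ρ * drop φ_f p ∎

  energy : Edges n m → Vector Carrier m → Vector Carrier n → Vector Carrier n → Carrier
  energy E c φ ψ = sum (λ i → c i * drop φ (E i) * drop ψ (E i))

  energy-sym : ∀ (E : Edges n m) c φ ψ → energy E c φ ψ ≈ energy E c ψ φ
  energy-sym E c φ ψ = sum-cong λ i → solve 3 (λ c x y → c :* x :* y := c :* y :* x) refl (c i) (drop φ (E i))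
      (drop ψ (E i))

  -- Kirchhoff's current law in weak form. Both sides are affine in the first conductance, with no
  -- square on the left because of `voltage-first`. Its coefficient is `voltage-kirchhoff` for the
  -- first edge, and the constant term is the induction hypothesis.
  potential-energy : ∀ (E : Edges n m) c p ρ {φ} → Respects ρ φ →
    energy E c (potential E c p ρ) φ ≈ τ E c ρ * drop φ p
  potential-energy {m = zero} E c p ρ {φ} resp = go (total? ρ)
    where
    go : Dec (Total ρ) → 0# ≈ τ E c ρ * drop φ p
    go (yes t) = sym (trans (*-congˡ (respects⇒drop≈0 {ρ = ρ} {φ} p resp (t _ _))) (zeroʳ _))
    go (no ¬t) = sym (trans (*-congʳ (indicator-no (total? ρ) ¬t)) (zeroˡ _))
  potential-energy {n} {suc m} E c p ρ {φ} resp = begin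
    x * voltage E c p f ρ * d f + sum (λ i → c′ i * voltage E c p (E′ i) ρ * d (E′ i))
      ≈⟨ +-cong (*-congʳ (*-congˡ (voltage-first E c p ρ)))
           (sum-cong λ i → trans (*-congʳ (*-congˡ (voltage-suc E c p (E′ i) ρ)))
           (solve 5 (λ c v x w d → c :* (v :+ x :* w) :* d := c :* v :* d :+ x :* (c :* w :* d)) refl (c′ i)
               (V (E′ i) ρ) x ((V (E′ i) / f) ρ) (d (E′ i)))) ⟩
    x * V f ρ * d f + sum (λ i → S i + x * S₂ i)
      ≈⟨ +-congˡ (trans (∑-distrib-+ S (λ i → x * S₂ i)) (+-congˡ (sym (*-distribˡ-sum x S₂)))) ⟩
    x * V f ρ * d f + (sum S + x * sum S₂)
      ≈⟨ solve 5 (λ x v d s s₂ → x :* v :* d :+ (s :+ x :* s₂) := s :+ x :* (v :* d :+ s₂)) refl x (V f ρ) (d f)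
           (sum S) (sum S₂) ⟩
    sum S + x * (V f ρ * d f + sum S₂)
      ≈⟨ +-cong (potential-energy E′ c′ p ρ resp) (*-congˡ (voltage-kirchhoff E′ c′ p f ρ resp)) ⟩
    F ρ * d p + x * ((F / f) ρ * d p)
      ≈⟨ solve 4 (λ a x b d → a :* d :+ x :* (b :* d) := (a :+ x :* b) :* d) refl (F ρ) x ((F / f) ρ) (d p) ⟩
    τ E c ρ * d p ∎
    where
    E′ = tail E
    c′ = c ∘ suc
    x = c zero
    f = E zero
    F = τ E′ c′
    V : Edge n → Labelling n → Carrier
    V = voltage E′ c′ p
    d = drop φ
    S S₂ : Vector Carrier m
    S i = c′ i * V (E′ i) ρ * d (E′ i)
    S₂ i = c′ i * (V (E′ i) / f) ρ * d (E′ i)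

-- Sign rules for the reals, and the ring of complex numbers.

module RealProperties {a ℓ} (R : RealNumbers a ℓ) where
  open RealNumbers R

  ℝ-ring : CommutativeRing a ℓ
  ℝ-ring = record { isCommutativeRing = isCommutativeRing }

  open CommutativeRing ℝ-ring using
      (sym; trans; refl; +-identityˡ; +-identityʳ; +-congˡ; *-congˡ; +-cong; -‿inverseʳ; zeroʳ)
  open RingSolver ℝ-ring
  open IsStrictPartialOrder isStrictPartialOrder public using () renaming
      (irrefl to <-irrefl; trans to <-trans; <-respʳ-≈ to <-respʳ; <-respˡ-≈ to <-respˡ)

  0≉1 : ¬ (0# ≈ 1#)
  0≉1 0≈1 = <-irrefl 0≈1 0<1

  +-pos : ∀ {x y} → 0# < x → 0# < y → 0# < x + y
  +-pos {x} {y} 0<x 0<y = <-trans 0<y (<-respˡ (+-identityˡ y) (+-monoˡ-< y 0<x))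

  neg-pos : ∀ {x} → x < 0# → 0# < - x
  neg-pos {x} x<0 = <-respˡ (-‿inverseʳ x) (<-respʳ (+-identityˡ (- x)) (+-monoˡ-< (- x) x<0))

  -- A decided alternative, constructively stronger than `0# ≤ x`. Tree sums satisfy it because each
  -- of their terms is decided to be positive or zero.
  NonNegative : ℝ → Set ℓ
  NonNegative x = 0# < x ⊎ x ≈ 0#

  nonNegative⇒0≤ : ∀ {x} → NonNegative x → 0# ≤ x
  nonNegative⇒0≤ (inj₁ 0<x) x<0 = <-irrefl refl (<-trans 0<x x<0)
  nonNegative⇒0≤ (inj₂ x≈0) x<0 = <-irrefl x≈0 x<0

  pos+nonNegative : ∀ {x y} → 0# < x → NonNegative y → 0# < x + y
  pos+nonNegative 0<x (inj₁ 0<y) = +-pos 0<x 0<y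
  pos+nonNegative {x} 0<x (inj₂ y≈0) = <-respʳ (sym (trans (+-congˡ y≈0) (+-identityʳ x))) 0<x

  nonNegative+pos : ∀ {x y} → NonNegative x → 0# < y → 0# < x + y
  nonNegative+pos {x} {y} x≥0 0<y = <-respʳ (CommutativeRing.+-comm ℝ-ring y x) (pos+nonNegative 0<y x≥0)

  +-nonNegative : ∀ {x y} → NonNegative x → NonNegative y → NonNegative (x + y)
  +-nonNegative (inj₁ 0<x) y≥0 = inj₁ (pos+nonNegative 0<x y≥0)
  +-nonNegative (inj₂ x≈0) (inj₁ 0<y) = inj₁ (nonNegative+pos (inj₂ x≈0) 0<y)
  +-nonNegative (inj₂ x≈0) (inj₂ y≈0) = inj₂ (trans (+-cong x≈0 y≈0) (+-identityˡ 0#))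

  pos*nonNegative : ∀ {x y} → 0# < x → NonNegative y → NonNegative (x * y)
  pos*nonNegative 0<x (inj₁ 0<y) = inj₁ (*-pos 0<x 0<y)
  pos*nonNegative {x} 0<x (inj₂ y≈0) = inj₂ (trans (*-congˡ y≈0) (zeroʳ x))

  pos⇒inverse : ∀ {x} → 0# < x → ∃[ y ] x * y ≈ 1#
  pos⇒inverse {x} 0<x with IsHeytingField.#⇒invertible isHeytingField (<⇒# 0<x)
  -- Apartness of `0#` from `x` provides an inverse of `0# - x`, whence the sign.
  ... | y , _ , inv = - y , trans (solve 2 (λ x y → x :* (:- y) := (con (0 , 0) :- x) :* y) refl x y) inv

module ComplexRing {a ℓ} (R : RealNumbers a ℓ) where
  open RealProperties R using (ℝ-ring)
  open Complex R
  open RealNumbers R using (0#; 1#) renaming (_+_ to _+ᵣ_; _*_ to _*ᵣ_; -_ to -ᵣ_; _≈_ to _≈ᵣ_)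
  open RawRing rawRingℂ using (_≈_; _+_; _*_; -_) renaming (0# to 0ᶜ; 1# to 1ᶜ)
  open CommutativeRing ℝ-ring using
      (refl; sym; trans; +-cong; *-cong; -‿cong; +-assoc; +-comm; +-identityˡ; +-identityʳ; -‿inverseˡ; -‿inverseʳ)
  open RingSolver ℝ-ring

  ℂ-commutativeRing : CommutativeRing a ℓ
  ℂ-commutativeRing = record
    { _≈_ = _≈_ ; _+_ = _+_ ; _*_ = _*_ ; -_ = -_ ; 0# = 0ᶜ ; 1# = 1ᶜ
    ; isCommutativeRing = record
      { isRing = record
        { +-isAbelianGroup = record
          { isGroup = record
            { isMonoid = record
              { isSemigroup = record
                { isMagma = record
                  { isEquivalence = record
                    { refl  = refl , refl
                    ; sym   = λ (p , q) → sym p , sym q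
                    ; trans = λ (p , q) (r , s) → trans p r , trans q s
                    }
                  ; ∙-cong = λ (p , q) (r , s) → +-cong p r , +-cong q s
                  }
                ; assoc = λ x y z → +-assoc _ _ _ , +-assoc _ _ _
                }
              ; identity = (λ x → +-identityˡ _ , +-identityˡ _) , (λ x → +-identityʳ _ , +-identityʳ _)
              }
            ; inverse = (λ x → -‿inverseˡ _ , -‿inverseˡ _) , (λ x → -‿inverseʳ _ , -‿inverseʳ _)
            ; ⁻¹-cong = λ (p , q) → -‿cong p , -‿cong q
            }
          ; comm = λ x y → +-comm _ _ , +-comm _ _
          }
        ; *-cong = λ (p , q) (r , s) →
            +-cong (*-cong p r) (-‿cong (*-cong q s)) , +-cong (*-cong p s) (*-cong q r)
        ; *-assoc = λ (x +i x′) (y +i y′) (z +i z′) →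
            solve 6 (λ x x′ y y′ z z′ → (x :* y :- x′ :* y′) :* z :- (x :* y′ :+ x′ :* y) :* z′
              := x :* (y :* z :- y′ :* z′) :- x′ :* (y :* z′ :+ y′ :* z)) refl x x′ y y′ z z′ ,
            solve 6 (λ x x′ y y′ z z′ → (x :* y :- x′ :* y′) :* z′ :+ (x :* y′ :+ x′ :* y) :* z
              := x :* (y :* z′ :+ y′ :* z) :+ x′ :* (y :* z :- y′ :* z′)) refl x x′ y y′ z z′
        ; *-identity =
            (λ (x +i x′) → solve 2 (λ x x′ → con (1 , 0) :* x :- con (0 , 0) :* x′ := x) refl x x′ ,
                           solve 2 (λ x x′ → con (1 , 0) :* x′ :+ con (0 , 0) :* x := x′) refl x x′) ,
            (λ (x +i x′) → solve 2 (λ x x′ → x :* con (1 , 0) :- x′ :* con (0 , 0) := x) refl x x′ ,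
                           solve 2 (λ x x′ → x :* con (0 , 0) :+ x′ :* con (1 , 0) := x′) refl x x′)
        ; distrib =
            (λ (x +i x′) (y +i y′) (z +i z′) →
              solve 6 (λ x x′ y y′ z z′ → x :* (y :+ z) :- x′ :* (y′ :+ z′)
                := (x :* y :- x′ :* y′) :+ (x :* z :- x′ :* z′)) refl x x′ y y′ z z′ ,
              solve 6 (λ x x′ y y′ z z′ → x :* (y′ :+ z′) :+ x′ :* (y :+ z)
                := (x :* y′ :+ x′ :* y) :+ (x :* z′ :+ x′ :* z)) refl x x′ y y′ z z′) ,
            (λ (x +i x′) (y +i y′) (z +i z′) →
              solve 6 (λ x x′ y y′ z z′ → (y :+ z) :* x :- (y′ :+ z′) :* x′
                := (y :* x :- y′ :* x′) :+ (z :* x :- z′ :* x′)) refl x x′ y y′ z z′ ,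
              solve 6 (λ x x′ y y′ z z′ → (y :+ z) :* x′ :+ (y′ :+ z′) :* x
                := (y :* x′ :+ y′ :* x) :+ (z :* x′ :+ z′ :* x)) refl x x′ y y′ z z′)
        }
      ; *-comm = λ (x +i x′) (y +i y′) →
          solve 4 (λ x x′ y y′ → x :* y :- x′ :* y′ := y :* x :- y′ :* x′) refl x x′ y y′ ,
          solve 4 (λ x x′ y y′ → x :* y′ :+ x′ :* y := y :* x′ :+ y′ :* x) refl x x′ y y′
      }
    }

  fromReal-cong : ∀ {x y} → x ≈ᵣ y → fromReal x ≈ fromReal y
  fromReal-cong eq = eq , refl

  fromReal-+ : ∀ x y → fromReal (x +ᵣ y) ≈ fromReal x + fromReal y
  fromReal-+ x y = refl , sym (+-identityˡ 0#)

  fromReal-neg : ∀ x → fromReal (-ᵣ x) ≈ - fromReal x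
  fromReal-neg x = refl , solve 0 (con (0 , 0) := :- con (0 , 0)) refl

  fromReal-* : ∀ x y → fromReal (x *ᵣ y) ≈ fromReal x * fromReal y
  fromReal-* x y = solve 2 (λ x y → x :* y := x :* y :- con (0 , 0) :* con (0 , 0)) refl x y ,
                   solve 2 (λ x y → con (0 , 0) := x :* con (0 , 0) :+ con (0 , 0) :* y) refl x y

-- Sums over sets of edges by deletion and contraction.

module SubsetSums {c ℓ} (K : CommutativeRing c ℓ) where
  open CommutativeRing K hiding (zero)
  open SetoidReasoning setoid
  open RawSemiringDefinitions (RawRing.rawSemiring rawRing) using (product)

  private variable
    a p : Level
    A B : Set a
    m : ℕ

  listSum : (A → Carrier) → List A → Carrier
  listSum w = List.foldr (λ x s → w x + s) 0#

  listSum-++ : ∀ (w : A → Carrier) xs ys → listSum w (xs ++ ys) ≈ listSum w xs + listSum w ys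
  listSum-++ w []       ys = sym (+-identityˡ _)
  listSum-++ w (x ∷ xs) ys = trans (+-congˡ (listSum-++ w xs ys)) (sym (+-assoc _ _ _))

  listSum-map : ∀ (w : B → Carrier) (v : A → Carrier) k (f : A → B) → (∀ x → w (f x) ≈ k * v x) →
    ∀ xs → listSum w (map f xs) ≈ k * listSum v xs
  listSum-map w v k f eq []       = sym (zeroʳ k)
  listSum-map w v k f eq (x ∷ xs) = trans (+-cong (eq x) (listSum-map w v k f eq xs)) (sym (distribˡ k _ _))

  selectSum : (A → Carrier) → {P : Pred A p} → Decidable P → List A → Carrier
  selectSum w P? xs = listSum w (filter P? xs)

  selectSum-++ : ∀ (w : A → Carrier) {P : Pred A p} (P? : Decidable P) xs ys →
    selectSum w P? (xs ++ ys) ≈ selectSum w P? xs + selectSum w P? ys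
  selectSum-++ w P? []       ys = sym (+-identityˡ _)
  selectSum-++ w P? (x ∷ xs) ys with does (P? x)
  ... | true  = trans (+-congˡ (selectSum-++ w P? xs ys)) (sym (+-assoc _ _ _))
  ... | false = selectSum-++ w P? xs ys

  selectSum-map : ∀ (w : B → Carrier) (v : A → Carrier) k (f : A → B) → (∀ x → w (f x) ≈ k * v x) →
    ∀ {P : Pred B p} (P? : Decidable P) xs → selectSum w P? (map f xs) ≈ k * selectSum v (P? ∘ f) xs
  selectSum-map w v k f eq P? []       = sym (zeroʳ k)
  selectSum-map w v k f eq P? (x ∷ xs) with does (P? (f x))
  ... | true  = trans (+-cong (eq x) (selectSum-map w v k f eq P? xs)) (sym (distribˡ k _ _))
  ... | false = selectSum-map w v k f eq P? xs

  selectSum-none : ∀ (w : A → Carrier) {P : Pred A p} (P? : Decidable P) → (∀ x → ¬ P x) → ∀ xs → selectSum w P? xs ≈ 0#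
  selectSum-none w P? ¬P []       = refl
  selectSum-none w P? ¬P (x ∷ xs) with P? x
  ... | yes px = contradiction px (¬P x)
  ... | no _   = selectSum-none w P? ¬P xs

  weight : Vector Carrier m → Subset m → Carrier
  weight c F = product (λ e → if does (e ∈? F) then c e else 1#)

  subsetSum : Vector Carrier m → {P : Pred (Subset m) p} → Decidable P → Carrier
  subsetSum {m} c P? = selectSum (weight c) P? (subsets m)

  subsetSum-suc : ∀ (c : Vector Carrier (suc m)) {P : Pred (Subset (suc m)) p} (P? : Decidable P) →
    subsetSum c P? ≈ subsetSum (c ∘ suc) (P? ∘ (outside ∷_)) + c zero * subsetSum (c ∘ suc) (P? ∘ (inside ∷_))
  subsetSum-suc {m} c P? = begin
    selectSum (weight c) P? (map (outside ∷_) (subsets m) ++ map (inside ∷_) (subsets m))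
      ≈⟨ selectSum-++ (weight c) P? (map (outside ∷_) (subsets m)) (map (inside ∷_) (subsets m)) ⟩
    selectSum (weight c) P? (map (outside ∷_) (subsets m)) + selectSum (weight c) P? (map (inside ∷_) (subsets m))
      ≈⟨ +-cong (trans (selectSum-map (weight c) (weight (c ∘ suc)) 1# (outside ∷_) (λ _ → refl) P? (subsets m))
           (*-identityˡ _))
           (selectSum-map (weight c) (weight (c ∘ suc)) (c zero) (inside ∷_) (λ _ → refl) P? (subsets m)) ⟩
    subsetSum (c ∘ suc) (P? ∘ (outside ∷_)) + c zero * subsetSum (c ∘ suc) (P? ∘ (inside ∷_)) ∎

  open Labellings
  open TreePolynomial K

  private variable
    n q : ℕ

  subsetSum-none : ∀ (c : Vector Carrier m) {P : Pred (Subset m) p} (P? : Decidable P) →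
      (∀ F → ¬ P F) → subsetSum c P? ≈ 0#
  subsetSum-none {m} c P? ¬P = selectSum-none (weight c) P? ¬P (subsets m)

  -- The predicate is given only up to equivalence with `Tree`, so that the forest sums of the
  -- theorem enter with their own decision procedures. Splitting off the first edge yields the
  -- recursion of `τ`, since a loop lies in no tree.
  subsetSum-tree : ∀ (E : Edges n m) c ρ {P : Pred (Subset m) p} (P? : Decidable P) →
    (∀ F → P F ⇔ Tree ρ E F) → subsetSum c P? ≈ τ E c ρ
  subsetSum-tree {m = zero} E c ρ P? P⇔ with P? []
  ... | yes p = trans (+-identityʳ 1#) (sym (indicator-yes (total? ρ) (proj₂ (Equivalence.to (P⇔ []) p))))
  ... | no ¬p = sym (indicator-no (total? ρ) λ total → ¬p (Equivalence.from (P⇔ []) (tt , total)))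
  subsetSum-tree {m = suc m} E c ρ P? P⇔ = trans (subsetSum-suc c P?)
    (+-cong (subsetSum-tree (tail E) (c ∘ suc) ρ (P? ∘ (outside ∷_)) (P⇔ ∘ (outside ∷_)))
        (*-congˡ (go (loop? ρ (E zero)))))
    where
    go : Dec (Loop ρ (E zero)) → subsetSum (c ∘ suc) (P? ∘ (inside ∷_)) ≈ (τ (tail E) (c ∘ suc) / E zero) ρ
    go (yes l) = trans (subsetSum-none (c ∘ suc) (P? ∘ (inside ∷_)) λ F p →
        proj₁ (proj₁ (Equivalence.to (P⇔ (inside ∷ F)) p)) l)
      (sym (/-loop (τ (tail E) (c ∘ suc)) l))
    go (no ¬l) = trans (subsetSum-tree (tail E) (c ∘ suc) (merge ρ (E zero)) (P? ∘ (inside ∷_)) λ F → mk⇔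
        (λ p → let ((_ , forest) , total) = Equivalence.to (P⇔ (inside ∷ F)) p in forest , total)
        (λ (forest , total) → Equivalence.from (P⇔ (inside ∷ F)) ((¬l , forest) , total)))
      (sym (/-edge (τ (tail E) (c ∘ suc)) ¬l))

  -- The ports outside I are contracted and those in I are deleted.
  portMinor : (Labelling n → Carrier) → Edges n q → Subset q → Labelling n → Carrier
  portMinor F P []            = F
  portMinor F P (outside ∷ I) = portMinor F (tail P) I / P zero
  portMinor F P (inside ∷ I)  = portMinor F (tail P) I

  subsetSum-portMinor : ∀ (E : Edges n m) c (P : Edges n q) I ρ {Q : Pred (Subset m) p} (Q? : Decidable Q) →
    (∀ F → Q F ⇔ (Forest ρ P (∁ I) × Tree (contract ρ P (∁ I)) E F)) → subsetSum c Q? ≈ portMinor (τ E c) P I ρ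
  subsetSum-portMinor E c P []            ρ Q? Q⇔ = subsetSum-tree E c ρ Q? λ F →
    mk⇔ (proj₂ ∘ Equivalence.to (Q⇔ F)) (λ t → Equivalence.from (Q⇔ F) (tt , t))
  subsetSum-portMinor E c P (inside ∷ I)  ρ Q? Q⇔ = subsetSum-portMinor E c (tail P) I ρ Q? Q⇔
  subsetSum-portMinor E c P (outside ∷ I) ρ Q? Q⇔ = go (loop? ρ (P zero))
    where
    F′ = portMinor (τ E c) (tail P) I
    go : Dec (Loop ρ (P zero)) → subsetSum c Q? ≈ (F′ / P zero) ρ
    go (yes l) = trans (subsetSum-none c Q? λ F x → proj₁ (proj₁ (Equivalence.to (Q⇔ F) x)) l) (sym (/-loop F′ l))
    go (no ¬l) = trans (subsetSum-portMinor E c (tail P) I (merge ρ (P zero)) Q? λ F → mk⇔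
        (λ x → let ((_ , forest) , tree) = Equivalence.to (Q⇔ F) x in forest , tree)
        (λ (forest , tree) → Equivalence.from (Q⇔ F) ((¬l , forest) , tree)))
      (sym (/-edge F′ ¬l))

-- Positivity of tree sums.

module Positivity {a ℓ} (R : RealNumbers a ℓ) where
  open RealNumbers R
  open RealProperties R
  open CommutativeRing ℝ-ring using (sym; trans; refl; *-congˡ; +-congˡ; +-identityʳ; zeroʳ)
  open TreePolynomial ℝ-ring using (τ; _/_; /-loop; /-edge; indicator-yes; total?)
  open Labellings

  module _ {n : ℕ} where

    /-nonNegative : ∀ {F : Labelling n → ℝ} e → (∀ σ → NonNegative (F σ)) → ∀ ρ → NonNegative ((F / e) ρ)
    /-nonNegative {F} e F≥0 ρ = go (loop? ρ e)
      where
      go : Dec (Loop ρ e) → NonNegative ((F / e) ρ)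
      go (yes l) = inj₂ (/-loop F l)
      go (no ¬l) = Sum.map (<-respʳ (sym (/-edge F ¬l))) (trans (/-edge F ¬l)) (F≥0 (merge ρ e))

    τ-nonNegative : ∀ {m} (E : Edges n m) {c} → (∀ i → 0# < c i) → ∀ ρ → NonNegative (τ E c ρ)
    τ-nonNegative {zero} E c>0 ρ with does (total? ρ)
    ... | true  = inj₁ 0<1
    ... | false = inj₂ refl
    τ-nonNegative {suc m} E c>0 ρ = +-nonNegative (τ-nonNegative (tail E) (c>0 ∘ suc) ρ)
      (pos*nonNegative (c>0 zero) (/-nonNegative (E zero) (τ-nonNegative (tail E) (c>0 ∘ suc)) ρ))

    τ-pos : ∀ {m} (E : Edges n m) {c} → (∀ i → 0# < c i) → ∀ ρ → Total (contract ρ E ⊤) → 0# < τ E c ρ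
    τ-pos {zero} E c>0 ρ total = <-respʳ (sym (indicator-yes (total? ρ) total)) 0<1
    τ-pos {suc m} E {c} c>0 ρ total = go (loop? ρ e)
      where
      e = E zero
      F = τ (tail E) (c ∘ suc)
      go : Dec (Loop ρ e) → 0# < τ E c ρ
      go (yes l) = <-respʳ (sym (trans (+-congˡ (trans (*-congˡ (/-loop F l)) (zeroʳ _))) (+-identityʳ _)))
        (τ-pos (tail E) (c>0 ∘ suc) ρ λ u v → contract-mono {ρ = merge ρ e} {ρ} (tail E) {⊤}
          (merge-least (kernel ρ) ρ _ _ id l) id (total u v))
      go (no ¬l) = nonNegative+pos (τ-nonNegative (tail E) (c>0 ∘ suc) ρ)
        (*-pos (c>0 zero) (<-respʳ (sym (/-edge F ¬l)) (τ-pos (tail E) (c>0 ∘ suc) (merge ρ e) total)))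

-- Responses under contraction and deletion of ports, and the determinant formula.

module PortNetwork {a ℓ} (R : RealNumbers a ℓ) where
  open RealNumbers R hiding (sum)
  open RealProperties R
  open Complex R
  open ComplexRing R
  open Positivity R
  open Labellings
  open CommutativeRing ℝ-ring using
      (sym; trans; refl; setoid; *-congˡ; *-congʳ; +-congˡ; +-congʳ; +-cong; +-identityʳ; +-identityˡ;
      zeroʳ; zeroˡ; *-identityʳ; *-assoc)
  open AbelianGroupProperties (CommutativeRing.+-abelianGroup ℝ-ring) using (x∙y⁻¹≈ε⇒x≈y)
  open TreePolynomial ℝ-ring
  open SubsetSums ℝ-ring using (portMinor)
  open Sums ℝ-ring
  open MatrixOperations rawRing using (_*ⱽ_)
  open Determinant ℝ-ring using (schur; extend; extend-zero; extend-suc)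
  open Determinant ℂ-commutativeRing using (I+diag*; det-cong; det-I+diag*-suc) renaming (schur to schurᶜ)
  open MatrixOperations rawRingℂ using (det)
  private
    module ᶜ where
      open CommutativeRing ℂ-commutativeRing public
      open RingSolver ℂ-commutativeRing public

    variable
      n m q : ℕ

  -- L is the matrix of a map from port voltages to port currents; the ports are arbitrary
  -- pairs of vertices, and Kirchhoff's current law is stated weakly, against all test
  -- potentials φ that are constant on the classes of ρ.
  IsResponse : Edges n m → Vector ℝ m → Edges n q → Matrix ℝ q q → Labelling n → Set (a ⊔ ℓ)
  IsResponse E c P L ρ = ∀ y → ∃[ U ] Respects ρ U × (∀ i → drop U (P i) ≈ y i) ×
    (∀ φ → Respects ρ φ → energy E c U φ ≈ sum (λ i → (L *ⱽ y) i * drop φ (P i)))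

  minor₀₀ : Matrix ℝ (suc q) (suc q) → Matrix ℝ q q
  minor₀₀ L i j = L (suc i) (suc j)

  respects-contract : ∀ {ρ : Labelling n} {φ} (P : Edges n q) X → Respects ρ φ → (∀ i → drop φ (P i) ≈ 0#) →
    Respects (contract ρ P X) φ
  respects-contract {ρ = ρ} {φ} P X resp drops = contract-least isEq ρ P X resp
    (λ {i} _ → sym (x∙y⁻¹≈ε⇒x≈y _ _ (drops i)))
    where
    isEq : IsEquivalence (λ u v → φ u ≈ φ v)
    isEq = record { refl = refl ; sym = sym ; trans = trans }

  module _ {E : Edges n m} {c : Vector ℝ m} {P : Edges n (suc q)} {L : Matrix ℝ (suc q) (suc q)} {ρ : Labelling n}
           (response : IsResponse E c P L ρ) where

    private
      p = P zero
      P′ = tail P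

    port-notLoop : ¬ Loop ρ p
    port-notLoop l with response (λ _ → 1#)
    ... | U , resp , drops , _ = 0≉1 (trans (sym (respects⇒drop≈0 {ρ = ρ} {U} p resp l)) (drops zero))

    -- Voltage 0 at the first port makes `U` constant along it. The test potentials of the
    -- contracted graph are constant along it too, so its current drops out of the pairing.
    response-short : IsResponse E c P′ (minor₀₀ L) (merge ρ p)
    response-short y with response (0# ◂ y)
    ... | U , resp , drops , eq = U , respects-merge {ρ = ρ} {U} _ _ resp (sym (x∙y⁻¹≈ε⇒x≈y _ _ (drops zero))) ,
        (drops ∘ suc) ,
      λ φ resp-φ → trans (eq φ (resp-φ ∘ merge-⊑ ρ p)) (trans (+-cong
        (trans (*-congˡ (respects⇒drop≈0 {ρ = merge ρ p} {φ} p resp-φ (merge-loop ρ p))) (zeroʳ ((L *ⱽ (0# ◂ y)) zero)))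
        (sum-cong λ i → *-congʳ (trans (+-congʳ (zeroʳ (L (suc i) zero))) (+-identityˡ _))))
        (+-identityˡ _))

    -- The voltage at the deleted port is free, and `extend` sets it so that no current flows there.
    -- Eliminating this unknown is what produces the Schur complement.
    response-delete : ∀ a⁻¹ → L zero zero * a⁻¹ ≈ 1# → IsResponse E c P′ (schur L a⁻¹) ρ
    response-delete a⁻¹ inv y with response (extend L a⁻¹ y)
    ... | U , resp , drops , eq = U , resp , (drops ∘ suc) , λ φ resp-φ → trans (eq φ resp-φ) (trans (+-cong
        (trans (*-congʳ (extend-zero L a⁻¹ y inv)) (zeroˡ (drop φ p)))
        (sum-cong λ i → *-congʳ (extend-suc L a⁻¹ y i))) (+-identityˡ _))

    -- Kirchhoff's formula for the effective conductance at the first port, the others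
    -- being short-circuited: both sides are the energy pairing of the response to the
    -- unit voltage at p with Kirchhoff's potential.
    effective-conductance : L zero zero * τ E c (contract ρ P ⊤) ≈ τ E c (contract ρ P′ ⊤)
    effective-conductance with response (1# ◂ λ _ → 0#)
    ... | U , resp , drops , eq = begin
      L zero zero * τ E c (contract ρ P ⊤)
        ≈⟨ *-congˡ (τ-extensional E c (contract-merge ρ p P′ ⊤)) ⟩
      L zero zero * τ E c (merge ρ′ p)
        ≈⟨ *-congˡ (trans (voltage-port E c p ρ′) (/-edge (τ E c) ¬l)) ⟨
      L zero zero * drop V p
        ≈⟨ *-congʳ (trans (+-cong (*-identityʳ _) (sum-zero λ k → zeroʳ (L zero (suc k)))) (+-identityʳ _)) ⟨
      (L *ⱽ y) zero * drop V p
        ≈⟨ trans (+-congˡ (sum-zero λ i →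
             trans (*-congˡ (respects⇒drop≈0 {ρ = ρ′} {V} (P′ i) V-resp (contract-loop ρ P′ (∈⊤ {x = i}))))
             (zeroʳ ((L *ⱽ y) (suc i))))) (+-identityʳ _) ⟨
      sum (λ i → (L *ⱽ y) i * drop V (P i))
        ≈⟨ eq V (V-resp ∘ contract-⊑ ρ P′ ⊤) ⟨
      energy E c U V
        ≈⟨ energy-sym E c U V ⟩
      energy E c V U
        ≈⟨ potential-energy E c p ρ′ {U} U-resp ⟩
      τ E c ρ′ * drop U p
        ≈⟨ trans (*-congˡ (drops zero)) (*-identityʳ _) ⟩
      τ E c ρ′ ∎
      where
      open SetoidReasoning setoid
      ρ′ = contract ρ P′ ⊤
      V = potential E c p ρ′
      V-resp : Respects ρ′ V
      V-resp = potential-respects E c p ρ′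
      y : Vector ℝ (suc q)
      y = 1# ◂ λ _ → 0#
      U-resp : Respects ρ′ U
      U-resp = respects-contract {ρ = ρ} {U} P′ ⊤ resp (drops ∘ suc)
      ¬l : ¬ Loop ρ′ p
      ¬l l = 0≉1 (trans (sym (respects⇒drop≈0 {ρ = ρ′} {U} p U-resp l)) (drops zero))

  multiaffine : (Subset q → ℝ) → Vector ℂ q → ℂ
  multiaffine {zero}  g z = fromReal (g [])
  multiaffine {suc q} g z = multiaffine (g ∘ (outside ∷_)) (z ∘ suc) ᶜ.+ z zero ᶜ.* multiaffine
      (g ∘ (inside ∷_)) (z ∘ suc)

  multiaffine-cong : ∀ {g h : Subset q → ℝ} z → (∀ I → g I ≈ h I) → multiaffine g z ᶜ.≈ multiaffine h z
  multiaffine-cong {zero}  z g≈h = fromReal-cong (g≈h [])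
  multiaffine-cong {suc q} z g≈h = ᶜ.+-cong (multiaffine-cong (z ∘ suc) (g≈h ∘ (outside ∷_)))
    (ᶜ.*-congˡ (multiaffine-cong (z ∘ suc) (g≈h ∘ (inside ∷_))))

  fromReal-schur : ∀ (L : Matrix ℝ (suc q) (suc q)) a⁻¹ i j →
    schurᶜ (λ i j → fromReal (L i j)) (fromReal a⁻¹) i j ᶜ.≈ fromReal (schur L a⁻¹ i j)
  fromReal-schur L a⁻¹ i j = ᶜ.sym (ᶜ.trans (fromReal-+ _ _) (ᶜ.+-congˡ (ᶜ.trans (fromReal-neg _)
    (ᶜ.-‿cong (ᶜ.trans (fromReal-* _ _) (ᶜ.*-congʳ (fromReal-* _ _)))))))

  portMinor-determinant : ∀ (E : Edges n m) {c} → (∀ i → 0# < c i) → ∀ (P : Edges n q) L ρ →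
    Total (contract ρ E ⊤) → IsResponse E c P L ρ → ∀ z →
    multiaffine (λ I → portMinor (τ E c) P I ρ) z ᶜ.≈
      fromReal (τ E c (contract ρ P ⊤)) ᶜ.* det (I+diag* z (λ i j → fromReal (L i j)))
  portMinor-determinant {q = zero} E c>0 P L ρ total response z = ᶜ.sym (ᶜ.*-identityʳ _)
  portMinor-determinant {n} {m} {suc q} E {c} c>0 P L ρ total response z = ᶜ.trans
    (ᶜ.+-cong short (ᶜ.*-congˡ delete))
    (ᶜ.trans
      (ᶜ.solve 5 (λ Φ l z d₁ d₂ → Φ ᶜ.:* d₁ ᶜ.:+ z ᶜ.:* (l ᶜ.:* Φ ᶜ.:* d₂) ᶜ.:= Φ ᶜ.:*
          (d₁ ᶜ.:+ z ᶜ.:* (l ᶜ.:* d₂))) ᶜ.refl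
        (fromReal Φ) (fromReal l) (z zero) D₁ D₂)
      (ᶜ.*-congˡ (ᶜ.sym determinant)))
    where
    p = P zero
    P′ = tail P
    l = L zero zero
    Φ = τ E c (contract ρ P ⊤)
    total-mono : ∀ {σ} → ρ ⊑ σ → Total (contract σ E ⊤)
    total-mono {σ} ρ⊑σ u v = contract-mono {ρ = ρ} {σ} E {⊤} ρ⊑σ id (total u v)
    inverse : ∃[ t ] τ E c (contract ρ P′ ⊤) * t ≈ 1#
    inverse = pos⇒inverse (τ-pos E c>0 (contract ρ P′ ⊤) (total-mono (contract-⊑ ρ P′ ⊤)))
    -- By `effective-conductance`, `l * Φ` is the tree sum with only the later ports contracted.
    -- That sum is positive because the network is connected, which makes `l` invertible.
    a⁻¹ = Φ * proj₁ inverse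
    inv : l * a⁻¹ ≈ 1#
    inv = trans (sym (*-assoc _ _ _))
        (trans (*-congʳ (effective-conductance {E = E} {c} {P} {L} {ρ} response)) (proj₂ inverse))
    D₁ D₂ : ℂ
    D₁ = det (I+diag* (z ∘ suc) (λ i j → fromReal (minor₀₀ L i j)))
    D₂ = det (I+diag* (z ∘ suc) (λ i j → fromReal (schur L a⁻¹ i j)))
    short : multiaffine (λ I → (portMinor (τ E c) P′ I / p) ρ) (z ∘ suc) ᶜ.≈ fromReal Φ ᶜ.* D₁
    short = ᶜ.trans (multiaffine-cong (z ∘ suc)
        (λ I → /-edge (portMinor (τ E c) P′ I) (port-notLoop {E = E} {c} {P} {L} {ρ} response)))
      (portMinor-determinant E c>0 P′ (minor₀₀ L) (merge ρ p) (total-mono (merge-⊑ ρ p))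
        (response-short {E = E} {c} {P} {L} {ρ} response) (z ∘ suc))
    -- The induction hypothesis has as its factor the tree sum with the first port left open, which
    -- is `l * Φ`. In `short` the factor is `Φ` itself.
    delete : multiaffine (λ I → portMinor (τ E c) P′ I ρ) (z ∘ suc) ᶜ.≈ fromReal l ᶜ.* fromReal Φ ᶜ.* D₂
    delete = ᶜ.trans (portMinor-determinant E c>0 P′ (schur L a⁻¹) ρ total
        (response-delete {E = E} {c} {P} {L} {ρ} response a⁻¹ inv) (z ∘ suc))
      (ᶜ.*-congʳ (ᶜ.trans (fromReal-cong (sym (effective-conductance {E = E} {c} {P} {L} {ρ} response)))
          (fromReal-* _ _)))
    determinant : det (I+diag* z (λ i j → fromReal (L i j))) ᶜ.≈ D₁ ᶜ.+ z zero ᶜ.* (fromReal l ᶜ.* D₂)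
    determinant = ᶜ.trans (det-I+diag*-suc z (λ i j → fromReal (L i j)) (fromReal a⁻¹)
        (ᶜ.trans (ᶜ.sym (fromReal-* _ _)) (fromReal-cong inv)))
      (ᶜ.+-congˡ (ᶜ.*-congˡ (ᶜ.*-congˡ (det-cong (I+diag* (z ∘ suc) (schurᶜ (λ i j → fromReal (L i j)) (fromReal a⁻¹)))
        (I+diag* (z ∘ suc) (λ i j → fromReal (schur L a⁻¹ i j))) λ i j →
            ᶜ.+-congˡ (ᶜ.*-congˡ (fromReal-schur L a⁻¹ i j))))))

-- Order arguments with the negated inequality.

module OrderProperties {a ℓ} (R : RealNumbers a ℓ) where
  open RealNumbers R
  open RealProperties R
  open IsHeytingField isHeytingField using (tight; #-cotrans; invertible⇒#)
  open CommutativeRing ℝ-ring using (trans; refl; +-identityˡ; *-congʳ; *-identityˡ; *-comm; -‿cong; -‿inverseʳ; zeroˡ)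
  open RingSolver ℝ-ring

  <-cotrans : ∀ {x y} → x < y → ∀ z → x < z ⊎ z < y
  <-cotrans x<y z with #-cotrans (<⇒# x<y) z
  ... | inj₁ x#z = Sum.map₂ (λ z<x → <-trans z<x x<y) (#⇒<⊎> x#z)
  ... | inj₂ z#y = Sum.swap (Sum.map₂ (<-trans x<y) (#⇒<⊎> z#y))

  +-cancelˡ-neg : ∀ {x y} → x + y < x → y < 0#
  +-cancelˡ-neg {x} {y} x+y<x = <-respˡ (solve 2 (λ x y → (x :+ y) :+ :- x := y) refl x y)
    (<-respʳ (-‿inverseʳ x) (+-monoˡ-< (- x) x+y<x))

  -- `0# ≤ y` only denies `y < 0#`. Cotransitivity of `0# < x` at `x + y` leaves the claim or
  -- `x + y < x`, and the latter is denied.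
  pos+0≤ : ∀ {x y} → 0# < x → 0# ≤ y → 0# < x + y
  pos+0≤ {x} {y} 0<x 0≤y with <-cotrans 0<x (x + y)
  ... | inj₁ 0<x+y = 0<x+y
  ... | inj₂ x+y<x = contradiction (+-cancelˡ-neg x+y<x) 0≤y

  0≤+0≤ : ∀ {x y} → 0# ≤ x → 0# ≤ y → 0# ≤ x + y
  0≤+0≤ {x} {y} 0≤x 0≤y x+y<0 with <-cotrans x+y<0 x
  ... | inj₁ x+y<x = 0≤y (+-cancelˡ-neg x+y<x)
  ... | inj₂ x<0   = 0≤x x<0

  neg-neg : ∀ {x} → 0# < - x → x < 0#
  neg-neg {x} 0<-x = <-respˡ (+-identityˡ x)
      (<-respʳ (solve 1 (λ x → (:- x) :+ x := con (0 , 0)) refl x) (+-monoˡ-< x 0<-x))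

  square-pos : ∀ {x} → x # 0# → 0# < x * x
  square-pos {x} x#0 with #⇒<⊎> x#0
  ... | inj₁ x<0 = <-respʳ (solve 1 (λ x → (:- x) :* (:- x) := x :* x) refl x) (*-pos (neg-pos x<0) (neg-pos x<0))
  ... | inj₂ 0<x = *-pos 0<x 0<x

  -- A negative square excludes `x # 0#`, so `x ≈ 0#` by tightness, and then the square is 0.
  0≤square : ∀ x → 0# ≤ x * x
  0≤square x x²<0 = <-irrefl (trans (*-congʳ x≈0) (zeroˡ x)) x²<0
    where
    x≈0 : x ≈ 0#
    x≈0 = proj₁ (tight x 0#) λ x#0 → <-irrefl refl (<-trans (square-pos x#0) x²<0)

  inverse-pos : ∀ {x y} → 0# < x → x * y ≈ 1# → 0# < y
  inverse-pos {x} {y} 0<x xy≈1 with #⇒<⊎>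
      (invertible⇒# {y} {0#} (x , trans x*[y-0]≈xy xy≈1 , trans (*-comm _ _) (trans x*[y-0]≈xy xy≈1)))
    where
    x*[y-0]≈xy : x * (y - 0#) ≈ x * y
    x*[y-0]≈xy = solve 2 (λ x y → x :* (y :- con (0 , 0)) := x :* y) refl x y
  ... | inj₂ 0<y = 0<y
  ... | inj₁ y<0 = contradiction (<-trans 0<1
      (neg-neg (<-respʳ (trans (solve 2 (λ x y → x :* (:- y) := :- (x :* y)) refl x y) (-‿cong xy≈1))
                     (*-pos 0<x (neg-pos y<0))))) (<-irrefl refl)

  pos*0≤ : ∀ {x y} → 0# < x → 0# ≤ y → 0# ≤ x * y
  pos*0≤ {x} {y} 0<x 0≤y xy<0 with pos⇒inverse 0<x
  ... | t , xt≈1 = 0≤y (neg-neg (<-respʳ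
    (trans (solve 3 (λ x y t → t :* (:- (x :* y)) := :- (x :* t :* y)) refl x y t)
        (-‿cong (trans (*-congʳ xt≈1) (*-identityˡ y))))
    (*-pos (inverse-pos 0<x xt≈1) (neg-pos xy<0))))

-- Nonvanishing of the determinant by its numerical range.

module Stability {a ℓ} (R : RealNumbers a ℓ) where
  open RealNumbers R using (ℝ; 0#; 1#; _<_; _≤_; 0<1; *-pos; _+_; _*_; -_; _-_; _≈_)
  open RealProperties R
  open OrderProperties R
  open Complex R
  open ComplexRing R
  private
    module ℝ where
      open CommutativeRing ℝ-ring public
      open RingSolver ℝ-ring public
      open Sums ℝ-ring public
    module ᶜ where
      open CommutativeRing ℂ-commutativeRing public
      open RingSolver ℂ-commutativeRing public
      open Sums ℂ-commutativeRing public
  open Determinant ℂ-commutativeRing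
  open MatrixOperations rawRingℂ using (det; _*ⱽ_; 1ᴹ)

  conjugate : ℂ → ℂ
  conjugate (x +i y) = x +i (- y)

  normSquared : ℂ → ℝ
  normSquared (x +i y) = x * x + y * y

  0≤normSquared : ∀ w → 0# ≤ normSquared w
  0≤normSquared (x +i y) = 0≤+0≤ (0≤square x) (0≤square y)

  normSquared-pos : ∀ {w} → 0# < im w → 0# < normSquared w
  normSquared-pos {x +i y} 0<y = <-respʳ (ℝ.+-comm _ _) (pos+0≤ (*-pos 0<y 0<y) (0≤square x))

  *-conjugate : ∀ w → w ᶜ.* conjugate w ᶜ.≈ fromReal (normSquared w)
  *-conjugate (x +i y) =
    ℝ.solve 2 (λ x y → x ℝ.:* x ℝ.:- y ℝ.:* (ℝ.:- y) ℝ.:= x ℝ.:* x ℝ.:+ y ℝ.:* y) ℝ.refl x y ,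
    ℝ.solve 2 (λ x y → x ℝ.:* (ℝ.:- y) ℝ.:+ y ℝ.:* x ℝ.:= ℝ.con (0 , 0)) ℝ.refl x y

  -- The value `w* diag(u) M w`. The scaling `u` is kept outside `M`, so that elimination and
  -- determinant concern `M` itself; the Schur complement then goes with the scaling `u ∘ suc`.
  form : ∀ {n} → Vector ℂ n → Matrix ℂ n n → Vector ℂ n → ℂ
  form u M w = ᶜ.sum (λ i → conjugate (w i) ᶜ.* (u i ᶜ.* (M *ⱽ w) i))

  -- The numerical range of the matrix with rows u i M i lies in the upper half plane.
  Accretive : ∀ {n} → Vector ℂ n → Matrix ℂ n n → Set (a ⊔ ℓ)
  Accretive u M = ∀ w → (∃[ i ] 0# < normSquared (w i)) → 0# < im (form u M w)

  unit : ∀ {n} → Vector ℂ (suc n)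
  unit = fromReal 1# ◂ λ _ → fromReal 0#

  form-unit : ∀ {n} u (M : Matrix ℂ (suc n) (suc n)) → form u M unit ᶜ.≈ u zero ᶜ.* M zero zero
  form-unit u M = begin
    conjugate 1ᶜ ᶜ.* (u zero ᶜ.* (M *ⱽ unit) zero) ᶜ.+ ᶜ.sum
        (λ i → conjugate 0ᶜ ᶜ.* (u (suc i) ᶜ.* (M *ⱽ unit) (suc i)))
      ≈⟨ ᶜ.+-cong (ᶜ.*-cong (ℝ.refl , -0≈0) (ᶜ.*-congˡ (ᶜ.trans
           (ᶜ.+-cong (ᶜ.*-identityʳ (M zero zero)) (ᶜ.sum-zero λ k → ᶜ.zeroʳ (M zero (suc k))))
               (ᶜ.+-identityʳ (M zero zero)))))
           (ᶜ.sum-zero λ i → ᶜ.trans (ᶜ.*-congʳ {u (suc i) ᶜ.* (M *ⱽ unit) (suc i)} (ℝ.refl , -0≈0))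
               (ᶜ.zeroˡ (u (suc i) ᶜ.* (M *ⱽ unit) (suc i)))) ⟩
    1ᶜ ᶜ.* (u zero ᶜ.* M zero zero) ᶜ.+ 0ᶜ
      ≈⟨ ᶜ.trans (ᶜ.+-identityʳ _) (ᶜ.*-identityˡ _) ⟩
    u zero ᶜ.* M zero zero ∎
    where
    open SetoidReasoning ᶜ.setoid
    1ᶜ = fromReal 1#
    0ᶜ = fromReal 0#
    -0≈0 : - 0# ≈ 0#
    -0≈0 = ℝ.solve 0 (ℝ.:- ℝ.con (0 , 0) ℝ.:= ℝ.con (0 , 0)) ℝ.refl

  -- At the first unit vector the form is `v = u₀ M₀₀`, so `im v` and with it `|v|²` are positive.
  -- The inverse of `M₀₀` is `u₀` times the conjugate of `v`, divided by `|v|²`.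
  accretive-pivot : ∀ {n} u (M : Matrix ℂ (suc n) (suc n)) → Accretive u M →
      ∃[ a⁻¹ ] M zero zero ᶜ.* a⁻¹ ᶜ.≈ fromReal 1#
  accretive-pivot u M acc = u zero ᶜ.* conjugate v ᶜ.* fromReal t , (begin
    M zero zero ᶜ.* (u zero ᶜ.* conjugate v ᶜ.* fromReal t)
      ≈⟨ ᶜ.solve 4 (λ m u v t → m ᶜ.:* (u ᶜ.:* v ᶜ.:* t) ᶜ.:= u ᶜ.:* m ᶜ.:* v ᶜ.:* t) ᶜ.refl (M zero zero)
           (u zero) (conjugate v) (fromReal t) ⟩
    v ᶜ.* conjugate v ᶜ.* fromReal t             ≈⟨ ᶜ.*-congʳ (*-conjugate v) ⟩
    fromReal (normSquared v) ᶜ.* fromReal t      ≈⟨ fromReal-* _ _ ⟨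
    fromReal (normSquared v * t)                 ≈⟨ fromReal-cong (proj₂ inverse) ⟩
    fromReal 1#                                  ∎)
    where
    open SetoidReasoning ᶜ.setoid
    v = u zero ᶜ.* M zero zero
    0<im-v : 0# < im v
    0<im-v = <-respʳ (proj₂ (form-unit u M)) (acc unit (zero , <-respʳ
      (ℝ.solve 0 (ℝ.con (1 , 0) ℝ.:= ℝ.con (1 , 0) ℝ.:* ℝ.con (1 , 0) ℝ.:+ ℝ.con (0 , 0) ℝ.:* ℝ.con (0 , 0))
          ℝ.refl) 0<1))
    inverse : ∃[ t ] normSquared v * t ≈ 1#
    inverse = pos⇒inverse (normSquared-pos {v} 0<im-v)
    t = proj₁ inverse

  -- The form of the Schur complement at `w` is the form of `M` at the extension of `w` for which
  -- the first entry of the image vanishes.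
  accretive-schur : ∀ {n} u (M : Matrix ℂ (suc n) (suc n)) a⁻¹ → M zero zero ᶜ.* a⁻¹ ᶜ.≈ fromReal 1# →
    Accretive u M → Accretive (u ∘ suc) (schur M a⁻¹)
  accretive-schur u M a⁻¹ inv acc w (i , 0<w) = <-respʳ (proj₂ (ᶜ.trans
    (ᶜ.+-cong
      (ᶜ.trans (ᶜ.*-congˡ {conjugate (extend M a⁻¹ w zero)}
          (ᶜ.trans (ᶜ.*-congˡ {u zero} (extend-zero M a⁻¹ w inv)) (ᶜ.zeroʳ (u zero)))) (ᶜ.zeroʳ _))
      (ᶜ.sum-cong λ j → ᶜ.*-congˡ {conjugate (w j)} (ᶜ.*-congˡ {u (suc j)} (extend-suc M a⁻¹ w j))))
    (ᶜ.+-identityˡ _)))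
    (acc (extend M a⁻¹ w) (suc i , 0<w))

  accretive⇒det≉0 : ∀ {n} u (M : Matrix ℂ n n) → Accretive u M → ¬ (det M ᶜ.≈ fromReal 0#)
  accretive⇒det≉0 {zero}  u M acc (1≈0 , _) = 0≉1 (ℝ.sym 1≈0)
  accretive⇒det≉0 {suc n} u M acc det≈0 = accretive⇒det≉0 (u ∘ suc) (schur M a⁻¹)
      (accretive-schur u M a⁻¹ inv acc) (begin
    det (schur M a⁻¹)                             ≈⟨ ᶜ.*-identityˡ _ ⟨
    fromReal 1# ᶜ.* det (schur M a⁻¹)             ≈⟨ ᶜ.*-congʳ inv ⟨
    M zero zero ᶜ.* a⁻¹ ᶜ.* det (schur M a⁻¹)     ≈⟨ ᶜ.solve 3
        (λ m a d → m ᶜ.:* a ᶜ.:* d ᶜ.:= a ᶜ.:* (m ᶜ.:* d)) ᶜ.refl (M zero zero) a⁻¹ (det (schur M a⁻¹)) ⟩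
    a⁻¹ ᶜ.* (M zero zero ᶜ.* det (schur M a⁻¹))   ≈⟨ ᶜ.*-congˡ {a⁻¹} (ᶜ.trans (ᶜ.sym (det-schur M a⁻¹ inv)) det≈0) ⟩
    a⁻¹ ᶜ.* fromReal 0#                           ≈⟨ ᶜ.zeroʳ a⁻¹ ⟩
    fromReal 0#                                   ∎)
    where
    open SetoidReasoning ᶜ.setoid
    a⁻¹ = proj₁ (accretive-pivot u M acc)
    inv = proj₂ (accretive-pivot u M acc)

  im-sum : ∀ {n} (f : Vector ℂ n) → im (ᶜ.sum f) ≡ ℝ.sum (im ∘ f)
  im-sum {zero}  f = ≡.refl
  im-sum {suc n} f = ≡.cong (im (f zero) +_) (im-sum (f ∘ suc))

  sum-0≤ : ∀ {n} (f : Vector ℝ n) → (∀ i → 0# ≤ f i) → 0# ≤ ℝ.sum f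
  sum-0≤ {zero}  f f≥0 = <-irrefl ℝ.refl
  sum-0≤ {suc n} f f≥0 = 0≤+0≤ (f≥0 zero) (sum-0≤ (f ∘ suc) (f≥0 ∘ suc))

  sum-pos : ∀ {n} (f : Vector ℝ n) → (∀ i → 0# ≤ f i) → ∀ i → 0# < f i → 0# < ℝ.sum f
  sum-pos f f≥0 zero    fi>0 = pos+0≤ fi>0 (sum-0≤ (f ∘ suc) (f≥0 ∘ suc))
  sum-pos f f≥0 (suc i) fi>0 = <-respʳ (ℝ.+-comm _ _) (pos+0≤ (sum-pos (f ∘ suc) (f≥0 ∘ suc) i fi>0) (f≥0 zero))

  module _ {n} (L : Matrix ℝ n n) (L-sym : ∀ i j → L i j ≈ L j i) where

    private
      Lᶜ : Matrix ℂ n n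
      Lᶜ i j = fromReal (L i j)

    -- `w* L w` is real: its imaginary part is a double sum of `A - B`, and `B` turns into `A` on
    -- exchanging the indices, by symmetry of `L`.
    symmetric-form : ∀ w → ℝ.sum (λ i → im (conjugate (w i) ᶜ.* (Lᶜ *ⱽ w) i)) ≈ 0#
    symmetric-form w = begin
      ℝ.sum (λ i → im (conjugate (w i) ᶜ.* (Lᶜ *ⱽ w) i))
        ≈⟨ ℝ.sum-cong (λ i → ℝ.trans (proj₂ (ᶜ.*-distribˡ-sum (conjugate (w i)) (λ j → Lᶜ i j ᶜ.* w j)))
             (ℝ.reflexive (im-sum (λ j → conjugate (w i) ᶜ.* (Lᶜ i j ᶜ.* w j))))) ⟩
      ℝ.sum (λ i → ℝ.sum (λ j → im (conjugate (w i) ᶜ.* (Lᶜ i j ᶜ.* w j))))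
        ≈⟨ ℝ.sum-cong (λ i → ℝ.sum-cong λ j → ℝ.solve 5 (λ l x y x′ y′ →
             x ℝ.:* (l ℝ.:* y′ ℝ.:+ ℝ.con (0 , 0) ℝ.:* x′) ℝ.:+ (ℝ.:- y) ℝ.:* (l ℝ.:* x′ ℝ.:- ℝ.con (0 , 0) ℝ.:* y′)
               ℝ.:= l ℝ.:* (x ℝ.:* y′) ℝ.:+ (ℝ.:- (l ℝ.:* (x′ ℝ.:* y)))) ℝ.refl (L i j) (re (w i)) (im (w i))
                   (re (w j)) (im (w j))) ⟩
      ℝ.sum (λ i → ℝ.sum (λ j → A i j + - B i j))
        ≈⟨ ℝ.sum-cong (λ i → ℝ.∑-distrib-+ (A i) (λ j → - B i j)) ⟩
      ℝ.sum (λ i → ℝ.sum (A i) + ℝ.sum (λ j → - B i j))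
        ≈⟨ ℝ.∑-distrib-+ (λ i → ℝ.sum (A i)) (λ i → ℝ.sum (λ j → - B i j)) ⟩
      ℝ.sum (λ i → ℝ.sum (A i)) + ℝ.sum (λ i → ℝ.sum (λ j → - B i j))
        ≈⟨ ℝ.+-congˡ (ℝ.∑-comm (λ i j → - B i j)) ⟩
      ℝ.sum (λ i → ℝ.sum (A i)) + ℝ.sum (λ j → ℝ.sum (λ i → - B i j))
        ≈⟨ ℝ.+-congˡ (ℝ.sum-cong λ j → ℝ.sum-cong λ i → ℝ.-‿cong (ℝ.*-congʳ (L-sym i j))) ⟩
      ℝ.sum (λ i → ℝ.sum (A i)) + ℝ.sum (λ j → ℝ.sum (λ i → - A j i))
        ≈⟨ ℝ.∑-distrib-+ (λ i → ℝ.sum (A i)) (λ i → ℝ.sum (λ j → - A i j)) ⟨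
      ℝ.sum (λ i → ℝ.sum (A i) + ℝ.sum (λ j → - A i j))
        ≈⟨ ℝ.sum-zero (λ i → ℝ.trans (ℝ.sym (ℝ.∑-distrib-+ (A i) (λ j → - A i j)))
             (ℝ.sum-zero λ j → ℝ.-‿inverseʳ (A i j))) ⟩
      0# ∎
      where
      open SetoidReasoning ℝ.setoid
      A B : Fin n → Fin n → ℝ
      A i j = L i j * (re (w i) * im (w j))
      B i j = L i j * (re (w j) * im (w i))

    module _ (z : Vector ℂ n) (z>0 : ∀ i → 0# < im (z i)) where

      private
        inverse : ∀ i → ∃[ t ] normSquared (z i) * t ≈ 1#
        inverse i = pos⇒inverse (normSquared-pos {z i} (z>0 i))
        t : Vector ℝ n
        t i = proj₁ (inverse i)
        -- u i = - 1 / z i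
        u : Vector ℂ n
        u i = (- (re (z i) * t i)) +i (im (z i) * t i)
        M : Matrix ℂ n n
        M = I+diag* z Lᶜ

      u*z : ∀ i → u i ᶜ.* z i ᶜ.≈ ᶜ.- fromReal 1#
      u*z i = ℝ.trans (ℝ.solve 3 (λ x y t → (ℝ.:- (x ℝ.:* t)) ℝ.:* x ℝ.:- (y ℝ.:* t) ℝ.:* y ℝ.:= ℝ.:-
          ((x ℝ.:* x ℝ.:+ y ℝ.:* y) ℝ.:* t)) ℝ.refl (re (z i)) (im (z i)) (t i))
                (ℝ.-‿cong (proj₂ (inverse i))) ,
              ℝ.solve 3 (λ x y t → (ℝ.:- (x ℝ.:* t)) ℝ.:* y ℝ.:+ (y ℝ.:* t) ℝ.:* x ℝ.:= ℝ.:- ℝ.con (0 , 0))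
                  ℝ.refl (re (z i)) (im (z i)) (t i)

      M*w : ∀ w i → (M *ⱽ w) i ᶜ.≈ w i ᶜ.+ z i ᶜ.* (Lᶜ *ⱽ w) i
      M*w w i = begin
        ᶜ.sum (λ j → (1ᴹ i j ᶜ.+ z i ᶜ.* Lᶜ i j) ᶜ.* w j)
          ≈⟨ ᶜ.sum-cong (λ j → ᶜ.solve 4 (λ δ z l w → (δ ᶜ.:+ z ᶜ.:* l) ᶜ.:* w ᶜ.:= δ ᶜ.:* w ᶜ.:+ z ᶜ.:*
               (l ᶜ.:* w)) ᶜ.refl (1ᴹ i j) (z i) (Lᶜ i j) (w j)) ⟩
        ᶜ.sum (λ j → 1ᴹ i j ᶜ.* w j ᶜ.+ z i ᶜ.* (Lᶜ i j ᶜ.* w j))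
          ≈⟨ ᶜ.∑-distrib-+ (λ j → 1ᴹ i j ᶜ.* w j) (λ j → z i ᶜ.* (Lᶜ i j ᶜ.* w j)) ⟩
        ᶜ.sum (λ j → 1ᴹ i j ᶜ.* w j) ᶜ.+ ᶜ.sum (λ j → z i ᶜ.* (Lᶜ i j ᶜ.* w j))
          ≈⟨ ᶜ.+-cong (ᶜ.trans (ᶜ.sum-cong δ*) (ᶜ.sum-indicator i w))
               (ᶜ.sym (ᶜ.*-distribˡ-sum (z i) (λ j → Lᶜ i j ᶜ.* w j))) ⟩
        w i ᶜ.+ z i ᶜ.* (Lᶜ *ⱽ w) i ∎
        where
        open SetoidReasoning ᶜ.setoid
        δ* : ∀ j → 1ᴹ i j ᶜ.* w j ᶜ.≈ (if does (i ≟ j) then w j else fromReal 0#)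
        δ* j with does (i ≟ j)
        ... | true  = ᶜ.*-identityˡ (w j)
        ... | false = ᶜ.zeroˡ (w j)

      -- As `u i * z i = - 1`, each summand is the conjugate of `w i` times `u i * w i - (L w) i`.
      -- The terms with `L` have total imaginary part 0. The others give `im (u i) * |w i|²`, where
      -- `im (u i) = im (z i) / |z i|²` is positive.
      I+diag*-accretive : Accretive u M
      I+diag*-accretive w (k , 0<w) = <-respʳ (ℝ.sym im-form)
        (sum-pos (λ i → im (z i) * t i * normSquared (w i)) (λ i → pos*0≤ (u>0 i) (0≤normSquared (w i))) k
            (*-pos (u>0 k) 0<w))
        where
        open SetoidReasoning ℝ.setoid
        u>0 : ∀ i → 0# < im (z i) * t i
        u>0 i = *-pos (z>0 i) (inverse-pos (normSquared-pos {z i} (z>0 i)) (proj₂ (inverse i)))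
        summand : ∀ i → conjugate (w i) ᶜ.* (u i ᶜ.* (M *ⱽ w) i) ᶜ.≈ conjugate (w i) ᶜ.* (u i ᶜ.* w i) ᶜ.-
            conjugate (w i) ᶜ.* (Lᶜ *ⱽ w) i
        summand i = ᶜ.trans (ᶜ.*-congˡ {conjugate (w i)} (ᶜ.*-congˡ {u i} (M*w w i)))
          (ᶜ.trans (ᶜ.solve 5 (λ c u w z l → c ᶜ.:* (u ᶜ.:* (w ᶜ.:+ z ᶜ.:* l)) ᶜ.:= c ᶜ.:* (u ᶜ.:* w) ᶜ.:+
              (u ᶜ.:* z) ᶜ.:* (c ᶜ.:* l)) ᶜ.refl
             (conjugate (w i)) (u i) (w i) (z i) ((Lᶜ *ⱽ w) i))
          (ᶜ.+-congˡ {conjugate (w i) ᶜ.* (u i ᶜ.* w i)} (ᶜ.trans (ᶜ.*-congʳ {conjugate (w i) ᶜ.* (Lᶜ *ⱽ w) i} (u*z i))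
            (ᶜ.solve 1 (λ x → (ᶜ.:- ᶜ.con (1 , 0)) ᶜ.:* x ᶜ.:= ᶜ.:- x) ᶜ.refl (conjugate (w i) ᶜ.* (Lᶜ *ⱽ w) i)))))
        im-form : im (form u M w) ≈ ℝ.sum (λ i → im (z i) * t i * normSquared (w i))
        im-form = begin
          im (form u M w)
            ≈⟨ ℝ.reflexive (im-sum (λ i → conjugate (w i) ᶜ.* (u i ᶜ.* (M *ⱽ w) i))) ⟩
          ℝ.sum (λ i → im (conjugate (w i) ᶜ.* (u i ᶜ.* (M *ⱽ w) i)))
            ≈⟨ ℝ.sum-cong (λ i → ℝ.trans (proj₂ (summand i)) (ℝ.+-cong
                 (ℝ.solve 4 (λ x y r s → x ℝ.:* (r ℝ.:* y ℝ.:+ s ℝ.:* x) ℝ.:+ (ℝ.:- y) ℝ.:*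
                     (r ℝ.:* x ℝ.:- s ℝ.:* y) ℝ.:= s ℝ.:* (x ℝ.:* x ℝ.:+ y ℝ.:* y)) ℝ.refl
                   (re (w i)) (im (w i)) (re (u i)) (im (u i)))
                 (ℝ.solve 1 (λ x → ℝ.:- x ℝ.:= (ℝ.:- ℝ.con (1 , 0)) ℝ.:* x) ℝ.refl
                     (im (conjugate (w i) ᶜ.* (Lᶜ *ⱽ w) i))))) ⟩
          ℝ.sum (λ i → im (z i) * t i * normSquared (w i) + (- 1#) * im (conjugate (w i) ᶜ.* (Lᶜ *ⱽ w) i))
            ≈⟨ ℝ.∑-distrib-+ (λ i → im (z i) * t i * normSquared (w i))
                 (λ i → (- 1#) * im (conjugate (w i) ᶜ.* (Lᶜ *ⱽ w) i)) ⟩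
          ℝ.sum (λ i → im (z i) * t i * normSquared (w i)) + ℝ.sum (λ i → (- 1#) * im (conjugate (w i) ᶜ.* (Lᶜ *ⱽ w) i))
            ≈⟨ ℝ.+-congˡ (ℝ.trans (ℝ.sym (ℝ.*-distribˡ-sum (- 1#) (λ i → im (conjugate (w i) ᶜ.* (Lᶜ *ⱽ w) i))))
                 (ℝ.trans (ℝ.*-congˡ (symmetric-form w)) (ℝ.zeroʳ (- 1#)))) ⟩
          ℝ.sum (λ i → im (z i) * t i * normSquared (w i)) + 0#
            ≈⟨ ℝ.+-identityʳ _ ⟩
          ℝ.sum (λ i → im (z i) * t i * normSquared (w i)) ∎

      det-I+diag*≉0 : ¬ (det (I+diag* z Lᶜ) ᶜ.≈ fromReal 0#)
      det-I+diag*≉0 = accretive⇒det≉0 u M I+diag*-accretive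

-- The formal polynomial and its multiaffine function.

module PolynomialEvaluation {a ℓ} (R : RealNumbers a ℓ) where
  open RealNumbers R using (ℝ; 0#; _≈_)
  open RealProperties R
  open Complex R
  open ComplexRing R
  open Polynomials R
  open PortNetwork R using (multiaffine)
  open SubsetSums ℂ-commutativeRing using (listSum; listSum-++; listSum-map)
  private
    module ᶜ where
      open CommutativeRing ℂ-commutativeRing public
      open RingSolver ℂ-commutativeRing public
    module ᶜ-ops = RawSemiringDefinitions (RawRing.rawSemiring rawRingℂ)

  -- With the same body as `monomial`, this makes `𝒫` equal to `subsetPolynomial Ψ` by computation.
  exponents : ∀ {q} → Subset q → Vec ℕ q
  exponents I = Vec.tabulate (λ i → if does (i ∈? I) then 1 else 0)

  subsetPolynomial : ∀ {q} → (Subset q → ℝ) → Polynomial q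
  subsetPolynomial g = map (λ I → g I , exponents I) (subsets _)

  monomialValue : ∀ {q} → (Subset q → ℝ) → Vector ℂ q → Subset q → ℂ
  monomialValue g z I = fromReal (g I) ᶜ.* ᶜ-ops.product (λ i → z i ᶜ-ops.^ Vec.lookup (exponents I) i)

  evaluate-listSum : ∀ {q} (g : Subset q → ℝ) z Is →
    evaluate (map (λ I → g I , exponents I) Is) z ≡ listSum (monomialValue g z) Is
  evaluate-listSum g z []       = ≡.refl
  evaluate-listSum g z (I ∷ Is) = ≡.cong (monomialValue g z I ᶜ.+_) (evaluate-listSum g z Is)

  listSum-multiaffine : ∀ {q} (g : Subset q → ℝ) z → listSum (monomialValue g z) (subsets q) ᶜ.≈ multiaffine g z
  listSum-multiaffine {zero}  g z = ᶜ.trans (ᶜ.+-identityʳ _) (ᶜ.*-identityʳ (fromReal (g [])))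
  listSum-multiaffine {suc q} g z = ᶜ.trans
    (listSum-++ (monomialValue g z) (map (outside ∷_) (subsets q)) (map (inside ∷_) (subsets q)))
    (ᶜ.+-cong
      (ᶜ.trans (listSum-map (monomialValue g z) (monomialValue (g ∘ (outside ∷_)) (z ∘ suc)) ᶜ.1# (outside ∷_)
          (λ I → ᶜ.solve 2 (λ x y → x ᶜ.:* (ᶜ.con (1 , 0) ᶜ.:* y) ᶜ.:= ᶜ.con (1 , 0) ᶜ.:* (x ᶜ.:* y)) ᶜ.refl
              (fromReal (g (outside ∷ I))) (rest I)) (subsets q))
        (ᶜ.trans (ᶜ.*-identityˡ _) (listSum-multiaffine (g ∘ (outside ∷_)) (z ∘ suc))))
      (ᶜ.trans (listSum-map (monomialValue g z) (monomialValue (g ∘ (inside ∷_)) (z ∘ suc)) (z zero) (inside ∷_)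
          (λ I → ᶜ.solve 3 (λ x y z → x ᶜ.:* (z ᶜ.:* ᶜ.con (1 , 0) ᶜ.:* y) ᶜ.:= z ᶜ.:* (x ᶜ.:* y)) ᶜ.refl
              (fromReal (g (inside ∷ I))) (rest I) (z zero)) (subsets q))
        (ᶜ.*-congˡ {z zero} (listSum-multiaffine (g ∘ (inside ∷_)) (z ∘ suc)))))
    where
    rest : Subset q → ℂ
    rest I = ᶜ-ops.product (λ i → z (suc i) ᶜ-ops.^ Vec.lookup (exponents I) i)

  evaluate-subsetPolynomial : ∀ {q} (g : Subset q → ℝ) z → evaluate (subsetPolynomial g) z ᶜ.≈ multiaffine g z
  evaluate-subsetPolynomial g z = ᶜ.trans (ᶜ.reflexive (evaluate-listSum g z (subsets _))) (listSum-multiaffine g z)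

  exponents≤1 : ∀ {q} (I : Subset q) i → Vec.lookup (exponents I) i ℕ.≤ 1
  exponents≤1 I i rewrite Vec.lookup∘tabulate (λ i → if does (i ∈? I) then 1 else 0) i with does (i ∈? I)
  ... | true  = ℕ.≤-refl
  ... | false = ℕ.z≤n

  subsetPolynomial-multiaffine : ∀ {q} (g : Subset q → ℝ) → Multiaffine (subsetPolynomial g)
  subsetPolynomial-multiaffine {q} g e i 1<eᵢ = go (subsets q)
    where
    open CommutativeRing ℝ-ring using (refl)
    go : ∀ Is → coefficient (map (λ I → g I , exponents I) Is) e ≈ 0#
    go []       = refl
    go (I ∷ Is) with Vec.≡-dec ℕ._≟_ (exponents I) e
    ... | yes ≡.refl = contradiction (exponents≤1 I i) (ℕ.<⇒≱ 1<eᵢ)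
    ... | no _       = go Is

  subsetPolynomial-nonnegative : ∀ {q} (g : Subset q → ℝ) → (∀ I → NonNegative (g I)) →
      CoefficientwiseNonnegative (subsetPolynomial g)
  subsetPolynomial-nonnegative {q} g g≥0 e = nonNegative⇒0≤ (go (subsets q))
    where
    open CommutativeRing ℝ-ring using (refl)
    go : ∀ Is → NonNegative (coefficient (map (λ I → g I , exponents I) Is) e)
    go []       = inj₂ refl
    go (I ∷ Is) with does (Vec.≡-dec ℕ._≟_ (exponents I) e)
    ... | true  = +-nonNegative (g≥0 I) (go Is)
    ... | false = go Is

-- The weighted Laplacian and the energy form.

module NetworkEnergy {a ℓ} {R : RealNumbers a ℓ} {n m : ℕ} (G : Network R n m) where
  open RealNumbers R hiding (sum)
  open RealProperties R
  open Network G
  open Multigraph graph using (Joins)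
  open CommutativeRing ℝ-ring using (sym; trans; refl; setoid; *-congˡ; *-congʳ; *-cong; +-cong; -‿cong; zeroʳ; zeroˡ)
  open TreePolynomial ℝ-ring
  open Sums ℝ-ring
  open RingSolver ℝ-ring
  open SetoidReasoning setoid
  open MatrixOperations rawRing using (_*ⱽ_)
  open Labellings

  networkEdges : Edges n m
  networkEdges e = source e , target e

  source≢target : ∀ e → source e ≢ target e
  source≢target e = Fin.<⇒≢ (source<target e)

  -- The signed incidence matrix. Factoring the Laplacian through it and the conductances replaces a
  -- definition by cases with a sum over edges.
  incidence : Fin m → Fin n → ℝ
  incidence e v = indicator (target e ≟ v) - indicator (source e ≟ v)

  sum-incidence : ∀ e (φ : Vector ℝ n) → sum (λ v → incidence e v * φ v) ≈ drop φ (networkEdges e)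
  sum-incidence e φ = begin
    sum (λ v → incidence e v * φ v)
      ≈⟨ sum-cong (λ v → trans (solve 3 (λ x y z → (x :- y) :* z := x :* z :+ (:- con (1 , 0)) :* (y :* z)) refl
           (indicator (target e ≟ v)) (indicator (source e ≟ v)) (φ v))
           (+-cong (indicator-* (target e) v) (*-congˡ (indicator-* (source e) v)))) ⟩
    sum (λ v → at (target e) v + (- 1#) * at (source e) v)
      ≈⟨ ∑-distrib-+ (at (target e)) (λ v → (- 1#) * at (source e) v) ⟩
    sum (at (target e)) + sum (λ v → (- 1#) * at (source e) v)
      ≈⟨ +-cong (sum-indicator (target e) φ)
           (trans (sym (*-distribˡ-sum (- 1#) (at (source e)))) (*-congˡ (sum-indicator (source e) φ))) ⟩
    φ (target e) + (- 1#) * φ (source e)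
      ≈⟨ solve 2 (λ x y → x :+ (:- con (1 , 0)) :* y := x :- y) refl (φ (target e)) (φ (source e)) ⟩
    drop φ (networkEdges e) ∎
    where
    at : Fin n → Vector ℝ n
    at u v = if does (u ≟ v) then φ v else 0#
    indicator-* : ∀ u v → indicator (u ≟ v) * φ v ≈ at u v
    indicator-* u v with does (u ≟ v)
    ... | true  = CommutativeRing.*-identityˡ ℝ-ring (φ v)
    ... | false = zeroˡ (φ v)

  incidence-square : ∀ e v → (if does (incident? e v) then conductance e else 0#) ≈ conductance e *
      (incidence e v * incidence e v)
  incidence-square e v with source e ≟ v | target e ≟ v
  ... | yes ≡.refl | yes eq = contradiction (≡.sym eq) (source≢target e)
  ... | yes _      | no _   = solve 1
      (λ x → x := x :* ((con (0 , 0) :- con (1 , 0)) :* (con (0 , 0) :- con (1 , 0)))) refl (conductance e)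
  ... | no _       | yes _  = solve 1
      (λ x → x := x :* ((con (1 , 0) :- con (0 , 0)) :* (con (1 , 0) :- con (0 , 0)))) refl (conductance e)
  ... | no _       | no _   = solve 1
      (λ x → con (0 , 0) := x :* ((con (0 , 0) :- con (0 , 0)) :* (con (0 , 0) :- con (0 , 0)))) refl (conductance e)

  incidence-ends : ∀ e → incidence e (source e) * incidence e (target e) ≈ - 1#
  incidence-ends e = trans
    (*-cong (+-cong (indicator-no (target e ≟ source e) (source≢target e ∘ ≡.sym))
        (-‿cong (indicator-yes (source e ≟ source e) ≡.refl)))
            (+-cong (indicator-yes (target e ≟ target e) ≡.refl)
                (-‿cong (indicator-no (source e ≟ target e) (source≢target e)))))
    (solve 0 ((con (0 , 0) :- con (1 , 0)) :* (con (1 , 0) :- con (0 , 0)) := :- con (1 , 0)) refl)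

  incidence-joins : ∀ e {u v} → Joins e u v → incidence e u * incidence e v ≈ - 1#
  incidence-joins e (inj₁ (≡.refl , ≡.refl)) = incidence-ends e
  incidence-joins e (inj₂ (≡.refl , ≡.refl)) = trans (CommutativeRing.*-comm ℝ-ring _ _) (incidence-ends e)

  incidence-apart : ∀ e {u v} → u ≢ v → ¬ Joins e u v → incidence e u * incidence e v ≈ 0#
  incidence-apart e {u} {v} u≢v ¬joins = go (source e ≟ u) (target e ≟ u)
    where
    0-0≈0 : 0# - 0# ≈ 0#
    0-0≈0 = CommutativeRing.-‿inverseʳ ℝ-ring 0#
    incidence≈0 : ∀ w → source e ≢ w → target e ≢ w → incidence e w ≈ 0#
    incidence≈0 w s≢w t≢w = trans (+-cong (indicator-no (target e ≟ w) t≢w)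
        (-‿cong (indicator-no (source e ≟ w) s≢w))) 0-0≈0
    go : Dec (source e ≡ u) → Dec (target e ≡ u) → incidence e u * incidence e v ≈ 0#
    go (yes s≡u) _ = trans (*-congˡ
        (incidence≈0 v (λ s≡v → u≢v (≡.trans (≡.sym s≡u) s≡v)) (λ t≡v → ¬joins (inj₁ (s≡u , t≡v))))) (zeroʳ _)
    go (no _) (yes t≡u) = trans (*-congˡ
        (incidence≈0 v (λ s≡v → ¬joins (inj₂ (s≡v , t≡u))) (λ t≡v → u≢v (≡.trans (≡.sym t≡u) t≡v)))) (zeroʳ _)
    go (no s≢u) (no t≢u) = trans (*-congʳ (incidence≈0 u s≢u t≢u)) (zeroˡ _)

  -- `source<target` excludes a second copy recorded in the opposite direction. Thus the edge found
  -- by `any?` is the only one contributing to an off-diagonal entry.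
  joins-unique : ∀ {e f u v} → Joins e u v → Joins f u v → e ≡ f
  joins-unique {e} {f} (inj₁ (≡.refl , ≡.refl)) (inj₁ (p , q)) = simple e f (≡.sym p) (≡.sym q)
  joins-unique {e} {f} (inj₁ (≡.refl , ≡.refl)) (inj₂ (p , q)) =
    contradiction (source<target e) (Fin.<-asym (≡.subst₂ Fin._<_ p q (source<target f)))
  joins-unique {e} {f} (inj₂ (≡.refl , ≡.refl)) (inj₁ (p , q)) =
    contradiction (source<target e) (Fin.<-asym (≡.subst₂ Fin._<_ p q (source<target f)))
  joins-unique {e} {f} (inj₂ (≡.refl , ≡.refl)) (inj₂ (p , q)) = simple e f (≡.sym p) (≡.sym q)

  laplacian-incidence : ∀ u v → laplacian u v ≈ sum (λ e → conductance e * (incidence e u * incidence e v))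
  laplacian-incidence u v with u ≟ v | any? (joins? u v)
  ... | yes ≡.refl | _        = sum-cong λ e → incidence-square e u
  ... | no u≢v | yes (e , j)  = sym (trans (sum-cong term′) (sum-indicator e (λ f → - conductance f)))
    where
    term′ : ∀ f → conductance f * (incidence f u * incidence f v) ≈ (if does (e ≟ f) then - conductance f else 0#)
    term′ f with e ≟ f
    ... | yes ≡.refl = trans (*-congˡ (incidence-joins e j))
        (solve 1 (λ x → x :* (:- con (1 , 0)) := :- x) refl (conductance e))
    ... | no e≢f     = trans (*-congˡ (incidence-apart f u≢v (λ j′ → e≢f (joins-unique j j′)))) (zeroʳ _)
  ... | no u≢v | no ¬j        = sym
      (sum-zero λ f → trans (*-congˡ (incidence-apart f u≢v (λ j → ¬j (f , j)))) (zeroʳ _))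

  laplacian-energy : ∀ U φ → sum (λ v → φ v * (laplacian *ⱽ U) v) ≈ energy networkEdges conductance U φ
  laplacian-energy U φ = begin
    sum (λ v → φ v * (laplacian *ⱽ U) v)
      ≈⟨ sum-cong (λ v → *-congˡ (currents-incidence v)) ⟩
    sum (λ v → φ v * sum (λ e → incidence e v * (conductance e * d e)))
      ≈⟨ sum-cong (λ v → trans (*-distribˡ-sum (φ v) (λ e → incidence e v * (conductance e * d e)))
           (sum-cong λ e → solve 3 (λ x y z → x :* (y :* z) := z :* (y :* x)) refl (φ v) (incidence e v)
               (conductance e * d e))) ⟩
    sum (λ v → sum (λ e → conductance e * d e * (incidence e v * φ v)))
      ≈⟨ ∑-comm (λ v e → conductance e * d e * (incidence e v * φ v)) ⟩
    sum (λ e → sum (λ v → conductance e * d e * (incidence e v * φ v)))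
      ≈⟨ sum-cong (λ e → trans (sym (*-distribˡ-sum (conductance e * d e) (λ v → incidence e v * φ v)))
           (*-congˡ (sum-incidence e φ))) ⟩
    energy networkEdges conductance U φ ∎
    where
    d : Fin m → ℝ
    d e = drop U (networkEdges e)
    currents-incidence : ∀ v → (laplacian *ⱽ U) v ≈ sum (λ e → incidence e v * (conductance e * d e))
    currents-incidence v = begin
      sum (λ w → laplacian v w * U w)
        ≈⟨ sum-cong (λ w → trans (*-congʳ (laplacian-incidence v w))
             (trans (*-distribʳ-sum (U w) (λ e → conductance e * (incidence e v * incidence e w)))
             (sum-cong λ e → solve 4 (λ c x y u → c :* (x :* y) :* u := x :* c :* (y :* u)) refl (conductance e)
                 (incidence e v) (incidence e w) (U w)))) ⟩
      sum (λ w → sum (λ e → incidence e v * conductance e * (incidence e w * U w)))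
        ≈⟨ ∑-comm (λ w e → incidence e v * conductance e * (incidence e w * U w)) ⟩
      sum (λ e → sum (λ w → incidence e v * conductance e * (incidence e w * U w)))
        ≈⟨ sum-cong (λ e → trans (sym (*-distribˡ-sum (incidence e v * conductance e) (λ w → incidence e w * U w)))
             (trans (*-congˡ (sum-incidence e U))
                 (CommutativeRing.*-assoc ℝ-ring (incidence e v) (conductance e) (d e)))) ⟩
      sum (λ e → incidence e v * (conductance e * d e)) ∎

-- Independence of the ports, reciprocity and nonnegative coefficients.

module PortNetworkProperties {a ℓ} (R : RealNumbers a ℓ) where
  open RealNumbers R hiding (sum)
  open RealProperties R
  open PortNetwork R
  open Labellings
  open CommutativeRing ℝ-ring using (sym; trans; *-congˡ; *-identityʳ; zeroʳ)
  open TreePolynomial ℝ-ring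
  open Sums ℝ-ring
  open MatrixOperations rawRing using (_*ⱽ_)

  -- Derived from solvability and not from the shape of the superports: with the earlier ports
  -- contracted, the next one can still be given voltage 1, so its ends are distinct.
  ports-forest : ∀ {n m q} {E : Edges n m} {c} (P : Edges n q) L {ρ} → IsResponse E c P L ρ → Forest ρ P ⊤
  ports-forest {q = zero}  P L response = tt
  ports-forest {q = suc q} {E} {c} P L {ρ} response = port-notLoop {E = E} {c} {P} {L} {ρ} response ,
    ports-forest {E = E} {c} (tail P) (minor₀₀ L) (response-short {E = E} {c} {P} {L} {ρ} response)

  unitVector : ∀ {q} → Fin q → Vector ℝ q
  unitVector i j = if does (i ≟ j) then 1# else 0#

  sum-unitVector : ∀ {q} (i : Fin q) (f : Vector ℝ q) → sum (λ k → f k * unitVector i k) ≈ f i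
  sum-unitVector i f = trans (sum-cong eq) (sum-indicator i f)
    where
    eq : ∀ k → f k * unitVector i k ≈ (if does (i ≟ k) then f k else 0#)
    eq k with does (i ≟ k)
    ... | true  = *-identityʳ (f k)
    ... | false = zeroʳ (f k)

  -- Reciprocity: the energy pairing of the responses to unit voltages at two ports is an entry of
  -- `L`, read in either order, and the pairing is symmetric.
  response-symmetric : ∀ {n m q} {E : Edges n m} {c} {P : Edges n q} {L ρ} → IsResponse E c P L ρ → ∀ i j →
      L i j ≈ L j i
  response-symmetric {E = E} {c} {P} {L} {ρ} response i j = trans (sym (entry j i))
      (trans (energy-sym E c (U j) (U i)) (entry i j))
    where
    U : Fin _ → Vector ℝ _
    U i = proj₁ (response (unitVector i))
    entry : ∀ i j → energy E c (U i) (U j) ≈ L j i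
    entry i j = trans (proj₂ (proj₂ (proj₂ (response (unitVector i)))) (U j) (proj₁ (proj₂ (response (unitVector j)))))
      (trans (sum-cong λ k → *-congˡ (proj₁ (proj₂ (proj₂ (response (unitVector j)))) k))
      (trans (sum-unitVector j (L *ⱽ unitVector i)) (sum-unitVector i (L j))))

  portMinor-nonNegative : ∀ {n q} {F : Labelling n → ℝ} (P : Edges n q) I → (∀ σ → NonNegative (F σ)) →
    ∀ ρ → NonNegative (SubsetSums.portMinor ℝ-ring F P I ρ)
  portMinor-nonNegative P []            F≥0 = F≥0
  portMinor-nonNegative P (inside ∷ I)  F≥0 = portMinor-nonNegative (tail P) I F≥0
  portMinor-nonNegative P (outside ∷ I) F≥0 =
    Positivity./-nonNegative R (P zero) (portMinor-nonNegative (tail P) I F≥0)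

-- Valid forests and port graphs as trees modulo contracted ports.

module SuperportCombinatorics {a ℓ} {R : RealNumbers a ℓ} {n m p q : ℕ} (G : Network R n m) (S : Superports n p q) where
  open Network G
  open Superports S
  open SuperportNetwork G S
  open NetworkEnergy G using (networkEdges)
  open Labellings
  private
    module graph = MultigraphLabelling graph id id id

  ports : Edges n q
  ports i = rootOf i , x i

  module portGraph (F : Subset m) =
    MultigraphLabelling (portGraph F) (contract id networkEdges F) graph.walk⇒label graph.label⇒walk

  x∈A⇒port : ∀ {b i} → x i ∈ A b → port i ≡ b
  x∈A⇒port {i = i} = disjoint (x∈ i)

  -- The ports of a superport form a star around its root, so contracting all ports carries out the
  -- identification of the superports.
  shorted : Labelling n
  shorted = contract id ports ⊤

  identified⇒shorted : ∀ {u v} → Identified u v → shorted u ≡ shorted v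
  identified⇒shorted (inj₁ ≡.refl) = ≡.refl
  identified⇒shorted (inj₂ (b , u∈ , v∈)) = ≡.trans (toRoot u∈) (≡.sym (toRoot v∈))
    where
    toRoot : ∀ {v} → v ∈ A b → shorted v ≡ shorted (root b)
    toRoot {v} v∈ with v ≟ root b
    ... | yes v≡r = ≡.cong shorted v≡r
    ... | no v≢r with x-all v∈ v≢r
    ...   | i , ≡.refl with x∈A⇒port {b} {i} v∈
    ...     | ≡.refl = ≡.sym (contract-loop id ports {⊤} {i} ∈⊤)

  shorted⇒identified : ∀ {u v} → shorted u ≡ shorted v → Identified u v
  shorted⇒identified = contract-least (IsDecEquivalence.isEquivalence identified-isDecEquivalence) id ports ⊤ inj₁
    (λ {i} _ → inj₂ (port i , root∈ (port i) , x∈ i))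

  private
    module quotient = MultigraphLabelling quotientNetwork shorted identified⇒shorted shorted⇒identified

  valid⇔tree : ∀ F → Valid F ⇔ Tree shorted networkEdges F
  valid⇔tree F = mk⇔ (λ (_ , tree) → quotient.spanningTree⇒tree tree)
    (λ tree → graph.forest⇒acyclic (forest-mono {ρ = shorted} networkEdges F (contract-⊑ id ports ⊤) (proj₁ tree)) ,
              quotient.tree⇒spanningTree tree)

  -- Both sides say that `F` and the ports outside `I` form a spanning tree of the enlarged graph;
  -- one contracts `F` first, the other the ports. `forest-exchange` and `contract-swap` pass
  -- between them.
  contributes⇔tree : ∀ I F → Contributes I F ⇔ (Forest id ports (∁ I) × Tree (contract id ports (∁ I)) networkEdges F)
  contributes⇔tree I F = mk⇔ to from
    where
    σ ρ′ : Labelling n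
    σ = contract id networkEdges F
    ρ′ = contract id ports (∁ I)
    to : Contributes I F → Forest id ports (∁ I) × Tree ρ′ networkEdges F
    to ((acyclic , _) , tree) with portGraph.spanningTree⇒tree F tree
    ... | forest , total = forest-mono {ρ = σ} ports (∁ I) (contract-⊑ id networkEdges F) forest ,
      forest-exchange id networkEdges F ports (∁ I) (graph.acyclic⇒forest acyclic) forest ,
      λ u v → contract-swap id networkEdges F ports (∁ I) (total u v)
    from : Forest id ports (∁ I) × Tree ρ′ networkEdges F → Contributes I F
    from (ports-forest , forest , total) =
      (graph.forest⇒acyclic (forest-mono {ρ = ρ′} networkEdges F (contract-⊑ id ports (∁ I)) forest) ,
       -- The ports outside `I` form a tree on the components of `F`, so there is one component more
       -- than such ports. A root supplies the vertex of the final class.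
       ≡.trans (transversal-unique (graph.components F)
           (tree⇒transversal σ ports (∁ I) (root (someSuperport p≢0)) tree))
               (≡.cong (ℕ._+ 1) (∣∁p∣≡n∸∣p∣ I))) ,
      portGraph.tree⇒spanningTree F tree
      where
      tree : Tree σ ports (∁ I)
      tree = forest-exchange id ports (∁ I) networkEdges F ports-forest forest ,
             λ u v → contract-swap id ports (∁ I) networkEdges F (total u v)
      someSuperport : ∀ {p} → ℕ.NonZero p → Fin p
      someSuperport {suc p} _ = zero

  empty⇒∁≡⊤ : ∀ {I : Subset q} → Empty I → ∁ I ≡ ⊤
  empty⇒∁≡⊤ empty = ⊆-antisym ⊆⊤ (λ {i} _ → x∉p⇒x∈∁p (λ i∈I → empty (i , i∈I)))

  open RealNumbers R hiding (sum)
  open RealProperties R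
  open CommutativeRing ℝ-ring using (sym; trans)
  open TreePolynomial ℝ-ring using (τ)
  open SubsetSums ℝ-ring

  Φ-valid≈τ : Φ-valid ≈ τ networkEdges conductance shorted
  Φ-valid≈τ = subsetSum-tree networkEdges conductance shorted valid? valid⇔tree

  -- For empty `I` the coefficient is defined by valid forests, which say nothing about independence
  -- of the ports; the hypothesis provides this part of the minor.
  Ψ≈portMinor : Forest id ports ⊤ → ∀ I → Ψ I ≈ portMinor (τ networkEdges conductance) ports I id
  Ψ≈portMinor ports-forest I with nonempty? I
  ... | yes _    = subsetSum-portMinor networkEdges conductance ports I id (contributes? I) (contributes⇔tree I)
  ... | no empty = subsetSum-portMinor networkEdges conductance ports I id valid? equivalence
    where
    equivalence : ∀ F → Valid F ⇔ (Forest id ports (∁ I) × Tree (contract id ports (∁ I)) networkEdges F)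
    equivalence F rewrite empty⇒∁≡⊤ empty = mk⇔ (λ valid → ports-forest , Equivalence.to (valid⇔tree F) valid)
      (λ (_ , tree) → Equivalence.from (valid⇔tree F) tree)

  contract-⊤-total : ∀ ρ → Total (contract ρ networkEdges ⊤)
  contract-⊤-total ρ u v = contract-mono {ρ = id} {ρ} networkEdges {⊤} (≡.cong ρ) id (graph.walk⇒label (connected u v))

-- From superport currents to the weak port response.

module SuperportResponse {a ℓ} {R : RealNumbers a ℓ} {n m p q : ℕ} (G : Network R n m) (S : Superports n p q) where
  open RealNumbers R hiding (sum)
  open RealProperties R
  open Network G
  open Superports S
  open SuperportNetwork G S
  open SuperportCombinatorics G S
  open NetworkEnergy G
  open PortNetwork R using (IsResponse)
  open CommutativeRing ℝ-ring using
      (sym; trans; refl; setoid; *-congˡ; *-congʳ; +-congˡ; -‿cong; +-identityʳ; zeroʳ; zeroˡ; -‿inverseʳ; *-comm)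
  open TreePolynomial ℝ-ring using (drop; energy)
  open Sums ℝ-ring
  open RingSolver ℝ-ring
  open SetoidReasoning setoid
  open MatrixOperations rawRing using (_*ⱽ_)

  module _ {y U} (admissible : Admissible y U) (φ : Vector ℝ n) where
    open Admissible admissible

    private
      ι = currents U

    -- On each superport the value of `φ` at the root, elsewhere 0. As each superport has total
    -- current 0, this part pairs to 0 with the currents, and only differences to the roots remain.
    rootPotential : Vector ℝ n
    rootPotential v = sum (λ b → if does (v ∈? A b) then φ (root b) else 0#)

    rootPotential-A : ∀ {b v} → v ∈ A b → rootPotential v ≈ φ (root b)
    rootPotential-A {b} {v} v∈ = trans (sum-cong same) (sum-indicator b (φ ∘ root))
      where
      same : ∀ b′ → (if does (v ∈? A b′) then φ (root b′) else 0#) ≈ (if does (b ≟ b′) then φ (root b′) else 0#)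
      same b′ with v ∈? A b′ | b ≟ b′
      ... | yes _  | yes _      = refl
      ... | no _   | no _       = refl
      ... | yes v∈′ | no b≢b′   = contradiction (disjoint v∈ v∈′) b≢b′
      ... | no v∉  | yes ≡.refl = contradiction v∈ v∉

    sum-rootPotential : sum (λ v → rootPotential v * ι v) ≈ 0#
    sum-rootPotential = begin
      sum (λ v → rootPotential v * ι v)
        ≈⟨ sum-cong (λ v → trans (*-distribʳ-sum (ι v) (λ b → if does (v ∈? A b) then φ (root b) else 0#))
             (sum-cong (move v))) ⟩
      sum (λ v → sum (λ b → φ (root b) * (if does (v ∈? A b) then ι v else 0#)))
        ≈⟨ ∑-comm (λ v b → φ (root b) * (if does (v ∈? A b) then ι v else 0#)) ⟩
      sum (λ b → sum (λ v → φ (root b) * (if does (v ∈? A b) then ι v else 0#)))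
        ≈⟨ sum-zero (λ b → trans (sym (*-distribˡ-sum (φ (root b)) (λ v → if does (v ∈? A b) then ι v else 0#)))
             (trans (*-congˡ (balanced b)) (zeroʳ _))) ⟩
      0# ∎
      where
      move : ∀ v b → (if does (v ∈? A b) then φ (root b) else 0#) * ι v ≈ φ (root b) *
          (if does (v ∈? A b) then ι v else 0#)
      move v b with does (v ∈? A b)
      ... | true  = refl
      ... | false = trans (zeroˡ _) (sym (zeroʳ _))

    weak-currents : sum (λ v → φ v * ι v) ≈ sum (λ i → ι (x i) * drop φ (ports i))
    weak-currents = begin
      sum (λ v → φ v * ι v)
        ≈⟨ sum-cong (λ v → solve 3 (λ f r i → f :* i := (f :- r) :* i :+ r :* i) refl (φ v) (rootPotential v) (ι v)) ⟩
      sum (λ v → (φ v - rootPotential v) * ι v + rootPotential v * ι v)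
        ≈⟨ ∑-distrib-+ (λ v → (φ v - rootPotential v) * ι v) (λ v → rootPotential v * ι v) ⟩
      sum (λ v → (φ v - rootPotential v) * ι v) + sum (λ v → rootPotential v * ι v)
        ≈⟨ trans (+-congˡ sum-rootPotential) (+-identityʳ _) ⟩
      sum (λ v → (φ v - rootPotential v) * ι v)
        ≈⟨ sum-injective x x-inj (λ v → (φ v - rootPotential v) * ι v) off-ports ⟩
      sum (λ i → (φ (x i) - rootPotential (x i)) * ι (x i))
        ≈⟨ sum-cong (λ i → trans (*-congʳ (+-congˡ (-‿cong (rootPotential-A (x∈ i))))) (*-comm _ _)) ⟩
      sum (λ i → ι (x i) * drop φ (ports i)) ∎
      where
      -- At interior vertices the current vanishes, at roots the difference of potentials.
      off-ports : ∀ v → (∀ i → x i ≢ v) → (φ v - rootPotential v) * ι v ≈ 0#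
      off-ports v v≢x with any? (λ b → v ∈? A b)
      ... | no ¬boundary = trans (*-congˡ (interior v ¬boundary)) (zeroʳ _)
      ... | yes (b , v∈) with v ≟ root b
      ...   | yes ≡.refl = trans (*-congʳ (trans (+-congˡ (-‿cong (rootPotential-A v∈))) (-‿inverseʳ _))) (zeroˡ _)
      ...   | no v≢r     = contradiction (proj₂ (x-all v∈ v≢r)) (v≢x (proj₁ (x-all v∈ v≢r)))

  -- The equivalence is read backwards at the current `L y`, where it yields a voltage function for
  -- every `y`.
  superportResponse⇒response : ∀ L → IsSuperportResponse L → IsResponse networkEdges conductance ports L id
  superportResponse⇒response L isResponse y with Equivalence.from (isResponse y (L *ⱽ y)) (λ i → refl)
  ... | U , admissible , j≈ι = U , (λ { ≡.refl → refl }) , Admissible.voltages admissible , λ φ _ → begin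
    energy networkEdges conductance U φ        ≈⟨ laplacian-energy U φ ⟨
    sum (λ v → φ v * currents U v)             ≈⟨ weak-currents admissible φ ⟩
    sum (λ i → currents U (x i) * drop φ (ports i)) ≈⟨ sum-cong (λ i → *-congʳ (j≈ι i)) ⟨
    sum (λ i → (L *ⱽ y) i * drop φ (ports i)) ∎

theorem5p4 : ∀ {a ℓ} (R : RealNumbers a ℓ) {n m p q : ℕ}
    (G : Network R n m) (S : Superports n p q) →
    let open RealNumbers R using (ℝ)
        open Complex R
        open Polynomials R
        open MatrixOperations rawRingℂ
        open SuperportNetwork G S
    in
    (L : Matrix ℝ q q) → IsSuperportResponse L →
    ((z : Vector ℂ q) →
      evaluate 𝒫 z ℂ-ring.≈
        fromReal Φ-valid ℂ-ring.* det (1ᴹ +ᴹ diag z *ᴹ (λ i j → fromReal (L i j))))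
    × Multiaffine 𝒫
    × CoefficientwiseNonnegative 𝒫
    × RealStable 𝒫
theorem5p4 R {q = q} G S L isResponse =
  formula , subsetPolynomial-multiaffine Ψ , subsetPolynomial-nonnegative Ψ Ψ-nonNegative , stable
  where
  open RealNumbers R using (ℝ; _*_; _≈_; 1#)
  open RealProperties R
  open Complex R
  open ComplexRing R
  open Polynomials R using (evaluate; RealStable)
  open MatrixOperations rawRingℂ
  open SuperportNetwork G S
  open Network G using (conductance; conductance>0)
  open PolynomialEvaluation R
  open PortNetwork R using (IsResponse; portMinor-determinant; multiaffine-cong)
  open PortNetworkProperties R
  open NetworkEnergy G using (networkEdges)
  open SuperportCombinatorics G S
  open SuperportResponse G S
  open Positivity R
  open Determinant ℂ-commutativeRing using (I+diag*; I+diag*-spec; det-cong)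
  module ℝ = CommutativeRing ℝ-ring
  module ᶜ = CommutativeRing ℂ-commutativeRing

  Lᶜ : Matrix ℂ q q
  Lᶜ i j = fromReal (L i j)

  response : IsResponse networkEdges conductance ports L id
  response = superportResponse⇒response L isResponse

  Ψ≈ : ∀ I → Ψ I ≈ _
  Ψ≈ = Ψ≈portMinor (ports-forest {E = networkEdges} {conductance} ports L {id} response)

  Ψ-nonNegative : ∀ I → NonNegative (Ψ I)
  Ψ-nonNegative I = Sum.map (<-respʳ (ℝ.sym (Ψ≈ I))) (ℝ.trans (Ψ≈ I))
    (portMinor-nonNegative ports I (τ-nonNegative networkEdges conductance>0) id)

  determinant : ∀ z → det (1ᴹ +ᴹ diag z *ᴹ Lᶜ) ᶜ.≈ det (I+diag* z Lᶜ)
  determinant z = det-cong (1ᴹ +ᴹ diag z *ᴹ Lᶜ) (I+diag* z Lᶜ) (I+diag*-spec z Lᶜ)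

  formula : ∀ z → evaluate 𝒫 z ᶜ.≈ fromReal Φ-valid ᶜ.* det (1ᴹ +ᴹ diag z *ᴹ Lᶜ)
  formula z = ᶜ.trans (evaluate-subsetPolynomial Ψ z) (ᶜ.trans (multiaffine-cong z Ψ≈)
    (ᶜ.trans (portMinor-determinant networkEdges conductance>0 ports L id (contract-⊤-total id) response z)
    (ᶜ.*-cong (fromReal-cong (ℝ.sym Φ-valid≈τ)) (ᶜ.sym (determinant z)))))

  -- The quotient of a connected network is connected, so `Φ-valid` is positive and can be cancelled
  -- at a supposed zero of `𝒫`.
  inverse : ∃[ t ] Φ-valid * t ≈ 1#
  inverse = pos⇒inverse (<-respʳ (ℝ.sym Φ-valid≈τ)
      (τ-pos networkEdges conductance>0 shorted (contract-⊤-total shorted)))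

  stable : RealStable 𝒫
  stable z z>0 𝒫≈0 = Stability.det-I+diag*≉0 R L
      (response-symmetric {E = networkEdges} {conductance} {ports} {L} {id} response) z z>0
    (ᶜ.trans (ᶜ.sym (determinant z)) (ᶜ.trans (ᶜ.sym (ᶜ.*-identityˡ d)) (ᶜ.trans (ᶜ.*-congʳ {d} (ᶜ.sym tΦ≈1))
      (ᶜ.trans (ᶜ.*-assoc t (fromReal Φ-valid) d)
          (ᶜ.trans (ᶜ.*-congˡ {t} (ᶜ.trans (ᶜ.sym (formula z)) 𝒫≈0)) (ᶜ.zeroʳ t))))))
    where
    d t : ℂ
    d = det (1ᴹ +ᴹ diag z *ᴹ Lᶜ)
    t = fromReal (proj₁ inverse)
    tΦ≈1 : t ᶜ.* fromReal Φ-valid ᶜ.≈ fromReal 1#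
    tΦ≈1 = ᶜ.trans (ᶜ.sym (fromReal-* _ _)) (fromReal-cong (ℝ.trans (ℝ.*-comm _ _) (proj₂ inverse)))
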